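{- For all positive integers $m$ and $p$, \[ 2\sum_{n=1}^\infty\frac{T_n(\{1\}_{2m-2})T_n(\{1\}_{2p-2})}{2n-1}(-1)^n=(-1)^{m-1}\sum_{j=1}^pW(2j+2m-3,2m-1)\,Z(j,p). \]
   Context: $\{1\}_r$ denotes $1,\dots,1$ ($r$ times). For positive integers $n$ and $r\ge0$, $T_n(\{1\}_r):=2^r\sum\frac{1}{m_1\cdots m_r}$ over integers $0<m_1<\cdots<m_r<2n$ with $m_i\equiv i\pmod 2$ for all $i$ (empty sum $=0$, and $T_n(\emptyset):=1$). Alternating multiple $T$-value: $\bar T(k_1,\ldots,k_r):=2^r\sum_{0<n_1<\cdots<n_r}\frac{(-1)^{n_r}}{(2n_1-1)^{k_1}(2n_2-2)^{k_2}\cdots(2n_r-r)^{k_r}}$. For $k\ge r$, $I(k,r)$ is the set of $r$-tuples of positive integers summing to $k$, and $W(k,r):=\sum_{(k_1,\dots,k_r)\in I(k,r)}\bar T(k_1,\dots,k_r)$. $\bar\zeta(s):=\sum_{n\ge1}(-1)^{n-1}n^{ -s}$. For $1\le j\le p$, $Z(j,p):=\sum_{k=1}^{p-j}(-2)^k\sum_{j=i_0<i_1<\cdots<i_k=p}\prod_{l=1}^k\bar\zeta(2i_l-2i_{l-1})$ for $j<p$, and $Z(p,p):=1$. -}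

module Defs where

open import Data.Nat as ℕ using (ℕ; zero; suc; _∸_; _%_; _≡ᵇ_)
open import Data.Integer using (+_)
open import Data.Rational using (ℚ; _/_; 0ℚ; 1ℚ; -_; _+_; _*_)
open import Data.List using (List; []; _∷_; map; concatMap; foldr)
open import Data.Bool using (if_then_else_)

-- ℚ-valued 1/d for a natural d (d = 0 never occurs in the uses below; mapped to 0)
inv : ℕ → ℚ
inv zero = 0ℚ
inv (suc d) = + 1 / suc d

pow : ℚ → ℕ → ℚ
pow x zero = 1ℚ
pow x (suc k) = x * pow x k

sgn : ℕ → ℚ
sgn zero = 1ℚ
sgn (suc n) = - sgn n

two : ℚ
two = + 2 / 1

range : ℕ → ℕ → List ℕ
range a b = go a (suc b ∸ a)
  where
  go : ℕ → ℕ → List ℕ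
  go x zero = []
  go x (suc c) = x ∷ go (suc x) c

sumℚ : List ℚ → ℚ
sumℚ = foldr _+_ 0ℚ

prodℚ : List ℚ → ℚ
prodℚ = foldr _*_ 1ℚ

Σ[_⋯_] : ℕ → ℕ → (ℕ → ℚ) → ℚ
Σ[ a ⋯ b ] f = sumℚ (map f (range a b))

-- T_n({1}_r) = 2^r Σ_{0<m_1<⋯<m_r<2n, m_i ≡ i (mod 2)} 1/(m_1⋯m_r)

-- tsum r i prev b : sum over prev < m_i < m_{i+1} < ⋯ (r more terms) < b,
-- with m_l ≡ l (mod 2), of Π 1/m_l
tsum : ℕ → ℕ → ℕ → ℕ → ℚ
tsum zero i prev b = 1ℚ
tsum (suc r) i prev b =
  Σ[ suc prev ⋯ b ∸ 1 ] (λ m →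
    if (m % 2) ≡ᵇ (i % 2) then inv m * tsum r (suc i) m b else 0ℚ)

T : ℕ → ℕ → ℚ
T n r = pow two r * tsum r 1 0 (2 ℕ.* n)

-- Partial sums (truncated at N) of alternating multiple T-values
-- T̄(k_1,…,k_r) = 2^r Σ_{0<n_1<⋯<n_r} (-1)^{n_r} / Π (2n_i - i)^{k_i},
-- truncated to n_r ≤ N.

tbarSum : List ℕ → ℕ → ℕ → ℕ → ℚ
tbarSum [] i prev N = sgn prev
tbarSum (k ∷ ks) i prev N =
  Σ[ suc prev ⋯ N ] (λ n → pow (inv (2 ℕ.* n ∸ i)) k * tbarSum ks (suc i) n N)

length : List ℕ → ℕ
length [] = 0
length (_ ∷ xs) = suc (length xs)

Tbar : ℕ → List ℕ → ℚ
Tbar N ks = pow two (length ks) * tbarSum ks 1 0 N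

I : ℕ → ℕ → List (List ℕ)
I k zero = if k ≡ᵇ 0 then [] ∷ [] else []
I k (suc r) = concatMap (λ a → map (a ∷_) (I (k ∸ a) r)) (range 1 k)

W : ℕ → ℕ → ℕ → ℚ
W N k r = sumℚ (map (Tbar N) (I k r))

zbar : ℕ → ℕ → ℚ
zbar N s = Σ[ 1 ⋯ N ] (λ n → sgn (n ∸ 1) * pow (inv n) s)

chains : ℕ → ℕ → ℕ → List (List ℕ)
chains s e zero = if s ≡ᵇ e then [] ∷ [] else []
chains s e (suc k) = concatMap (λ i → map (i ∷_) (chains i e k)) (range (suc s) e)

chainProd : ℕ → ℕ → List ℕ → ℚ
chainProd N s [] = 1ℚ
chainProd N s (i ∷ is) = zbar N (2 ℕ.* i ∸ 2 ℕ.* s) * chainProd N i is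

Z : ℕ → ℕ → ℕ → ℚ
Z N j p = if j ≡ᵇ p then 1ℚ else
  Σ[ 1 ⋯ p ∸ j ] (λ k → pow (- two) k * sumℚ (map (chainProd N j) (chains j p k)))

LHS : ℕ → ℕ → ℕ → ℚ
LHS N m p = two * Σ[ 1 ⋯ N ] (λ n →
  T n (2 ℕ.* m ∸ 2) * T n (2 ℕ.* p ∸ 2) * inv (2 ℕ.* n ∸ 1) * sgn n)

RHS : ℕ → ℕ → ℕ → ℚ
RHS N m p = sgn (m ∸ 1) * Σ[ 1 ⋯ p ] (λ j →
  W N ((2 ℕ.* j) ℕ.+ (2 ℕ.* m) ∸ 3) (2 ℕ.* m ∸ 1) * Z N j p)

open import Relation.Binary.PropositionalEquality using (_≡_; refl)
private
  -- T_2({1}_2) = 4 * (1/(1*2)) = 2   (pairs 0<m1<m2<4, m1 odd, m2 even: (1,2))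
  chk1 : T 2 2 ≡ two
  chk1 = refl
  chk2 : I 3 2 ≡ (1 ∷ 2 ∷ []) ∷ (2 ∷ 1 ∷ []) ∷ []
  chk2 = refl
  chk3 : chains 1 3 2 ≡ (2 ∷ 3 ∷ []) ∷ []
  chk3 = refl

{-# OPTIONS --safe #-}

-- For s in [0,1] put v = (1-s)/(1+s), L = log (1/s) and Θ = arctan v = π/4 - arctan s, so that
-- ds/s = -2dv/(1-v²) and ds/(1+s²) = -dv/(1+v²) = -dΘ.  Consider
--   X = ∫ L^{2q}/(2q)! Θ^{2m-2}/(2m-2)! ds/(1+s²)   over 0 < s < 1.
-- Expanding 1/(1+s²) in powers of s and integrating by parts repeatedly gives
--   W(2q+2m-1, 2m-1) = -2^{2m-1} X.
-- Expanding in powers of v instead gives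
--   Σ_n (-1)^n T_n({1}_{2m-2}) A(2n-1) = (-1)^m 4^{m-1} X,   A(b) = ∫ v^{b-1} L^{2q}/(2q)! dv,
-- and the recurrence (b+2) A_e(b+2) - b A_e(b) = 2 A_{e-1}(b+1) in the power e of L yields
--   (2n-1) A(2n-1) = Σ_j c_{q-j} T_n({1}_{2j}),   c_0 = 1,  c_d = ∫ L^{2d}/(2d)! dv = 2 ζ̄(2d).
-- Hence LHS(m,·) convolved with c is (-1)^{m-1} W, and Z is the convolution inverse of c.
-- Integrals are replaced by Riemann sums of mesh 1/(n+1) with n independent of the truncation N:
-- for fixed N all identities hold up to O(1/n), and truncation costs O((log N)^k / N).
module Submission where

open import Defs
open import Data.Nat as ℕ using (ℕ; zero; suc; _∸_; _%_; _≡ᵇ_; z≤n; s≤s)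
import Data.Nat.Properties as ℕP
import Data.Nat.Solver
import Data.Integer as ℤ
import Data.Integer.Properties as ℤP
open import Data.Rational using (ℚ; 0ℚ; 1ℚ; ½; -_; _+_; _*_; _-_; _≤_; _<_; ∣_∣; 1/_; mkℚ; toℚᵘ; nonNegative; Positive; positive; NonZero)
open import Data.Rational.Properties
import Data.Rational.Unnormalised as ℚᵘ
import Data.Rational.Unnormalised.Properties as ℚᵘP
open import Data.Rational.Solver
open import Data.Product using (∃-syntax; _×_; _,_; proj₁; proj₂)
open import Data.Sum using (inj₁; inj₂)
open import Data.Empty using (⊥-elim)
open import Data.List using (List; []; _∷_; _++_; map; concatMap)
open import Data.List.Properties using (map-++; map-cong; map-∘)
open import Data.Bool using (Bool; true; false; if_then_else_)
open import Function using (_∘_)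
open import Relation.Nullary using (yes; no)
open import Relation.Binary.PropositionalEquality

open +-*-Solver using (solve; _:+_; _:*_; _:-_; :-_; _:=_; con)
module NS = Data.Nat.Solver.+-*-Solver

-- Finite sums in ℚ

-- Everything has to happen in ℚ, where no integral, logarithm or arctangent is available. A
-- comparison at fixed N has the form |d(N)| ≤ ε(N) + C/(n+1) for all n, where d(N) no longer
-- mentions the mesh; letting n grow gives |d(N)| ≤ ε(N). So C may depend on N in any way, and only
-- ε(N) has to be tracked. The obstacle is that log(1/s) is unbounded at s = 0, so that pointwise
-- errors cannot be multiplied by a bound of the integrand. Integrands are controlled by their total
-- mass instead, which the discrete integration by parts itself bounds by 2^(e+k) on every mesh. The
-- nodes in the weights are chosen so that s · ds/s = ds and (1+s²) · ds/(1+s²) = ds hold exactly.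
-- Discretisation errors then come only from increments of powers, from the change of variable and
-- from products of two increments. The inversion of c takes place at each finite N with the
-- truncated ζ̄, where it is an exact identity; it only multiplies errors by powers of log N.

≥0-* : ∀ {p q} → 0ℚ ≤ p → 0ℚ ≤ q → 0ℚ ≤ p * q
≥0-* {p} {q} hp hq = nonNegative⁻¹ (p * q) {{nonNeg*nonNeg⇒nonNeg p {{nonNegative hp}} q {{nonNegative hq}}}}

≥0-+ : ∀ {p q} → 0ℚ ≤ p → 0ℚ ≤ q → 0ℚ ≤ p + q
≥0-+ hp hq = +-mono-≤ hp hq

*-monoˡ : ∀ {p q} r → 0ℚ ≤ r → p ≤ q → r * p ≤ r * q
*-monoˡ r hr = *-monoˡ-≤-nonNeg r {{nonNegative hr}}

*-monoʳ : ∀ {p q} r → 0ℚ ≤ r → p ≤ q → p * r ≤ q * r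
*-monoʳ r hr = *-monoʳ-≤-nonNeg r {{nonNegative hr}}

*-mono : ∀ {p q r t} → 0ℚ ≤ p → 0ℚ ≤ r → p ≤ q → r ≤ t → p * r ≤ q * t
*-mono {p} {q} {r} {t} hp hr pq rt = ≤-trans (*-monoʳ r hr pq) (*-monoˡ q (≤-trans hp pq) rt)

≥0-- : ∀ {p q} → p ≤ q → 0ℚ ≤ q - p
≥0-- {p} {q} h = subst (_≤ q - p) (+-inverseʳ p) (+-monoˡ-≤ (- p) h)

0≤-⇒≤ : ∀ {p q} → 0ℚ ≤ q - p → p ≤ q
0≤-⇒≤ {p} {q} h = subst₂ _≤_ (+-identityˡ p) (solve 2 (λ p q → q :- p :+ p := q) refl p q) (+-monoˡ-≤ p h)

≤+ʳ : ∀ {p q} → 0ℚ ≤ q → p ≤ p + q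
≤+ʳ {p} {q} h = subst (_≤ p + q) (+-identityʳ p) (+-monoʳ-≤ p h)

≤+ˡ : ∀ {p q} → 0ℚ ≤ q → p ≤ q + p
≤+ˡ {p} {q} h = subst (_≤ q + p) (+-identityˡ p) (+-monoˡ-≤ p h)

*≤ˡ : ∀ {p q} → 0ℚ ≤ p → q ≤ 1ℚ → p * q ≤ p
*≤ˡ {p} hp h = ≤-trans (*-monoˡ p hp h) (≤-reflexive (*-identityʳ p))

*≤ʳ : ∀ {p q} → 0ℚ ≤ p → q ≤ 1ℚ → q * p ≤ p
*≤ʳ {p} hp h = ≤-trans (*-monoʳ p hp h) (≤-reflexive (*-identityˡ p))

0≤1 : 0ℚ ≤ 1ℚ
0≤1 = nonNegative⁻¹ 1ℚ

0≤two : 0ℚ ≤ two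
0≤two = nonNegative⁻¹ two

1≤two : 1ℚ ≤ two
1≤two = ≤+ʳ {1ℚ} {1ℚ} 0≤1

p+p≡two* : ∀ p → p + p ≡ two * p
p+p≡two* = solve 1 (λ p → p :+ p := con two :* p) refl

≤two* : ∀ {p} → 0ℚ ≤ p → p ≤ two * p
≤two* {p} h = ≤-trans (≤+ʳ {p} {p} h) (≤-reflexive (p+p≡two* p))

∸suc-< : ∀ m n → n ℕ.< m → m ∸ suc n ℕ.< m
∸suc-< (suc m) n _ = s≤s (ℕP.m∸n≤m m n)

p≤∣p∣ : ∀ p → p ≤ ∣ p ∣
p≤∣p∣ p with ≤-total 0ℚ p
... | inj₁ h = ≤-reflexive (sym (0≤p⇒∣p∣≡p h))
... | inj₂ h = ≤-trans h (0≤∣p∣ p)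

∣-∣-sym : ∀ p q → ∣ p - q ∣ ≡ ∣ q - p ∣
∣-∣-sym p q = trans (sym (∣-p∣≡∣p∣ (p - q))) (cong ∣_∣ (solve 2 (λ p q → :- (p :- q) := q :- p) refl p q))

∣*∣≤ : ∀ {p q P Q} → ∣ p ∣ ≤ P → ∣ q ∣ ≤ Q → ∣ p * q ∣ ≤ P * Q
∣*∣≤ {p} {q} hp hq = subst (_≤ _) (sym (∣p*q∣≡∣p∣*∣q∣ p q)) (*-mono (0≤∣p∣ p) (0≤∣p∣ q) hp hq)

∣+∣≤ : ∀ {p q P Q} → ∣ p ∣ ≤ P → ∣ q ∣ ≤ Q → ∣ p + q ∣ ≤ P + Q
∣+∣≤ {p} {q} hp hq = ≤-trans (∣p+q∣≤∣p∣+∣q∣ p q) (+-mono-≤ hp hq)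

∣0≤∣ : ∀ {p} → 0ℚ ≤ p → ∣ p ∣ ≤ p
∣0≤∣ h = ≤-reflexive (0≤p⇒∣p∣≡p h)

ι : ℕ → ℚ
ι zero = 0ℚ
ι (suc n) = 1ℚ + ι n

ι-+ : ∀ m n → ι (m ℕ.+ n) ≡ ι m + ι n
ι-+ zero n = sym (+-identityˡ (ι n))
ι-+ (suc m) n = trans (cong (1ℚ +_) (ι-+ m n)) (sym (+-assoc 1ℚ (ι m) (ι n)))

ι-* : ∀ m n → ι (m ℕ.* n) ≡ ι m * ι n
ι-* zero n = sym (*-zeroˡ (ι n))
ι-* (suc m) n = trans (ι-+ n (m ℕ.* n)) (trans (cong (ι n +_) (ι-* m n))
  (solve 2 (λ a b → b :+ a :* b := (con 1ℚ :+ a) :* b) refl (ι m) (ι n)))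

0≤ι : ∀ n → 0ℚ ≤ ι n
0≤ι zero = ≤-refl
0≤ι (suc n) = ≥0-+ 0≤1 (0≤ι n)

ι-mono : ∀ {m n} → m ℕ.≤ n → ι m ≤ ι n
ι-mono {n = n} z≤n = 0≤ι n
ι-mono (s≤s h) = +-monoʳ-≤ 1ℚ (ι-mono h)

toℚᵘ-ι : ∀ n → toℚᵘ (ι n) ℚᵘ.≃ ℚᵘ.mkℚᵘ (ℤ.+ n) 0
toℚᵘ-ι zero = ℚᵘP.≃-refl
toℚᵘ-ι (suc n) = ℚᵘP.≃-trans (toℚᵘ-homo-+ 1ℚ (ι n))
  (ℚᵘP.≃-trans (ℚᵘP.+-congʳ (toℚᵘ 1ℚ) (toℚᵘ-ι n)) (ℚᵘ.*≡*
      (cong (ℤ._* ℤ.1ℤ) (cong (ℤ._+_ ℤ.1ℤ) (ℤP.*-identityʳ (ℤ.+ n))))))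

inv-ι : ∀ d → inv (suc d) * ι (suc d) ≡ 1ℚ
inv-ι d = toℚᵘ-injective (ℚᵘP.≃-trans (toℚᵘ-homo-* (inv (suc d)) (ι (suc d)))
  (ℚᵘP.≃-trans (ℚᵘP.*-cong (toℚᵘ-fromℚᵘ (ℚᵘ.mkℚᵘ (ℤ.+ 1) d)) (toℚᵘ-ι (suc d)))
  (ℚᵘ.*≡* (trans (ℤP.*-identityʳ _) (cong (ℤ.1ℤ ℤ.*_) (sym (ℤP.*-identityʳ (ℤ.+ suc d))))))))

0≤inv : ∀ d → 0ℚ ≤ inv d
0≤inv zero = ≤-refl
0≤inv (suc d) = nonNegative⁻¹ (inv (suc d)) {{normalize-nonNeg 1 (suc d)}}

inv-anti : ∀ {m n} → m ℕ.≤ n → inv (suc n) ≤ inv (suc m)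
inv-anti {m} {n} h = begin
  b                        ≡⟨ sym (*-identityʳ b) ⟩
  b * 1ℚ                   ≡⟨ cong (b *_) (sym (inv-ι m)) ⟩
  b * (a * ι (suc m))      ≤⟨ *-monoˡ b (0≤inv (suc n)) (*-monoˡ a (0≤inv (suc m)) (ι-mono (s≤s h))) ⟩
  b * (a * ι (suc n))      ≡⟨ solve 3 (λ a b c → b :* (a :* c) := a :* (b :* c)) refl a b (ι (suc n)) ⟩
  a * (b * ι (suc n))      ≡⟨ cong (a *_) (inv-ι n) ⟩
  a * 1ℚ                   ≡⟨ *-identityʳ a ⟩
  a                        ∎
  where
  open ≤-Reasoning
  a = inv (suc m)
  b = inv (suc n)

inv≤1 : ∀ d → inv d ≤ 1ℚ
inv≤1 zero = 0≤1
inv≤1 (suc d) = inv-anti {0} {d} z≤n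

pow-≥0 : ∀ {x} k → 0ℚ ≤ x → 0ℚ ≤ pow x k
pow-≥0 zero h = 0≤1
pow-≥0 (suc k) h = ≥0-* h (pow-≥0 k h)

pow-≤1 : ∀ {x} k → 0ℚ ≤ x → x ≤ 1ℚ → pow x k ≤ 1ℚ
pow-≤1 zero h h' = ≤-refl
pow-≤1 (suc k) h h' = ≤-trans (*≤ˡ h (pow-≤1 k h h')) h'

pow-mono : ∀ {x y} k → 0ℚ ≤ x → x ≤ y → pow x k ≤ pow y k
pow-mono zero h h' = ≤-refl
pow-mono (suc k) h h' = *-mono h (pow-≥0 k h) h' (pow-mono k h h')

pow-≥1 : ∀ {x} k → 1ℚ ≤ x → 1ℚ ≤ pow x k
pow-≥1 zero h = ≤-refl
pow-≥1 {x} (suc k) h = ≤-trans h (≤-trans (≤-reflexive (sym (*-identityʳ x)))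
    (*-monoˡ x (≤-trans 0≤1 h) (pow-≥1 k h)))

pow-+ : ∀ x j k → pow x (j ℕ.+ k) ≡ pow x j * pow x k
pow-+ x zero k = sym (*-identityˡ _)
pow-+ x (suc j) k = trans (cong (x *_) (pow-+ x j k)) (sym (*-assoc x _ _))

pow-mono-exp : ∀ {x j k} → 1ℚ ≤ x → j ℕ.≤ k → pow x j ≤ pow x k
pow-mono-exp {k = k} h z≤n = pow-≥1 k h
pow-mono-exp {x} h (s≤s le) = *-monoˡ x (≤-trans 0≤1 h) (pow-mono-exp h le)

pow-1 : ∀ k → pow 1ℚ k ≡ 1ℚ
pow-1 zero = refl
pow-1 (suc k) = trans (*-identityˡ _) (pow-1 k)

∣sgn∣ : ∀ n → ∣ sgn n ∣ ≡ 1ℚ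
∣sgn∣ zero = refl
∣sgn∣ (suc n) = trans (∣-p∣≡∣p∣ (sgn n)) (∣sgn∣ n)

∣sgn∣≤1 : ∀ n → ∣ sgn n ∣ ≤ 1ℚ
∣sgn∣≤1 n = ≤-reflexive (∣sgn∣ n)

sgn-+ : ∀ m n → sgn (m ℕ.+ n) ≡ sgn m * sgn n
sgn-+ zero n = sym (*-identityˡ _)
sgn-+ (suc m) n = trans (cong -_ (sgn-+ m n)) (neg-distribˡ-* (sgn m) (sgn n))

Sum : ℕ → (ℕ → ℚ) → ℚ
Sum zero f = 0ℚ
Sum (suc n) f = Sum n f + f n

Sum-cong : ∀ n {f g} → (∀ i → i ℕ.< n → f i ≡ g i) → Sum n f ≡ Sum n g
Sum-cong zero h = refl
Sum-cong (suc n) h = cong₂ _+_ (Sum-cong n λ i l → h i (ℕP.m<n⇒m<1+n l)) (h n ℕP.≤-refl)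

Sum-ext : ∀ n {f g} → (∀ i → f i ≡ g i) → Sum n f ≡ Sum n g
Sum-ext n h = Sum-cong n λ i _ → h i

Sum-+ : ∀ n f g → Sum n (λ i → f i + g i) ≡ Sum n f + Sum n g
Sum-+ zero f g = refl
Sum-+ (suc n) f g = trans (cong (_+ (f n + g n)) (Sum-+ n f g))
  (solve 4 (λ a b c d → a :+ b :+ (c :+ d) := a :+ c :+ (b :+ d)) refl (Sum n f) (Sum n g) (f n) (g n))

Sum-*ˡ : ∀ n c f → Sum n (λ i → c * f i) ≡ c * Sum n f
Sum-*ˡ zero c f = sym (*-zeroʳ c)
Sum-*ˡ (suc n) c f = trans (cong (_+ c * f n) (Sum-*ˡ n c f)) (sym (*-distribˡ-+ c _ _))

Sum-*ʳ : ∀ n c f → Sum n (λ i → f i * c) ≡ Sum n f * c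
Sum-*ʳ n c f = trans (Sum-ext n λ i → *-comm (f i) c) (trans (Sum-*ˡ n c f) (*-comm c _))

Sum-neg : ∀ n f → Sum n (λ i → - f i) ≡ - Sum n f
Sum-neg zero f = refl
Sum-neg (suc n) f = trans (cong (_+ - f n) (Sum-neg n f)) (sym (neg-distrib-+ (Sum n f) (f n)))

Sum-- : ∀ n f g → Sum n (λ i → f i - g i) ≡ Sum n f - Sum n g
Sum-- n f g = trans (Sum-+ n f (λ i → - g i)) (cong (Sum n f +_) (Sum-neg n g))

Sum-0 : ∀ n {f} → (∀ i → i ℕ.< n → f i ≡ 0ℚ) → Sum n f ≡ 0ℚ
Sum-0 zero h = refl
Sum-0 (suc n) h = trans (cong₂ _+_ (Sum-0 n λ i l → h i (ℕP.m<n⇒m<1+n l)) (h n ℕP.≤-refl)) (+-identityʳ 0ℚ)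

Sum-mono : ∀ n {f g} → (∀ i → i ℕ.< n → f i ≤ g i) → Sum n f ≤ Sum n g
Sum-mono zero h = ≤-refl
Sum-mono (suc n) h = +-mono-≤ (Sum-mono n λ i l → h i (ℕP.m<n⇒m<1+n l)) (h n ℕP.≤-refl)

Sum-≥0 : ∀ n {f} → (∀ i → i ℕ.< n → 0ℚ ≤ f i) → 0ℚ ≤ Sum n f
Sum-≥0 zero h = ≤-refl
Sum-≥0 (suc n) h = ≥0-+ (Sum-≥0 n λ i l → h i (ℕP.m<n⇒m<1+n l)) (h n ℕP.≤-refl)

Sum-∣∣ : ∀ n {f g} → (∀ i → i ℕ.< n → ∣ f i ∣ ≤ g i) → ∣ Sum n f ∣ ≤ Sum n g
Sum-∣∣ zero h = ≤-refl
Sum-∣∣ (suc n) h = ∣+∣≤ (Sum-∣∣ n λ i l → h i (ℕP.m<n⇒m<1+n l)) (h n ℕP.≤-refl)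

Sum-head : ∀ n f → Sum (suc n) f ≡ f 0 + Sum n (f ∘ suc)
Sum-head zero f = trans (+-identityˡ (f 0)) (sym (+-identityʳ (f 0)))
Sum-head (suc n) f = trans (cong (_+ f (suc n)) (Sum-head n f)) (+-assoc (f 0) _ _)

Sum-mono-len : ∀ {m n} f → (∀ i → 0ℚ ≤ f i) → m ℕ.≤ n → Sum m f ≤ Sum n f
Sum-mono-len {m} {zero} f h z≤n = ≤-refl
Sum-mono-len {m} {suc n} f h le with ℕP.m≤n⇒m<n∨m≡n le
... | inj₁ (s≤s l) = ≤-trans (Sum-mono-len f h l) (≤+ʳ (h n))
... | inj₂ refl = ≤-refl

Sum-swap : ∀ m n (f : ℕ → ℕ → ℚ) → Sum m (λ i → Sum n (f i)) ≡ Sum n (λ j → Sum m (λ i → f i j))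
Sum-swap zero n f = sym (Sum-0 n λ _ _ → refl)
Sum-swap (suc m) n f = trans (cong (_+ Sum n (f m)) (Sum-swap m n f)) (sym (Sum-+ n _ (f m)))

-- Exchange of the order of summation over the pairs i ≤ j < n, with the diagonal on both sides. It
-- is the discrete Fubini theorem behind `x≡y`.
Sum-triangle : ∀ n (a b : ℕ → ℚ) →
  Sum n (λ i → a i * (Sum n b - Sum i b)) ≡ Sum n (λ i → b i * Sum (suc i) a)
Sum-triangle zero a b = refl
Sum-triangle (suc n) a b = begin
  Sum n (λ i → a i * (Sum n b + b n - Sum i b)) + a n * (Sum n b + b n - Sum n b)
    ≡⟨ cong₂ _+_ (trans (Sum-ext n λ i → solve 4 (λ x p q r → x :* (p :+ q :- r) := x :* (p :- r) :+ x :* q)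
        refl (a i) (Sum n b) (b n) (Sum i b))
         (trans (Sum-+ n _ _) (cong₂ _+_ (Sum-triangle n a b) (Sum-*ʳ n (b n) a))))
         (solve 3 (λ x p q → x :* (p :+ q :- p) := x :* q) refl (a n) (Sum n b) (b n)) ⟩
  Sum n (λ i → b i * Sum (suc i) a) + Sum n a * b n + a n * b n
    ≡⟨ solve 4 (λ p q x y → p :+ q :* y :+ x :* y := p :+ y :* (q :+ x)) refl
        (Sum n (λ i → b i * Sum (suc i) a)) (Sum n a) (a n) (b n) ⟩
  Sum n (λ i → b i * Sum (suc i) a) + b n * (Sum n a + a n) ∎ where open ≡-Reasoning

Sum-by-parts : ∀ n (h u : ℕ → ℚ) →
  Sum n (λ i → (h (suc i) - h i) * u i) ≡ h n * u n - h 0 * u 0 + Sum n (λ i → h (suc i) * (u i - u (suc i)))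
Sum-by-parts zero h u = solve 1 (λ a → con 0ℚ := a :- a :+ con 0ℚ) refl (h 0 * u 0)
Sum-by-parts (suc n) h u = trans (cong (_+ (h (suc n) - h n) * u n) (Sum-by-parts n h u))
  (solve 6 (λ hn un h' u' c S → hn :* un :- c :+ S :+ (h' :- hn) :* un := h' :* u' :- c :+
      (S :+ h' :* (un :- u')))
    refl (h n) (u n) (h (suc n)) (u (suc n)) (h 0 * u 0) (Sum n (λ i → h (suc i) * (u i - u (suc i)))))

-- Null sequences

archimedean : ∀ x → ∃[ n ] x ≤ ι n
archimedean x@(mkℚ p d _) = ℤ.∣ p ∣ , toℚᵘ-cancel-≤ (ℚᵘP.≤-respʳ-≃ (ℚᵘP.≃-sym (toℚᵘ-ι ℤ.∣ p ∣)) (ℚᵘ.*≤* le))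
  where
  p≤ : ∀ p → p ℤ.≤ ℤ.+ ℤ.∣ p ∣
  p≤ (ℤ.+ n) = ℤP.≤-refl
  p≤ (ℤ.-[1+ n ]) = ℤ.-≤+
  le : p ℤ.* ℤ.1ℤ ℤ.≤ ℤ.+ ℤ.∣ p ∣ ℤ.* ℤ.+ suc d
  le = ℤP.≤-trans (ℤP.≤-reflexive (ℤP.*-identityʳ p)) (ℤP.≤-trans (p≤ p)
    (ℤP.≤-trans (ℤ.+≤+ (ℕP.m≤m*n ℤ.∣ p ∣ (suc d))) (ℤP.≤-reflexive (ℤP.pos-* ℤ.∣ p ∣ (suc d)))))

Null : (ℕ → ℚ) → Set
Null f = ∀ ε → 0ℚ < ε → ∃[ N ] (∀ M → N ℕ.≤ M → ∣ f M ∣ < ε)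

0<½* : ∀ {ε} → 0ℚ < ε → 0ℚ < ½ * ε
0<½* {ε} h = positive⁻¹ (½ * ε) {{pos*pos⇒pos ½ ε {{positive h}}}}

½+½ : ∀ ε → ½ * ε + ½ * ε ≡ ε
½+½ = solve 1 (λ e → con ½ :* e :+ con ½ :* e := e) refl

C/n-null : ∀ C ε → 0ℚ < ε → ∃[ N ] (∀ M → N ℕ.≤ M → C * inv (suc M) < ε)
C/n-null C ε h with archimedean (C * (1/ ε) {{pos⇒nonZero ε {{positive h}}}})
... | N , le = N , λ M N≤M → begin-strict
    C * inv (suc M)                        ≡⟨ cong (_* inv (suc M)) (sym (*-identityʳ C)) ⟩
    C * 1ℚ * inv (suc M)                   ≡⟨ cong (λ t → C * t * inv (suc M)) (sym (*-inverseˡ ε)) ⟩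
    C * (1/ ε * ε) * inv (suc M)           ≡⟨ solve 4 (λ c e f i → c :* (e :* f) :* i := c :* e :* (f :* i))
        refl C (1/ ε) ε (inv (suc M)) ⟩
    C * 1/ ε * (ε * inv (suc M))           ≤⟨ *-monoʳ _ (≥0-* (<⇒≤ h) (0≤inv (suc M)))
        (≤-trans le (ι-mono N≤M)) ⟩
    ι M * (ε * inv (suc M))                ≡⟨ solve 4 (λ m e i o → m :* (e :* i) := e :* (i :* (o :+ m)) :- e :*
        (i :* o)) refl (ι M) ε (inv (suc M)) 1ℚ ⟩
    ε * (inv (suc M) * ι (suc M)) - ε * (inv (suc M) * 1ℚ)
        ≡⟨ cong₂ (λ a b → ε * a - ε * b) (inv-ι M) (*-identityʳ (inv (suc M))) ⟩
    ε * 1ℚ - ε * inv (suc M)               <⟨ +-monoʳ-< (ε * 1ℚ)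
        (neg-antimono-< (positive⁻¹ (ε * inv (suc M)) {{pos*pos⇒pos ε {{positive h}} (inv (suc M))
        {{normalize-pos 1 (suc M)}}}})) ⟩
    ε * 1ℚ - 0ℚ                            ≡⟨ solve 1 (λ e → e :* con 1ℚ :- con 0ℚ := e) refl ε ⟩
    ε ∎
    where
    open ≤-Reasoning
    instance
      _ = pos⇒nonZero ε {{positive h}}

-- Used to send the mesh to 0: a gap d - ε > 0 would exceed C/(n+1) for some n.
≤-limit : ∀ {d ε} C → (∀ n → d ≤ ε + C * inv (suc n)) → d ≤ ε
≤-limit {d} {ε} C h with d ≤? ε
... | yes le = le
... | no ¬le = ⊥-elim (<-irrefl refl (<-≤-trans lt (h N)))
  where
  0<t : 0ℚ < d - ε
  0<t = subst (_< d - ε) (+-inverseʳ ε) (+-monoˡ-< (- ε) (≰⇒> ¬le))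
  N = proj₁ (C/n-null C (d - ε) 0<t)
  lt : ε + C * inv (suc N) < d
  lt = subst (ε + C * inv (suc N) <_) (solve 2 (λ e d → e :+ (d :- e) := d) refl ε d)
         (+-monoʳ-< ε (proj₂ (C/n-null C (d - ε) 0<t) N ℕP.≤-refl))

Null-mono : ∀ {f g} → (∀ n → ∣ f n ∣ ≤ g n) → Null g → Null f
Null-mono {f} {g} h ng ε 0<ε with ng ε 0<ε
... | N , b = N , λ M le → ≤-<-trans (≤-trans (h M) (p≤∣p∣ (g M))) (b M le)

Null-scale : ∀ {f} c → 0ℚ ≤ c → (∀ n → 0ℚ ≤ f n) → Null f → Null (λ n → c * f n)
Null-scale {f} c hc hf nf ε 0<ε = proj₁ r , λ M le → bound M (proj₂ r M le)
  where
  -- Dividing ε by c + 1 instead of c covers c = 0 without a case distinction.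
  0<c+1 : 0ℚ < c + 1ℚ
  0<c+1 = +-mono-≤-< hc (positive⁻¹ 1ℚ)
  instance
    posc : Positive (c + 1ℚ)
    posc = positive 0<c+1
    nzc : NonZero (c + 1ℚ)
    nzc = pos⇒nonZero (c + 1ℚ)
    posi : Positive (1/ (c + 1ℚ))
    posi = 1/pos⇒pos (c + 1ℚ)
    posε : Positive ε
    posε = positive 0<ε
  η' : ℚ
  η' = 1/ (c + 1ℚ) * ε
  r = nf η' (positive⁻¹ η' {{pos*pos⇒pos (1/ (c + 1ℚ)) ε}})
  bound : ∀ M → ∣ f M ∣ < η' → ∣ c * f M ∣ < ε
  bound M lt = ≤-<-trans (≤-trans (∣0≤∣ (≥0-* hc (hf M))) (*-monoʳ (f M) (hf M) (≤+ʳ {c} {1ℚ} 0≤1)))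
    (≤-<-trans (*-monoˡ (c + 1ℚ) (<⇒≤ 0<c+1) (p≤∣p∣ (f M)))
      (subst ((c + 1ℚ) * ∣ f M ∣ <_)
        (trans (sym (*-assoc (c + 1ℚ) (1/ (c + 1ℚ)) ε))
            (trans (cong (_* ε) (*-inverseʳ (c + 1ℚ))) (*-identityˡ ε)))
        (*-monoʳ-<-pos (c + 1ℚ) lt)))

-- From index `N₀` on every term is below ½ ε, so these terms contribute at most ½ ε to the mean.
-- The head together with C is the constant `K`, and K/(M+1) is below ½ ε from `N₁` on.
cesàro : ∀ {a} C → (∀ i → 0ℚ ≤ a i) → 0ℚ ≤ C → Null a → Null (λ N → (C + Sum N a) * inv (suc N))
cesàro {a} C ha hC na ε 0<ε = N₀ ℕ.⊔ N₁ , λ M le →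
    ≤-<-trans (≤-trans (∣0≤∣ (≥0-* (≥0-+ hC (Sum-≥0 M λ i _ → ha i)) (0≤inv (suc M))))
        (bound M (ℕP.m⊔n≤o⇒m≤o N₀ N₁ le)))
      (subst (K * inv (suc M) + ½ * ε <_) (½+½ ε) (+-monoˡ-< (½ * ε) (proj₂ r₁ M (ℕP.m⊔n≤o⇒n≤o N₀ N₁ le))))
  where
  r₀ = na (½ * ε) (0<½* 0<ε)
  N₀ = proj₁ r₀
  K = C + Sum N₀ a
  r₁ = C/n-null K (½ * ε) (0<½* 0<ε)
  N₁ = proj₁ r₁
  tail : ∀ d → Sum (d ℕ.+ N₀) a ≤ Sum N₀ a + ι d * (½ * ε)
  tail zero = ≤-reflexive (solve 2 (λ s e → s := s :+ con 0ℚ :* e) refl (Sum N₀ a) (½ * ε))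
  tail (suc d) = ≤-trans (+-mono-≤ (tail d) (≤-trans (p≤∣p∣ (a (d ℕ.+ N₀)))
      (<⇒≤ (proj₂ r₀ (d ℕ.+ N₀) (ℕP.m≤n+m N₀ d)))))
    (≤-reflexive (solve 3 (λ s d e → s :+ d :* e :+ e := s :+ (con 1ℚ :+ d) :* e) refl (Sum N₀ a) (ι d)
        (½ * ε)))
  bound : ∀ M → N₀ ℕ.≤ M → (C + Sum M a) * inv (suc M) ≤ K * inv (suc M) + ½ * ε
  bound M le = begin
    (C + Sum M a) * inv (suc M)     ≤⟨ *-monoʳ _ (0≤inv (suc M)) (+-monoʳ-≤ C S≤) ⟩
    (C + (Sum N₀ a + ι (suc M) * (½ * ε))) * inv (suc M)
      ≡⟨ solve 5 (λ c s m e i → (c :+ (s :+ m :* e)) :* i := (c :+ s) :* i :+ (i :* m) :* e) refl C (Sum N₀ a)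
          (ι (suc M)) (½ * ε) (inv (suc M)) ⟩
    K * inv (suc M) + inv (suc M) * ι (suc M) * (½ * ε)
      ≡⟨ cong (λ t → K * inv (suc M) + t) (trans (cong (_* (½ * ε)) (inv-ι M)) (*-identityˡ (½ * ε))) ⟩
    K * inv (suc M) + ½ * ε ∎
    where
    open ≤-Reasoning
    S≤ : Sum M a ≤ Sum N₀ a + ι (suc M) * (½ * ε)
    S≤ = ≤-trans (subst (λ t → Sum t a ≤ Sum N₀ a + ι (M ∸ N₀) * (½ * ε)) (ℕP.m∸n+n≡m le) (tail (M ∸ N₀)))
      (+-monoʳ-≤ (Sum N₀ a) (*-monoʳ (½ * ε) (<⇒≤ (0<½* 0<ε))
          (ι-mono (ℕP.≤-trans (ℕP.m∸n≤m M N₀) (ℕP.n≤1+n M)))))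

-- Powers of harmonic numbers are o(N)

-- The stand-in for log N, equal to 1 + H_{N+1}. The leading 1 gives η ≥ 1, so that powers grow with
-- the exponent and different logarithmic bounds can be brought to a common one.
η : ℕ → ℚ
η N = 1ℚ + Sum (suc N) (inv ∘ suc)

1≤η : ∀ N → 1ℚ ≤ η N
1≤η N = ≤+ʳ {1ℚ} (Sum-≥0 (suc N) λ i _ → 0≤inv (suc i))

0≤η : ∀ N → 0ℚ ≤ η N
0≤η N = ≤-trans 0≤1 (1≤η N)

-- Mean value inequality for x^(k+1): the slope is at most its value at the right end x + h.
pow-incr : ∀ k {x h} → 0ℚ ≤ x → 0ℚ ≤ h → pow (x + h) (suc k) ≤ pow x (suc k) + ι (suc k) * (pow (x + h) k * h)
pow-incr zero {x} {h} hx hh = ≤-reflexive (solve 2 (λ x h → (x :+ h) :* con 1ℚ := x :* con 1ℚ :+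
    (con 1ℚ :+ con 0ℚ) :* (con 1ℚ :* h)) refl x h)
pow-incr (suc k) {x} {h} hx hh = begin
  y * (y * pow y k)        ≡⟨ solve 3 (λ x h t → (x :+ h) :* t := x :* t :+ t :* h) refl x h (y * pow y k) ⟩
  x * (y * pow y k) + y * pow y k * h
    ≤⟨ +-monoˡ-≤ (y * pow y k * h) (*-monoˡ x hx (pow-incr k hx hh)) ⟩
  x * (x * pow x k + ι (suc k) * (pow y k * h)) + y * pow y k * h
    ≡⟨ solve 6 (λ x p n q h y → x :* (x :* p :+ n :* (q :* h)) :+ y :* q :* h := (x :* (x :* p) :+ y :* q :* h)
        :+ x :* (n :* (q :* h))) refl x (pow x k) (ι (suc k)) (pow y k) h y ⟩
  (x * (x * pow x k) + y * pow y k * h) + x * (ι (suc k) * (pow y k * h))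
    ≤⟨ +-monoʳ-≤ (x * (x * pow x k) + y * pow y k * h) (*-monoʳ (ι (suc k) * (pow y k * h))
        (≥0-* (0≤ι (suc k)) (≥0-* (pow-≥0 k hy) hh)) (≤+ʳ {x} {h} hh)) ⟩
  (x * (x * pow x k) + y * pow y k * h) + y * (ι (suc k) * (pow y k * h))
    ≡⟨ solve 6 (λ x p n q h y → (x :* (x :* p) :+ y :* q :* h) :+ y :* (n :* (q :* h)) := x :* (x :* p) :+
        (con 1ℚ :+ n) :* (y :* q :* h)) refl x (pow x k) (ι (suc k)) (pow y k) h y ⟩
  x * (x * pow x k) + ι (suc (suc k)) * (y * pow y k * h) ∎
  where
  open ≤-Reasoning
  y = x + h
  hy = ≥0-+ hx hh

smallη : ℕ → ℕ → ℚ
smallη k N = pow (η N) k * inv (suc N)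

0≤smallη : ∀ k N → 0ℚ ≤ smallη k N
0≤smallη k N = ≥0-* (pow-≥0 k (0≤η N)) (0≤inv (suc N))

η-pow : ∀ k N → pow (η N) (suc k) ≤ pow (η 0) (suc k) + Sum N (λ i → ι (suc k) * smallη k (suc i))
η-pow k zero = ≤-reflexive (sym (+-identityʳ (pow (η 0) (suc k))))
η-pow k (suc N) = begin
  pow (η (suc N)) (suc k)        ≡⟨ cong (λ t → pow t (suc k)) η-suc ⟩
  pow (η N + h) (suc k)          ≤⟨ pow-incr k (0≤η N) (0≤inv (suc (suc N))) ⟩
  pow (η N) (suc k) + ι (suc k) * (pow (η N + h) k * h)
    ≡⟨ cong (λ t → pow (η N) (suc k) + ι (suc k) * (pow t k * h)) (sym η-suc) ⟩
  pow (η N) (suc k) + ι (suc k) * smallη k (suc N)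
    ≤⟨ +-monoˡ-≤ (ι (suc k) * smallη k (suc N)) (η-pow k N) ⟩
  pow (η 0) (suc k) + Sum N (λ i → ι (suc k) * smallη k (suc i)) + ι (suc k) * smallη k (suc N)
    ≡⟨ +-assoc (pow (η 0) (suc k)) (Sum N (λ i → ι (suc k) * smallη k (suc i))) (ι (suc k) * smallη k (suc N)) ⟩
  pow (η 0) (suc k) + Sum (suc N) (λ i → ι (suc k) * smallη k (suc i)) ∎
  where
  open ≤-Reasoning
  h = inv (suc (suc N))
  η-suc : η (suc N) ≡ η N + h
  η-suc = sym (+-assoc 1ℚ (Sum (suc N) (inv ∘ suc)) h)

-- Induction on k replaces a comparison of logarithms with powers: by `η-pow`, η^(k+1)/(N+1) is at
-- most a Cesàro mean of shifted values of (k+1) `smallη k`, up to a constant over N + 1.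
smallη-null : ∀ k → Null (smallη k)
smallη-null zero ε 0<ε = proj₁ r , λ M le → ≤-<-trans (∣0≤∣ (0≤smallη 0 M)) (proj₂ r M le)
  where
  r = C/n-null 1ℚ ε 0<ε
smallη-null (suc k) = Null-mono {smallη (suc k)} {g} bound
  (cesàro {a} (pow (η 0) (suc k)) (λ i → ≥0-* (0≤ι (suc k)) (0≤smallη k (suc i))) (pow-≥0 (suc k) (0≤η 0))
    (Null-scale {smallη k ∘ suc} (ι (suc k)) (0≤ι (suc k)) (λ i → 0≤smallη k (suc i)) shifted))
  where
  a : ℕ → ℚ
  a i = ι (suc k) * smallη k (suc i)
  g : ℕ → ℚ
  g N = (pow (η 0) (suc k) + Sum N a) * inv (suc N)
  bound : ∀ N → ∣ smallη (suc k) N ∣ ≤ g N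
  bound N = ≤-trans (∣0≤∣ (0≤smallη (suc k) N)) (*-monoʳ (inv (suc N)) (0≤inv (suc N)) (η-pow k N))
  shifted : Null (smallη k ∘ suc)
  shifted ε 0<ε = proj₁ r , λ M le → proj₂ r (suc M) (ℕP.m≤n⇒m≤1+n le)
    where
    r = smallη-null k ε 0<ε

-- Sequences in the mesh, up to O(1/n)

-- The argument n of f is the inverse mesh: ∣ f ∣ is at most ε in the continuum limit.
record Apx (f : ℕ → ℚ) (ε : ℚ) : Set where
  constructor apx
  field
    const : ℚ
    bound : ∀ n → ∣ f n ∣ ≤ ε + const * inv (suc n)
open Apx public

_≈_ : (f g : ℕ → ℚ) → Set
f ≈ g = Apx (λ n → f n - g n) 0ℚ

infix 4 _≈_

apx-ext : ∀ {f g ε} → (∀ n → f n ≡ g n) → Apx f ε → Apx g ε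
apx-ext h (apx C b) = apx C λ n → subst (λ t → ∣ t ∣ ≤ _) (h n) (b n)

apx-dom : ∀ {f g ε} → (∀ n → ∣ f n ∣ ≤ ∣ g n ∣) → Apx g ε → Apx f ε
apx-dom h (apx C b) = apx C λ n → ≤-trans (h n) (b n)

apx-≤ : ∀ {f ε ε'} → ε ≤ ε' → Apx f ε → Apx f ε'
apx-≤ h (apx C b) = apx C λ n → ≤-trans (b n) (+-monoˡ-≤ (C * inv (suc n)) h)

apx-exact : ∀ {f ε} → (∀ n → ∣ f n ∣ ≤ ε) → Apx f ε
apx-exact {f} {ε} h = apx 0ℚ λ n → ≤-trans (h n) (≤-reflexive
    (solve 2 (λ e i → e := e :+ con 0ℚ :* i) refl ε (inv (suc n))))

apx-δ : ∀ {f} C → (∀ n → ∣ f n ∣ ≤ C * inv (suc n)) → Apx f 0ℚ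
apx-δ C h = apx C λ n → ≤-trans (h n) (≤-reflexive (sym (+-identityˡ (C * inv (suc n)))))

apx-+ : ∀ {f g ε ε'} → Apx f ε → Apx g ε' → Apx (λ n → f n + g n) (ε + ε')
apx-+ {f} {g} {ε} {ε'} (apx C b) (apx D c) = apx (C + D) λ n → ≤-trans (∣+∣≤ {f n} {g n} (b n) (c n))
  (≤-reflexive (solve 5 (λ e e' c d i → e :+ c :* i :+ (e' :+ d :* i) := e :+ e' :+ (c :+ d) :* i) refl ε ε' C D
      (inv (suc n))))

apx-scale : ∀ {f ε} c → Apx f ε → Apx (λ n → c * f n) (∣ c ∣ * ε)
apx-scale {f} {ε} c (apx C b) = apx (∣ c ∣ * C) λ n → ≤-trans (∣*∣≤ {c} {f n} ≤-refl (b n))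
  (≤-reflexive (solve 4 (λ a e c i → a :* (e :+ c :* i) := a :* e :+ a :* c :* i) refl ∣ c ∣ ε C (inv (suc n))))

apx-neg : ∀ {f ε} → Apx f ε → Apx (λ n → - f n) ε
apx-neg {f} (apx C b) = apx C λ n → subst (_≤ _) (sym (∣-p∣≡∣p∣ (f n))) (b n)

apx-Sum : ∀ N {f : ℕ → ℕ → ℚ} {ε : ℕ → ℚ} → (∀ i → i ℕ.< N → Apx (f i) (ε i)) →
    Apx (λ n → Sum N (λ i → f i n)) (Sum N ε)
apx-Sum zero h = apx-exact λ n → ≤-refl
apx-Sum (suc N) {f} {ε} h = apx-+ {λ n → Sum N (λ i → f i n)} (apx-Sum N λ i l → h i (ℕP.m<n⇒m<1+n l))
    (h N ℕP.≤-refl)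

apx-const : ∀ {d ε} → Apx (λ _ → d) ε → ∣ d ∣ ≤ ε
apx-const (apx C b) = ≤-limit C b

≈-refl : ∀ {f} → f ≈ f
≈-refl {f} = apx-exact λ n → ≤-reflexive (cong ∣_∣ (+-inverseʳ (f n)))

≈-sym : ∀ {f g} → f ≈ g → g ≈ f
≈-sym {f} {g} h = apx-ext (λ n → solve 2 (λ a b → :- (a :- b) := b :- a) refl (f n) (g n))
    (apx-neg {λ n → f n - g n} h)

apx-+₀ : ∀ {f g ε} → Apx f ε → Apx g 0ℚ → Apx (λ n → f n + g n) ε
apx-+₀ {ε = ε} a b = apx-≤ (≤-reflexive (+-identityʳ ε)) (apx-+ a b)

≈-trans : ∀ {f g h} → f ≈ g → g ≈ h → f ≈ h
≈-trans {f} {g} {h} a b = apx-ext (λ n → solve 3 (λ a b c → a :- b :+ (b :- c) := a :- c) refl (f n) (g n)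
    (h n)) (apx-+₀ a b)

≈-scale : ∀ {f g} c → f ≈ g → (λ n → c * f n) ≈ (λ n → c * g n)
≈-scale {f} {g} c h = apx-≤ (≤-reflexive (*-zeroʳ ∣ c ∣))
    (apx-ext (λ n → solve 3 (λ a b c → c :* (a :- b) := c :* a :- c :* b) refl (f n) (g n) c) (apx-scale c h))

≈-+ : ∀ {f g f' g'} → f ≈ g → f' ≈ g' → (λ n → f n + f' n) ≈ (λ n → g n + g' n)
≈-+ {f} {g} {f'} {g'} a b = apx-ext (λ n → solve 4 (λ a b c d → a :- b :+ (c :- d) := a :+ c :- (b :+ d)) refl
    (f n) (g n) (f' n) (g' n)) (apx-+₀ a b)

≈-ext : ∀ {f g f' g'} → (∀ n → f n ≡ f' n) → (∀ n → g n ≡ g' n) → f ≈ g → f' ≈ g'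
≈-ext hf hg = apx-ext λ n → cong₂ _-_ (hf n) (hg n)

≈-≡ : ∀ {f g} → (∀ n → f n ≡ g n) → f ≈ g
≈-≡ {f} h = ≈-ext {f} {f} (λ _ → refl) h (≈-refl {f})

≈-Sum : ∀ N {f g : ℕ → ℕ → ℚ} → (∀ i → i ℕ.< N → f i ≈ g i) → (λ n → Sum N (λ i → f i n)) ≈
    (λ n → Sum N (λ i → g i n))
≈-Sum zero h = ≈-refl {λ _ → 0ℚ}
≈-Sum (suc N) {f} {g} h = ≈-+ {λ n → Sum N (λ i → f i n)} {λ n → Sum N (λ i → g i n)} {f N} {g N}
    (≈-Sum N {f} {g} λ i l → h i (ℕP.m<n⇒m<1+n l)) (h N ℕP.≤-refl)

apx-≈ : ∀ {f g ε} → f ≈ g → Apx f ε → Apx g ε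
apx-≈ {f} {g} h a = apx-ext (λ n → solve 2 (λ a b → a :+ (b :- a) := b) refl (f n) (g n))
    (apx-+₀ a (≈-sym {f} {g} h))

-- Bounds by C (log N)^k ρ(N), up to errors vanishing with the mesh

record Bd (N₀ : ℕ) (ρ : ℕ → ℚ) (F : ℕ → ℕ → ℚ) : Set where
  constructor bd
  field
    coef : ℚ
    coef≥0 : 0ℚ ≤ coef
    exponent : ℕ
    holds : ∀ N → N₀ ℕ.≤ N → Apx (F N) (coef * (pow (η N) exponent * ρ N))
open Bd public

one : ℕ → ℚ
one _ = 1ℚ

invs : ℕ → ℚ
invs N = inv (suc N)

module _ {N₀ : ℕ} {ρ : ℕ → ℚ} (0≤ρ : ∀ N → 0ℚ ≤ ρ N) where

  bd-weaken : ∀ (F : ℕ → ℕ → ℚ) C k → 0ℚ ≤ C → (∀ N → N₀ ℕ.≤ N → Apx (F N) (C * (pow (η N) k * ρ N))) → ∀ j →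
      (∀ N → N₀ ℕ.≤ N → Apx (F N) (C * (pow (η N) (k ℕ.+ j) * ρ N)))
  bd-weaken F C k hC h j N le = apx-≤ (*-monoˡ _ hC (*-monoʳ (ρ N) (0≤ρ N)
      (pow-mono-exp (1≤η N) (ℕP.m≤m+n k j)))) (h N le)

  bd-+ : ∀ {F G} → Bd N₀ ρ F → Bd N₀ ρ G → Bd N₀ ρ (λ N n → F N n + G N n)
  bd-+ {F} {G} (bd C hC k b) (bd D hD j c) = bd (C + D) (≥0-+ hC hD) (k ℕ.+ j) λ N le →
    apx-≤ (≤-reflexive (sym (*-distribʳ-+ (pow (η N) (k ℕ.+ j) * ρ N) C D)))
      (apx-+ (bd-weaken F C k hC b j N le)
        (subst (λ t → Apx (G N) (D * (pow (η N) t * ρ N))) (ℕP.+-comm j k) (bd-weaken G D j hD c k N le)))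

bd-ext : ∀ {N₀ ρ F G} → (∀ N → N₀ ℕ.≤ N → ∀ n → F N n ≡ G N n) → Bd N₀ ρ F → Bd N₀ ρ G
bd-ext h (bd C hC k b) = bd C hC k λ N le → apx-ext (h N le) (b N le)

bd-≈ : ∀ {N₀ ρ F G} → (∀ N → N₀ ℕ.≤ N → F N ≈ G N) → Bd N₀ ρ F → Bd N₀ ρ G
bd-≈ {F = F} {G} h (bd C hC k b) = bd C hC k λ N le → apx-≈ {F N} {G N} (h N le) (b N le)

bd-neg : ∀ {N₀ ρ F} → Bd N₀ ρ F → Bd N₀ ρ (λ N n → - F N n)
bd-neg (bd C hC k b) = bd C hC k λ N le → apx-neg (b N le)

LogBounded : (ℕ → ℚ) → Set
LogBounded c = ∃[ C ] ∃[ k ] (0ℚ ≤ C × (∀ N → ∣ c N ∣ ≤ C * pow (η N) k))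

bd-scale : ∀ {N₀ ρ F c} → (∀ N → 0ℚ ≤ ρ N) → LogBounded c → Bd N₀ ρ F → Bd N₀ ρ (λ N n → c N * F N n)
bd-scale {N₀} {ρ} {F} {c} 0≤ρ (D , j , hD , d) (bd C hC k b) = bd (D * C) (≥0-* hD hC) (j ℕ.+ k) λ N le →
  apx-≤ (≤-trans (*-monoʳ (C * (pow (η N) k * ρ N)) (≥0-* hC (≥0-* (pow-≥0 k (0≤η N)) (0≤ρ N))) (d N))
      (≤-reflexive (trans (solve 5 (λ D P C Q r → D :* P :* (C :* (Q :* r)) := D :* C :* (P :* Q :* r)) refl D
          (pow (η N) j) C (pow (η N) k) (ρ N))
        (cong (λ t → D * C * (t * ρ N)) (sym (pow-+ (η N) j k))))))
    (apx-scale (c N) (b N le))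

lb-const : ∀ c → LogBounded (λ _ → c)
lb-const c = ∣ c ∣ , 0 , 0≤∣p∣ c , λ N → ≤-reflexive (sym (*-identityʳ ∣ c ∣))

lb-* : ∀ {b c} → LogBounded b → LogBounded c → LogBounded (λ N → b N * c N)
lb-* {b} {c} (C , k , hC , f) (D , j , hD , g) = C * D , k ℕ.+ j , ≥0-* hC hD , λ N → ≤-trans
    (∣*∣≤ {b N} {c N} (f N) (g N))
  (≤-reflexive (trans (solve 4 (λ C P D Q → C :* P :* (D :* Q) := C :* D :* (P :* Q)) refl C (pow (η N) k) D
      (pow (η N) j)) (cong (C * D *_) (sym (pow-+ (η N) k j)))))

lb-+ : ∀ {b c} → LogBounded b → LogBounded c → LogBounded (λ N → b N + c N)
lb-+ {b} {c} (C , k , hC , f) (D , j , hD , g) = C + D , k ℕ.+ j , ≥0-+ hC hD , λ N → ≤-trans (∣+∣≤ {b N} {c N}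
    (≤-trans (f N) (*-monoˡ C hC (pow-mono-exp (1≤η N) (ℕP.m≤m+n k j))))
        (≤-trans (g N) (*-monoˡ D hD (pow-mono-exp (1≤η N) (ℕP.m≤n+m j k)))))
  (≤-reflexive (sym (*-distribʳ-+ (pow (η N) (k ℕ.+ j)) C D)))

lb-Sum : ∀ K {b : ℕ → ℕ → ℚ} → (∀ i → LogBounded (b i)) → LogBounded (λ N → Sum K (λ i → b i N))
lb-Sum zero h = lb-const 0ℚ
lb-Sum (suc K) {b} h = lb-+ {λ N → Sum K (λ i → b i N)} (lb-Sum K h) (h K)

0≤invs : ∀ N → 0ℚ ≤ invs N
0≤invs N = 0≤inv (suc N)

bd-0 : ∀ {N₀} → Bd N₀ invs (λ _ _ → 0ℚ)
bd-0 = bd 0ℚ ≤-refl 0 λ N _ → apx-exact λ n → ≤-reflexive (sym (*-zeroˡ (1ℚ * inv (suc N))))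

bd-Sum : ∀ {N₀} K {F : ℕ → ℕ → ℕ → ℚ} → (∀ i → i ℕ.< K → Bd N₀ invs (F i)) →
    Bd N₀ invs (λ N n → Sum K (λ i → F i N n))
bd-Sum zero h = bd-0
bd-Sum (suc K) {F} h = bd-+ 0≤invs {λ N n → Sum K (λ i → F i N n)} (bd-Sum K λ i l → h i (ℕP.m<n⇒m<1+n l))
    (h K ℕP.≤-refl)

bd-inv : ∀ {N₀ F} → Bd N₀ one F → Bd N₀ invs (λ N n → inv (suc N) * F N n)
bd-inv (bd C hC k b) = bd C hC k λ N le → apx-≤
  (≤-reflexive (trans (cong (_* (C * (pow (η N) k * 1ℚ))) (0≤p⇒∣p∣≡p (0≤inv (suc N))))
    (solve 3 (λ i c p → i :* (c :* (p :* con 1ℚ)) := c :* (p :* i)) refl (inv (suc N)) C (pow (η N) k))))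
  (apx-scale (inv (suc N)) (b N le))

-- The family is constant in the mesh here, so `apx-const` removes the O(1/n) error and leaves a
-- genuine bound by a multiple of `smallη`.
bd⇒null : ∀ {N₀ d} → Bd N₀ invs (λ N _ → d N) → Null d
bd⇒null {N₀} {d} (bd C hC k b) ε 0<ε = N₀ ℕ.⊔ proj₁ r , λ M le →
    ≤-<-trans (apx-const (b M (ℕP.m⊔n≤o⇒m≤o N₀ _ le))) (≤-<-trans (p≤∣p∣ (C * smallη k M))
        (proj₂ r M (ℕP.m⊔n≤o⇒n≤o N₀ _ le)))
  where
  r = Null-scale {smallη k} C hC (0≤smallη k) (smallη-null k) ε 0<ε

-- Second-order Taylor bound for powers on [0,1]

taylorC : ℕ → ℚ
taylorC zero = 0ℚ
taylorC (suc b) = taylorC b + ι (suc b)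

0≤taylorC : ∀ b → 0ℚ ≤ taylorC b
0≤taylorC zero = ≤-refl
0≤taylorC (suc b) = ≥0-+ (0≤taylorC b) (0≤ι (suc b))

-- The constant `taylorC b` = b(b+1)/2 is half the maximum of the second derivative of t^(b+1) on
-- [0,1]. In the induction the remainder for exponent b + 2 is y times the one for b + 1, minus
-- (b+1) x^b (x-y)².
pow-taylor : ∀ b {x y} → 0ℚ ≤ x → x ≤ 1ℚ → 0ℚ ≤ y → y ≤ 1ℚ →
  ∣ pow x (suc b) - pow y (suc b) - ι (suc b) * ((x - y) * pow x b) ∣ ≤ taylorC b * ((x - y) * (x - y))
pow-taylor zero {x} {y} _ _ _ _ = ≤-reflexive (trans
  (cong ∣_∣ (solve 2 (λ x y → x :* con 1ℚ :- y :* con 1ℚ :- (con 1ℚ :+ con 0ℚ) :* ((x :- y) :* con 1ℚ) := con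
      0ℚ) refl x y))
  (sym (*-zeroˡ ((x - y) * (x - y)))))
pow-taylor (suc b) {x} {y} hx hx' hy hy' = begin
  ∣ x * X - y * Y - (1ℚ + N) * ((x - y) * X) ∣
    ≡⟨ cong ∣_∣ (solve 5 (λ x y p Y N → x :* (x :* p) :- y :* Y :- (con 1ℚ :+ N) :* ((x :- y) :* (x :* p))
         := y :* (x :* p :- Y :- N :* ((x :- y) :* p)) :- N :* (p :* ((x :- y) :* (x :- y)))) refl x y (pow x b)
             Y N) ⟩
  ∣ y * D - N * (pow x b * d²) ∣
    ≤⟨ ∣p-q∣≤∣p∣+∣q∣ (y * D) (N * (pow x b * d²)) ⟩
  ∣ y * D ∣ + ∣ N * (pow x b * d²) ∣
    ≤⟨ +-mono-≤ (≤-trans (∣*∣≤ {y} {D} (≤-trans (∣0≤∣ hy) hy') (pow-taylor b hx hx' hy hy'))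
        (≤-reflexive (*-identityˡ (taylorC b * d²))))
         (∣*∣≤ {N} {pow x b * d²} (∣0≤∣ (0≤ι (suc b))) (≤-trans (∣0≤∣ (≥0-* (pow-≥0 b hx) 0≤d²))
             (*≤ʳ 0≤d² (pow-≤1 b hx hx')))) ⟩
  taylorC b * d² + N * d²
    ≡⟨ sym (*-distribʳ-+ d² (taylorC b) N) ⟩
  (taylorC b + N) * d² ∎
  where
  open ≤-Reasoning
  X = pow x (suc b)
  Y = pow y (suc b)
  N = ι (suc b)
  D = X - Y - N * ((x - y) * pow x b)
  d² = (x - y) * (x - y)
  0≤d² : 0ℚ ≤ d²
  0≤d² with ≤-total y x
  ... | inj₁ h = ≥0-* (≥0-- h) (≥0-- h)
  ... | inj₂ h = subst (0ℚ ≤_) (solve 2 (λ x y → (y :- x) :* (y :- x) := (x :- y) :* (x :- y)) refl x y)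
      (≥0-* (≥0-- h) (≥0-- h))

-- The grid in the variable s and discrete integration by parts

-- The uniform grid s i = i/(n+1) on [0,1] and its image v i = (1 - s)/(1 + s).
module Grid (n : ℕ) where

  G : ℕ
  G = suc n

  δ : ℚ
  δ = inv (suc n)

  -- κ and μ are 1/(1+s) and 1/(1+s²), with denominators cleared so that only reciprocals of
  -- naturals occur. `w₀` and `w` are the weights ds/s and ds/(1+s²); both sample the right end of
  -- the cell, which keeps `w₀` finite in the cell that touches s = 0.
  s κ μ v w₀ w : ℕ → ℚ
  s i = ι i * δ
  κ i = ι G * inv (G ℕ.+ i)
  μ i = ι (G ℕ.* G) * inv (G ℕ.* G ℕ.+ i ℕ.* i)
  v i = (1ℚ - s i) * κ i
  w₀ i = inv (suc i)
  w i = δ * μ (suc i)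

  tailSum : (ℕ → ℚ) → ℕ → ℚ
  tailSum f i = Sum G f - Sum i f

  -- L e and Θ k discretise (log (1/s))^e / e! and (π/4 - arctan s)^k / k!.
  L Θ : ℕ → ℕ → ℚ
  L zero i = 1ℚ
  L (suc e) i = tailSum (λ j → w₀ j * L e j) i
  Θ zero i = 1ℚ
  Θ (suc k) i = tailSum (λ j → w j * Θ k j) i

  P : ℕ → ℕ → ℕ → ℚ
  P e k i = L e i * Θ k i

  -- Discretisations of ∫ s^a P ds and ∫ s^a P ds/(1+s²).
  z x : ℕ → ℕ → ℕ → ℚ
  z e k a = Sum G (λ i → δ * pow (s (suc i)) a * P e k i)
  x e k a = Sum G (λ i → w i * pow (s (suc i)) a * P e k i)

  0≤δ : 0ℚ ≤ δ
  0≤δ = 0≤inv G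

  δG : δ * ι G ≡ 1ℚ
  δG = inv-ι n

  s-suc : ∀ i → s (suc i) - s i ≡ δ
  s-suc i = solve 2 (λ i d → (con 1ℚ :+ i) :* d :- i :* d := d) refl (ι i) δ

  s-0 : s 0 ≡ 0ℚ
  s-0 = *-zeroˡ δ

  s-G : s G ≡ 1ℚ
  s-G = trans (*-comm (ι G) δ) δG

  0≤s : ∀ i → 0ℚ ≤ s i
  0≤s i = ≥0-* (0≤ι i) 0≤δ

  s≤1 : ∀ {i} → i ℕ.≤ G → s i ≤ 1ℚ
  s≤1 {i} h = ≤-trans (*-monoʳ δ 0≤δ (ι-mono h)) (≤-reflexive s-G)

  κ-inv : ∀ i → κ i * (1ℚ + s i) ≡ 1ℚ
  κ-inv i = begin
    ι G * inv (G ℕ.+ i) * (1ℚ + ι i * δ)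
      ≡⟨ solve 4 (λ g j i d → g :* j :* (con 1ℚ :+ i :* d) := j :* (g :+ i :* (d :* g))) refl (ι G)
          (inv (G ℕ.+ i)) (ι i) δ ⟩
    inv (G ℕ.+ i) * (ι G + ι i * (δ * ι G))
      ≡⟨ cong (λ t → inv (G ℕ.+ i) * (ι G + t)) (trans (cong (ι i *_) δG) (*-identityʳ (ι i))) ⟩
    inv (G ℕ.+ i) * (ι G + ι i)
      ≡⟨ cong (inv (G ℕ.+ i) *_) (sym (ι-+ G i)) ⟩
    inv (G ℕ.+ i) * ι (G ℕ.+ i) ≡⟨ inv-ι (n ℕ.+ i) ⟩
    1ℚ ∎ where open ≡-Reasoning

  μ-inv : ∀ i → μ i * (1ℚ + s i * s i) ≡ 1ℚ
  μ-inv i = begin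
    ι GG * Q * (1ℚ + ι i * δ * (ι i * δ))
      ≡⟨ cong (λ t → t * Q * (1ℚ + ι i * δ * (ι i * δ))) (ι-* G G) ⟩
    ι G * ι G * Q * (1ℚ + ι i * δ * (ι i * δ))
      ≡⟨ solve 4 (λ g j i d → g :* g :* j :* (con 1ℚ :+ i :* d :* (i :* d)) := j :*
          (g :* g :+ i :* i :* (d :* g) :* (d :* g))) refl (ι G) Q (ι i) δ ⟩
    Q * (ι G * ι G + ι i * ι i * (δ * ι G) * (δ * ι G))
      ≡⟨ cong (λ t → Q * (ι G * ι G + ι i * ι i * t * t)) δG ⟩
    Q * (ι G * ι G + ι i * ι i * 1ℚ * 1ℚ)
      ≡⟨ cong (Q *_) (trans (solve 2 (λ g i → g :+ i :* con 1ℚ :* con 1ℚ := g :+ i) refl (ι G * ι G)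
          (ι i * ι i))
           (trans (cong₂ _+_ (sym (ι-* G G)) (sym (ι-* i i))) (sym (ι-+ GG (i ℕ.* i))))) ⟩
    Q * ι (GG ℕ.+ i ℕ.* i) ≡⟨ inv-ι (n ℕ.+ n ℕ.* G ℕ.+ i ℕ.* i) ⟩
    1ℚ ∎
    where
    open ≡-Reasoning
    GG = G ℕ.* G
    Q = inv (GG ℕ.+ i ℕ.* i)

  0≤κ : ∀ i → 0ℚ ≤ κ i
  0≤κ i = ≥0-* (0≤ι G) (0≤inv (G ℕ.+ i))

  0≤μ : ∀ i → 0ℚ ≤ μ i
  0≤μ i = ≥0-* (0≤ι (G ℕ.* G)) (0≤inv (G ℕ.* G ℕ.+ i ℕ.* i))

  κ≤1 : ∀ i → κ i ≤ 1ℚ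
  κ≤1 i = ≤-trans (≤-reflexive (sym (*-identityʳ (κ i))))
      (≤-trans (*-monoˡ (κ i) (0≤κ i) (≤+ʳ {1ℚ} {s i} (0≤s i))) (≤-reflexive (κ-inv i)))

  μ≤1 : ∀ i → μ i ≤ 1ℚ
  μ≤1 i = ≤-trans (≤-reflexive (sym (*-identityʳ (μ i))))
      (≤-trans (*-monoˡ (μ i) (0≤μ i) (≤+ʳ {1ℚ} {s i * s i} (≥0-* (0≤s i) (0≤s i)))) (≤-reflexive (μ-inv i)))

  0≤w₀ : ∀ i → 0ℚ ≤ w₀ i
  0≤w₀ i = 0≤inv (suc i)

  0≤w : ∀ i → 0ℚ ≤ w i
  0≤w i = ≥0-* 0≤δ (0≤μ (suc i))

  w≤δ : ∀ i → w i ≤ δ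
  w≤δ i = *≤ˡ 0≤δ (μ≤1 (suc i))

  -- The cancellation s · ds/s = ds without error term; this and `w-unit` are the purpose of the
  -- nodes chosen in `w₀` and `w`.
  s*w₀ : ∀ i → s (suc i) * w₀ i ≡ δ
  s*w₀ i = trans (solve 3 (λ a d b → a :* d :* b := d :* (b :* a)) refl (ι (suc i)) δ (w₀ i))
      (trans (cong (δ *_) (inv-ι i)) (*-identityʳ δ))

  w-unit : ∀ i → w i * (1ℚ + s (suc i) * s (suc i)) ≡ δ
  w-unit i = trans (*-assoc δ (μ (suc i)) _) (trans (cong (δ *_) (μ-inv (suc i))) (*-identityʳ δ))

  tailSum-step : ∀ f i → tailSum f i - tailSum f (suc i) ≡ f i
  tailSum-step f i = solve 3 (λ a b c → a :- b :- (a :- (b :+ c)) := c) refl (Sum G f) (Sum i f) (f i)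

  tailSum-G : ∀ f → tailSum f G ≡ 0ℚ
  tailSum-G f = +-inverseʳ (Sum G f)

  0≤tailSum : ∀ f → (∀ i → i ℕ.< G → 0ℚ ≤ f i) → ∀ {i} → i ℕ.≤ G → 0ℚ ≤ tailSum f i
  0≤tailSum f h {i} le = ≥0-- (go G le h)
    where
    go : ∀ m → i ℕ.≤ m → (∀ j → j ℕ.< m → 0ℚ ≤ f j) → Sum i f ≤ Sum m f
    go m le h with ℕP.m≤n⇒m<n∨m≡n le
    ... | inj₂ refl = ≤-refl
    go (suc m) le h | inj₁ (s≤s l) = ≤-trans (go m l λ j q → h j (ℕP.m<n⇒m<1+n q))
        (≤+ʳ {Sum m f} (h m ℕP.≤-refl))

  0≤L : ∀ e {i} → i ℕ.≤ G → 0ℚ ≤ L e i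
  0≤L zero h = 0≤1
  0≤L (suc e) h = 0≤tailSum (λ j → w₀ j * L e j) (λ j l → ≥0-* (0≤w₀ j) (0≤L e (ℕP.<⇒≤ l))) h

  0≤Θ : ∀ k {i} → i ℕ.≤ G → 0ℚ ≤ Θ k i
  0≤Θ zero h = 0≤1
  0≤Θ (suc k) h = 0≤tailSum (λ j → w j * Θ k j) (λ j l → ≥0-* (0≤w j) (0≤Θ k (ℕP.<⇒≤ l))) h

  0≤P : ∀ e k {i} → i ℕ.≤ G → 0ℚ ≤ P e k i
  0≤P e k h = ≥0-* (0≤L e h) (0≤Θ k h)

  0≤s^ : ∀ a i → 0ℚ ≤ pow (s (suc i)) a
  0≤s^ a i = pow-≥0 a (0≤s (suc i))

  0≤z : ∀ e k a → 0ℚ ≤ z e k a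
  0≤z e k a = Sum-≥0 G λ i l → ≥0-* (≥0-* 0≤δ (0≤s^ a i)) (0≤P e k (ℕP.<⇒≤ l))

  0≤x : ∀ e k a → 0ℚ ≤ x e k a
  0≤x e k a = Sum-≥0 G λ i l → ≥0-* (≥0-* (0≤w i) (0≤s^ a i)) (0≤P e k (ℕP.<⇒≤ l))

  x≤z : ∀ e k a → x e k a ≤ z e k a
  x≤z e k a = Sum-mono G λ i l → *-monoʳ (P e k i) (0≤P e k (ℕP.<⇒≤ l))
      (*-monoʳ (pow (s (suc i)) a) (0≤s^ a i) (w≤δ i))

  z≤z₀ : ∀ e k a → z e k a ≤ z e k 0
  z≤z₀ e k a = Sum-mono G λ i l → *-monoʳ (P e k i) (0≤P e k (ℕP.<⇒≤ l))
      (*-monoˡ δ 0≤δ (pow-≤1 a (0≤s (suc i)) (s≤1 l)))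

  -- From 1/(1+s²) + s²/(1+s²) = 1, exact on the grid by `w-unit`; `x-telescope` iterates it into
  -- the expansion of 1/(1+s²).
  x-z : ∀ e k a → x e k a + x e k (suc (suc a)) ≡ z e k a
  x-z e k a = trans (sym (Sum-+ G _ _)) (Sum-ext G λ i →
    trans (solve 4 (λ w p P s → w :* p :* P :+ w :* (s :* (s :* p)) :* P := w :* (con 1ℚ :+ s :* s) :* p :* P)
        refl (w i) (pow (s (suc i)) a) (P e k i) (s (suc i)))
      (cong (λ t → t * pow (s (suc i)) a * P e k i) (w-unit i)))

  -- What the derivative of L^e/e! contributes once a factor s has cancelled its 1/s: z with e
  -- lowered by one, and nothing at e = 0.
  zp : ℕ → ℕ → ℕ → ℚ
  zp zero k a = 0ℚ
  zp (suc e) k a = z e k a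

  -- x with k shifted by one; at k = 0 it is the boundary term at s = 1.
  xs : ℕ → ℕ → ℕ → ℚ
  xs zero zero a = 1ℚ
  xs (suc e) zero a = 0ℚ
  xs e (suc k) a = x e k a

  -- The product of the increments of L and Θ, absent from the continuous product rule.
  cor : ℕ → ℕ → ℕ → ℚ
  cor zero k a = 0ℚ
  cor (suc e) zero a = 0ℚ
  cor (suc e) (suc k) a = x e k a

  dL dΘ : ℕ → ℕ → ℚ
  dL zero i = 0ℚ
  dL (suc e) i = w₀ i * L e i
  dΘ zero i = 0ℚ
  dΘ (suc k) i = w i * Θ k i

  L-step : ∀ e i → L e (suc i) ≡ L e i - dL e i
  L-step zero i = refl
  L-step (suc e) i = trans (solve 2 (λ a b → b := a :- (a :- b)) refl (L (suc e) i) (L (suc e) (suc i)))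
      (cong (λ t → L (suc e) i - t) (tailSum-step (λ j → w₀ j * L e j) i))

  Θ-step : ∀ k i → Θ k (suc i) ≡ Θ k i - dΘ k i
  Θ-step zero i = refl
  Θ-step (suc k) i = trans (solve 2 (λ a b → b := a :- (a :- b)) refl (Θ (suc k) i) (Θ (suc k) (suc i)))
      (cong (λ t → Θ (suc k) i - t) (tailSum-step (λ j → w j * Θ k j) i))

  P-step : ∀ e k i → P e k i - P e k (suc i) ≡ dL e i * Θ k i + L e i * dΘ k i - dL e i * dΘ k i
  P-step e k i = trans (cong₂ (λ a b → P e k i - a * b) (L-step e i) (Θ-step k i))
    (solve 4 (λ l t a b → l :* t :- (l :- a) :* (t :- b) := a :* t :+ l :* b :- a :* b) refl (L e i) (Θ k i)
        (dL e i) (dΘ k i))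

  byparts-z : ∀ e k a → Sum G (λ i → pow (s (suc i)) (suc a) * (dL e i * Θ k i)) ≡ zp e k a
  byparts-z zero k a = Sum-0 G λ i _ → solve 2 (λ p t → p :* (con 0ℚ :* t) := con 0ℚ) refl
      (pow (s (suc i)) (suc a)) (Θ k i)
  byparts-z (suc e) k a = Sum-ext G λ i →
    trans (solve 5 (λ s p w l t → s :* p :* (w :* l :* t) := s :* w :* p :* (l :* t)) refl (s (suc i))
        (pow (s (suc i)) a) (w₀ i) (L e i) (Θ k i))
      (cong (λ t → t * pow (s (suc i)) a * P e k i) (s*w₀ i))

  -- The boundary term at s = 1 and the sum complement each other: for k > 0 the former vanishes,
  -- for k = 0 the latter, and then the boundary term is 1 or 0 according to whether e = 0.
  byparts-x : ∀ e k a → P e k G + Sum G (λ i → pow (s (suc i)) a * (L e i * dΘ k i)) ≡ xs e k a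
  byparts-x e zero a = trans (cong (P e zero G +_) (Sum-0 G λ i _ → solve 2
      (λ p t → p :* (t :* con 0ℚ) := con 0ℚ) refl (pow (s (suc i)) a) (L e i)))
    (trans (+-identityʳ (P e zero G)) (trans (*-identityʳ (L e G)) (lem e)))
    where
    lem : ∀ e → L e G ≡ xs e zero a
    lem zero = refl
    lem (suc e) = tailSum-G (λ j → w₀ j * L e j)
  byparts-x e (suc k) a = trans (cong₂ _+_ (trans (cong (L e G *_) (tailSum-G (λ j → w j * Θ k j)))
      (*-zeroʳ (L e G)))
      (Sum-ext G λ i → solve 4 (λ p l w t → p :* (l :* (w :* t)) := w :* p :* (l :* t)) refl (pow (s (suc i)) a)
          (L e i) (w i) (Θ k i)))
    (trans (+-identityˡ (x e k a)) (lem e))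
    where
    lem : ∀ e → x e k a ≡ xs e (suc k) a
    lem zero = refl
    lem (suc e) = refl

  byparts-cor : ∀ e k a → Sum G (λ i → pow (s (suc i)) (suc a) * (dL e i * dΘ k i)) ≡ δ * cor e k a
  byparts-cor zero k a = trans (Sum-0 G λ i _ → solve 2 (λ p t → p :* (con 0ℚ :* t) := con 0ℚ) refl
      (pow (s (suc i)) (suc a)) (dΘ k i)) (sym (*-zeroʳ δ))
  byparts-cor (suc e) zero a = trans (Sum-0 G λ i _ → solve 2 (λ p t → p :* (t :* con 0ℚ) := con 0ℚ) refl
      (pow (s (suc i)) (suc a)) (dL (suc e) i)) (sym (*-zeroʳ δ))
  byparts-cor (suc e) (suc k) a = trans (Sum-ext G λ i →
      trans (solve 6 (λ s p w₀ l w t → s :* p :* (w₀ :* l :* (w :* t)) := s :* w₀ :* (w :* p :* (l :* t))) refl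
          (s (suc i)) (pow (s (suc i)) a) (w₀ i) (L e i) (w i) (Θ k i))
        (cong (λ t → t * (w i * pow (s (suc i)) a * P e k i)) (s*w₀ i)))
    (Sum-*ˡ G δ (λ i → w i * pow (s (suc i)) a * P e k i))

  byparts : ∀ e k a → Sum G (λ i → (pow (s (suc i)) (suc a) - pow (s i) (suc a)) * P e k i) ≡
      zp e k a + xs e k (suc a) - δ * cor e k a
  byparts e k a = begin
    Sum G (λ i → (H (suc i) - H i) * P e k i)
      ≡⟨ Sum-by-parts G H (P e k) ⟩
    H G * P e k G - H 0 * P e k 0 + Sum G (λ i → H (suc i) * (P e k i - P e k (suc i)))
      ≡⟨ cong₂ _+_ (cong₂ (λ a b → a * P e k G - b * P e k 0)
          (trans (cong (λ t → pow t (suc a)) s-G) (pow-1 (suc a)))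
          (trans (cong (λ t → t * pow (s 0) a) s-0) (*-zeroˡ (pow (s 0) a))))
           (trans (Sum-ext G λ i → trans (cong (H (suc i) *_) (P-step e k i))
               (solve 4 (λ h a b c → h :* (a :+ b :- c) := h :* a :+ h :* b :- h :* c) refl (H (suc i))
               (dL e i * Θ k i) (L e i * dΘ k i) (dL e i * dΘ k i)))
             (trans (Sum-- G (λ i → H (suc i) * (dL e i * Θ k i) + H (suc i) * (L e i * dΘ k i))
                 (λ i → H (suc i) * (dL e i * dΘ k i)))
                 (cong (_- C) (Sum-+ G (λ i → H (suc i) * (dL e i * Θ k i))
                 (λ i → H (suc i) * (L e i * dΘ k i)))))) ⟩
    1ℚ * P e k G - 0ℚ * P e k 0 + (A + B - C)
      ≡⟨ solve 5 (λ p q a b c → con 1ℚ :* p :- con 0ℚ :* q :+ (a :+ b :- c) := a :+ (p :+ b) :- c) refl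
          (P e k G) (P e k 0) A B C ⟩
    A + (P e k G + B) - C
      ≡⟨ cong₂ _-_ (cong₂ _+_ (byparts-z e k a) (byparts-x e k (suc a))) (byparts-cor e k a) ⟩
    zp e k a + xs e k (suc a) - δ * cor e k a ∎
    where
    open ≡-Reasoning
    H : ℕ → ℚ
    H i = pow (s i) (suc a)
    A = Sum G (λ i → H (suc i) * (dL e i * Θ k i))
    B = Sum G (λ i → H (suc i) * (L e i * dΘ k i))
    C = Sum G (λ i → H (suc i) * (dL e i * dΘ k i))

  0≤cor : ∀ e k a → 0ℚ ≤ cor e k a
  0≤cor zero k a = ≤-refl
  0≤cor (suc e) zero a = ≤-refl
  0≤cor (suc e) (suc k) a = 0≤x e k a

  0≤xs : ∀ e k a → 0ℚ ≤ xs e k a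
  0≤xs zero zero a = 0≤1
  0≤xs (suc e) zero a = ≤-refl
  0≤xs zero (suc k) a = 0≤x zero k a
  0≤xs (suc e) (suc k) a = 0≤x (suc e) k a

  -- At a = 0 the increment of s is δ itself, so no Taylor error enters, and the correction term has
  -- a favourable sign. The inequality thus holds on every mesh.
  z₀-rec : ∀ e k → z e k 0 ≤ zp e k 0 + xs e k 1
  z₀-rec e k = ≤-trans (≤-reflexive (trans (Sum-ext G λ i → cong (λ t → t * P e k i)
      (trans (*-identityʳ δ) (trans (sym (s-suc i)) (cong₂ _-_ (sym (*-identityʳ (s (suc i))))
          (sym (*-identityʳ (s i)))))))
      (byparts e k 0)))
    (≤-trans (+-monoʳ-≤ (zp e k 0 + xs e k 1) (neg-antimono-≤ (≥0-* 0≤δ (0≤cor e k 0))))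
        (≤-reflexive (+-identityʳ (zp e k 0 + xs e k 1))))

  -- Uniform in the mesh although L is unbounded near s = 0: each use of `z₀-rec` lowers e or k and
  -- at most doubles the number of terms.
  z₀≤ : ∀ e k → z e k 0 ≤ pow two (e ℕ.+ k)
  x≤₂ : ∀ e k a → x e k a ≤ pow two (e ℕ.+ k)
  x≤₂ e k a = ≤-trans (x≤z e k a) (≤-trans (z≤z₀ e k a) (z₀≤ e k))
  z₀≤ zero zero = z₀-rec zero zero
  z₀≤ zero (suc k) = ≤-trans (z₀-rec zero (suc k)) (≤-trans (≤-reflexive (+-identityˡ (x zero k 1)))
      (≤-trans (x≤₂ zero k 1) (≤two* (pow-≥0 k 0≤two))))
  z₀≤ (suc e) zero = ≤-trans (z₀-rec (suc e) zero) (≤-trans (≤-reflexive (+-identityʳ (z e zero 0)))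
      (≤-trans (z₀≤ e zero) (≤two* (pow-≥0 (e ℕ.+ 0) 0≤two))))
  z₀≤ (suc e) (suc k) = ≤-trans (z₀-rec (suc e) (suc k))
      (≤-trans (+-mono-≤ (z₀≤ e (suc k)) (≤-trans (x≤₂ (suc e) k 1)
      (≤-reflexive (cong (pow two) (sym (ℕP.+-suc e k))))))
    (≤-reflexive (p+p≡two* (pow two (e ℕ.+ suc k)))))

  -- Replacing a by b costs O(δ²) per cell, and one factor δ is spent on the mass of u. Only that
  -- mass enters, which admits weights growing without bound near s = 0 as the mesh shrinks.
  riemann : ∀ {a b u : ℕ → ℚ} {C K} → 0ℚ ≤ C → (∀ i → i ℕ.< G → ∣ a i - b i ∣ ≤ C * (δ * δ)) →
      (∀ i → i ℕ.< G → 0ℚ ≤ u i) →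
    Sum G (λ i → δ * u i) ≤ K → ∣ Sum G (λ i → a i * u i) - Sum G (λ i → b i * u i) ∣ ≤ C * K * δ
  riemann {a} {b} {u} {C} {K} hC h hu hK = begin
    ∣ Sum G (λ i → a i * u i) - Sum G (λ i → b i * u i) ∣
      ≡⟨ cong ∣_∣ (sym (Sum-- G (λ i → a i * u i) (λ i → b i * u i))) ⟩
    ∣ Sum G (λ i → a i * u i - b i * u i) ∣
      ≤⟨ Sum-∣∣ G (λ i l → ≤-trans (≤-reflexive (cong ∣_∣
          (solve 3 (λ a b u → a :* u :- b :* u := (a :- b) :* u) refl (a i) (b i) (u i))))
           (≤-trans (∣*∣≤ {a i - b i} {u i} (h i l) (∣0≤∣ (hu i l)))
             (≤-reflexive (solve 3 (λ c d u → c :* (d :* d) :* u := c :* d :* (d :* u)) refl C δ (u i))))) ⟩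
    Sum G (λ i → C * δ * (δ * u i))
      ≡⟨ Sum-*ˡ G (C * δ) (λ i → δ * u i) ⟩
    C * δ * Sum G (λ i → δ * u i)
      ≤⟨ *-monoˡ (C * δ) (≥0-* hC 0≤δ) hK ⟩
    C * δ * K
      ≡⟨ solve 3 (λ c d k → c :* d :* k := c :* k :* d) refl C δ K ⟩
    C * K * δ ∎ where open ≤-Reasoning

  0≤pow2 : ∀ k → 0ℚ ≤ pow two k
  0≤pow2 k = pow-≥0 k 0≤two

  Sum-P≤ : ∀ e k → Sum G (λ i → δ * P e k i) ≤ pow two (e ℕ.+ k)
  Sum-P≤ e k = ≤-trans (≤-reflexive (Sum-ext G λ i → cong (_* P e k i) (sym (*-identityʳ δ)))) (z₀≤ e k)

  cor≤ : ∀ e k a → cor e k a ≤ pow two (e ℕ.+ k)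
  cor≤ zero k a = 0≤pow2 k
  cor≤ (suc e) zero a = 0≤pow2 (suc e ℕ.+ 0)
  cor≤ (suc e) (suc k) a = ≤-trans (x≤₂ e k a) (pow-mono-exp {two} 1≤two
      (ℕP.≤-trans (ℕP.+-monoʳ-≤ e (ℕP.n≤1+n k)) (ℕP.n≤1+n (e ℕ.+ suc k))))

  -- Integration by parts of s^(a+1) against P. The first constant is the Taylor error in replacing
  -- the increment of s^(a+1) by (a+1) s^a δ, the second bounds the product of increments `cor`.
  z-rec : ∀ e k a → ∣ ι (suc a) * z e k a - (zp e k a + xs e k (suc a)) ∣ ≤
      (taylorC a * pow two (e ℕ.+ k) + pow two (e ℕ.+ k)) * δ
  z-rec e k a = begin
    ∣ ι (suc a) * z e k a - (zp e k a + xs e k (suc a)) ∣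
      ≡⟨ cong ∣_∣ (solve 3 (λ p q c → p :- q := p :- (q :- c) :+ :- c) refl (ι (suc a) * z e k a)
          (zp e k a + xs e k (suc a)) (δ * cor e k a)) ⟩
    ∣ ι (suc a) * z e k a - (zp e k a + xs e k (suc a) - δ * cor e k a) + - (δ * cor e k a) ∣
      ≤⟨ ∣+∣≤ {ι (suc a) * z e k a - (zp e k a + xs e k (suc a) - δ * cor e k a)} { - (δ * cor e k a)} main
          corb ⟩
    taylorC a * K * δ + K * δ
      ≡⟨ sym (*-distribʳ-+ δ (taylorC a * K) K) ⟩
    (taylorC a * K + K) * δ ∎
    where
    open ≤-Reasoning
    K = pow two (e ℕ.+ k)
    corb : ∣ - (δ * cor e k a) ∣ ≤ K * δ
    corb = ≤-trans (≤-reflexive (∣-p∣≡∣p∣ (δ * cor e k a)))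
        (≤-trans (∣0≤∣ (≥0-* 0≤δ (0≤cor e k a))) (≤-trans (*-monoˡ δ 0≤δ (cor≤ e k a))
        (≤-reflexive (*-comm δ K))))
    f g : ℕ → ℚ
    f i = ι (suc a) * (δ * pow (s (suc i)) a)
    g i = pow (s (suc i)) (suc a) - pow (s i) (suc a)
    fg : ∀ i → i ℕ.< G → ∣ f i - g i ∣ ≤ taylorC a * (δ * δ)
    fg i l = ≤-trans (≤-reflexive (∣-∣-sym (f i) (g i)))
      (subst (λ t → ∣ g i - ι (suc a) * (t * pow (s (suc i)) a) ∣ ≤ taylorC a * (t * t)) (s-suc i)
        (pow-taylor a {s (suc i)} {s i} (0≤s (suc i)) (s≤1 l) (0≤s i) (s≤1 (ℕP.<⇒≤ l))))
    main : ∣ ι (suc a) * z e k a - (zp e k a + xs e k (suc a) - δ * cor e k a) ∣ ≤ taylorC a * K * δ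
    main = subst₂ (λ p q → ∣ p - q ∣ ≤ taylorC a * K * δ)
      (trans (Sum-ext G λ i → *-assoc (ι (suc a)) (δ * pow (s (suc i)) a) (P e k i))
          (Sum-*ˡ G (ι (suc a)) (λ i → δ * pow (s (suc i)) a * P e k i)))
      (byparts e k a)
      (riemann {f} {g} {P e k} (0≤taylorC a) fg (λ i l → 0≤P e k (ℕP.<⇒≤ l)) (Sum-P≤ e k))

-- The grid in the variable v

∣⁻∣≤ : ∀ {p q P Q} → ∣ p ∣ ≤ P → ∣ q ∣ ≤ Q → ∣ p - q ∣ ≤ P + Q
∣⁻∣≤ {p} {q} hp hq = ≤-trans (∣p-q∣≤∣p∣+∣q∣ p q) (+-mono-≤ hp hq)

Sum-const : ∀ m c → Sum m (λ _ → c) ≡ ι m * c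
Sum-const zero c = sym (*-zeroˡ c)
Sum-const (suc m) c = trans (cong (_+ c) (Sum-const m c))
    (solve 2 (λ m c → m :* c :+ c := (con 1ℚ :+ m) :* c) refl (ι m) c)

Sum-telescope : ∀ m (h : ℕ → ℚ) → Sum m (λ i → h i - h (suc i)) ≡ h 0 - h m
Sum-telescope zero h = sym (+-inverseʳ (h 0))
Sum-telescope (suc m) h = trans (cong (_+ (h m - h (suc m))) (Sum-telescope m h))
    (solve 3 (λ a b c → a :- b :+ (b :- c) := a :- c) refl (h 0) (h m) (h (suc m)))

Sum-by-parts' : ∀ m (h f : ℕ → ℚ) → Sum m (λ i → (h i - h (suc i)) * Sum (suc i) f) ≡
    Sum m (λ i → h i * f i) - h m * Sum m f
Sum-by-parts' zero h f = solve 1 (λ h → con 0ℚ := con 0ℚ :- h :* con 0ℚ) refl (h 0)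
Sum-by-parts' (suc m) h f = trans (cong (_+ (h m - h (suc m)) * (Sum m f + f m)) (Sum-by-parts' m h f))
  (solve 5 (λ S a b F c → S :- a :* F :+ (a :- b) :* (F :+ c) := S :+ a :* c :- b :* (F :+ c)) refl
      (Sum m (λ i → h i * f i)) (h m) (h (suc m)) (Sum m f) (f m))

four six eight : ℚ
four = two + two
six = four + two
eight = four + four

module GridV (n : ℕ) where
  open Grid n

  v-κ : ∀ i → v i ≡ two * κ i - 1ℚ
  v-κ i = trans (solve 2 (λ s k → (con 1ℚ :- s) :* k := con two :* k :- k :* (con 1ℚ :+ s)) refl (s i) (κ i))
      (cong (λ t → two * κ i - t) (κ-inv i))

  0≤v : ∀ {i} → i ℕ.≤ G → 0ℚ ≤ v i
  0≤v {i} h = ≥0-* (≥0-- (s≤1 h)) (0≤κ i)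

  v≤1 : ∀ i → v i ≤ 1ℚ
  v≤1 i = ≤-trans (*≤ʳ {κ i} {1ℚ - s i} (0≤κ i) (0≤-⇒≤ (subst (0ℚ ≤_)
      (solve 1 (λ s → s := con 1ℚ :- (con 1ℚ :- s)) refl (s i)) (0≤s i)))) (κ≤1 i)

  κ-step : ∀ i → κ i - κ (suc i) ≡ δ * (κ i * κ (suc i))
  κ-step i = begin
    k - k'    ≡⟨ solve 2 (λ k k' → k :- k' := k :* con 1ℚ :- k' :* con 1ℚ) refl k k' ⟩
    k * 1ℚ - k' * 1ℚ   ≡⟨ cong₂ (λ a b → k * a - k' * b) (sym (κ-inv (suc i))) (sym (κ-inv i)) ⟩
    k * (k' * (1ℚ + s (suc i))) - k' * (k * (1ℚ + s i))
      ≡⟨ solve 4 (λ k k' a b → k :* (k' :* (con 1ℚ :+ a)) :- k' :* (k :* (con 1ℚ :+ b)) := (a :- b) :*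
          (k :* k')) refl k k' (s (suc i)) (s i) ⟩
    (s (suc i) - s i) * (k * k')  ≡⟨ cong (_* (k * k')) (s-suc i) ⟩
    δ * (k * k') ∎
    where
    open ≡-Reasoning
    k = κ i
    k' = κ (suc i)

  v-step : ∀ i → v i - v (suc i) ≡ two * (δ * (κ i * κ (suc i)))
  v-step i = trans (cong₂ _-_ (v-κ i) (v-κ (suc i))) (trans
      (solve 2 (λ a b → con two :* a :- con 1ℚ :- (con two :* b :- con 1ℚ) := con two :* (a :- b)) refl (κ i)
      (κ (suc i))) (cong (two *_) (κ-step i)))

  v-0 : v 0 ≡ 1ℚ
  v-0 = begin
    (1ℚ - s 0) * κ 0  ≡⟨ cong (λ t → (1ℚ - t) * κ 0) s-0 ⟩
    (1ℚ - 0ℚ) * κ 0   ≡⟨ solve 1 (λ k → (con 1ℚ :- con 0ℚ) :* k := k :* (con 1ℚ :+ con 0ℚ)) refl (κ 0) ⟩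
    κ 0 * (1ℚ + 0ℚ)   ≡⟨ cong (λ t → κ 0 * (1ℚ + t)) (sym s-0) ⟩
    κ 0 * (1ℚ + s 0)  ≡⟨ κ-inv 0 ⟩
    1ℚ ∎ where open ≡-Reasoning

  v-G : v G ≡ 0ℚ
  v-G = trans (cong (λ t → (1ℚ - t) * κ G) s-G) (solve 1 (λ k → (con 1ℚ :- con 1ℚ) :* k := con 0ℚ) refl (κ G))

  1+v² : ∀ i → 1ℚ + v i * v i ≡ two * (κ i * κ i) * (1ℚ + s i * s i)
  1+v² i = trans (cong (λ t → t * t + v i * v i) (sym (κ-inv i)))
    (solve 2 (λ k s → k :* (con 1ℚ :+ s) :* (k :* (con 1ℚ :+ s)) :+ (con 1ℚ :- s) :* k :* ((con 1ℚ :- s) :* k)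
        := con two :* (k :* k) :* (con 1ℚ :+ s :* s)) refl (κ i) (s i))

  1-v² : ∀ i → 1ℚ - v i * v i ≡ four * (κ i * κ i) * s i
  1-v² i = trans (cong (λ t → t * t - v i * v i) (sym (κ-inv i)))
    (solve 2 (λ k s → k :* (con 1ℚ :+ s) :* (k :* (con 1ℚ :+ s)) :- (con 1ℚ :- s) :* k :* ((con 1ℚ :- s) :* k)
        := con four :* (k :* k) :* s) refl (κ i) (s i))

  0≤κκ : ∀ i j → 0ℚ ≤ κ i * κ j
  0≤κκ i j = ≥0-* (0≤κ i) (0≤κ j)

  κκ≤1 : ∀ i j → κ i * κ j ≤ 1ℚ
  κκ≤1 i j = ≤-trans (*≤ˡ (0≤κ i) (κ≤1 j)) (κ≤1 i)

  0≤δδ : 0ℚ ≤ δ * δ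
  0≤δδ = ≥0-* 0≤δ 0≤δ

  [v-v]² : ∀ i → (v i - v (suc i)) * (v i - v (suc i)) ≤ four * (δ * δ)
  [v-v]² i = ≤-trans (≤-reflexive (trans (cong (λ t → t * t) (v-step i))
      (solve 2 (λ d k → con two :* (d :* k) :* (con two :* (d :* k)) := con four :* (d :* d) :* (k :* k)) refl δ
      kk)))
    (*≤ˡ (≥0-* 0≤four 0≤δδ) (≤-trans (*≤ˡ (0≤κκ i (suc i)) (κκ≤1 i (suc i))) (κκ≤1 i (suc i))))
    where
    kk = κ i * κ (suc i)
    0≤four : 0ℚ ≤ four
    0≤four = nonNegative⁻¹ four

  -- After `v-step` and `1+v²` the two quantities are 2δκ_iκ_{i+1} and 2δκ_i²(1+s_i²)μ_{i+1}. Moving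
  -- s_i to the next node costs at most 4δ² and moving one κ at most 2δ², whence the 6.
  dv-dΘ : ∀ i → i ℕ.< G → ∣ (v i - v (suc i)) - w i * (1ℚ + v i * v i) ∣ ≤ six * (δ * δ)
  dv-dΘ i l = begin
    ∣ (v i - v (suc i)) - w i * (1ℚ + v i * v i) ∣
      ≡⟨ cong ∣_∣ eq ⟩
    ∣ two * (δ * δ) * (k * k * m * (a + b)) - two * (δ * δ) * (k * k * k') ∣
      ≤⟨ ∣⁻∣≤ {two * (δ * δ) * (k * k * m * (a + b))} {two * (δ * δ) * (k * k * k')}
           (≤-trans (∣0≤∣ (≥0-* 0≤2δδ (≥0-* 0≤kkm (≥0-+ (0≤s i) (0≤s (suc i))))))
             (*-monoˡ _ 0≤2δδ (≤-trans (*≤ʳ (≥0-+ (0≤s i) (0≤s (suc i)))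
                 (≤-trans (*≤ˡ (0≤κκ i i) (μ≤1 (suc i))) (κκ≤1 i i))) (+-mono-≤ (s≤1 (ℕP.<⇒≤ l)) (s≤1 l)))))
           (≤-trans (∣0≤∣ (≥0-* 0≤2δδ (≥0-* (0≤κκ i i) (0≤κ (suc i)))))
             (*-monoˡ _ 0≤2δδ (≤-trans (*≤ˡ (0≤κκ i i) (κ≤1 (suc i))) (κκ≤1 i i)))) ⟩
    two * (δ * δ) * (1ℚ + 1ℚ) + two * (δ * δ) * 1ℚ
      ≡⟨ solve 1 (λ d → con two :* d :* (con 1ℚ :+ con 1ℚ) :+ con two :* d :* con 1ℚ := con six :* d) refl
          (δ * δ) ⟩
    six * (δ * δ) ∎
    where
    open ≤-Reasoning
    k = κ i
    k' = κ (suc i)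
    m = μ (suc i)
    a = s i
    b = s (suc i)
    0≤2δδ : 0ℚ ≤ two * (δ * δ)
    0≤2δδ = ≥0-* 0≤two 0≤δδ
    0≤kkm : 0ℚ ≤ k * k * m
    0≤kkm = ≥0-* (0≤κκ i i) (0≤μ (suc i))
    eq : (v i - v (suc i)) - w i * (1ℚ + v i * v i) ≡ two * (δ * δ) * (k * k * m * (a + b)) - two * (δ * δ) *
        (k * k * k')
    eq = E.begin
      (v i - v (suc i)) - w i * (1ℚ + v i * v i)
        E.≡⟨ cong₂ (λ p q → p - w i * q) (v-step i) (1+v² i) ⟩
      two * (δ * (k * k')) - δ * m * (two * (k * k) * (1ℚ + a * a))
        -- Grouped so that each bracket is the subject of one exact relation: `μ-inv`, `s-suc` or
        -- `κ-step`.
        E.≡⟨ solve 6 (λ d k k' m a b → con two :* (d :* (k :* k')) :- d :* m :*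
            (con two :* (k :* k) :* (con 1ℚ :+ a :* a))
              := con two :* d :* k :* k :* (con 1ℚ :- m :* (con 1ℚ :+ b :* b)) :+
                  (con two :* d :* (b :- a) :* (k :* k :* m :* (a :+ b)) :- con two :* d :* k :* (k :- k')))
                  refl δ k k' m a b ⟩
      two * δ * k * k * (1ℚ - m * (1ℚ + b * b)) + (two * δ * (b - a) * (k * k * m * (a + b)) - two * δ * k *
          (k - k'))
        E.≡⟨ cong₂ (λ p q → two * δ * k * k * (1ℚ - p) +
            (two * δ * q * (k * k * m * (a + b)) - two * δ * k * (k - k'))) (μ-inv (suc i)) (s-suc i) ⟩
      two * δ * k * k * (1ℚ - 1ℚ) + (two * δ * δ * (k * k * m * (a + b)) - two * δ * k * (k - k'))
        E.≡⟨ cong (λ p → two * δ * k * k * (1ℚ - 1ℚ) + (two * δ * δ * (k * k * m * (a + b)) - two * δ * k * p))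
            (κ-step i) ⟩
      two * δ * k * k * (1ℚ - 1ℚ) + (two * δ * δ * (k * k * m * (a + b)) - two * δ * k * (δ * (k * k')))
        E.≡⟨ solve 4 (λ d k k' X → con two :* d :* k :* k :* (con 1ℚ :- con 1ℚ) :+
            (con two :* d :* d :* X :- con two :* d :* k :* (d :* (k :* k')))
              := con two :* (d :* d) :* X :- con two :* (d :* d) :* (k :* k :* k')) refl δ k k'
                  (k * k * m * (a + b)) ⟩
      two * (δ * δ) * (k * k * m * (a + b)) - two * (δ * δ) * (k * k * k') E.∎
      where module E = ≡-Reasoning

  -- Iterated sums taken from the end s = 0, that is over larger values of v, with L innermost. They
  -- include the diagonal i' = i, to match the tail sums in Θ exactly.
  Tl : ℕ → ℕ → ℕ → ℚ
  Tl e zero i = L e i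
  Tl e (suc j) i = Sum (suc i) (λ i' → w i' * Tl e j i')

  -- y e 0 b discretises ∫ (log 1/s)^e/e! d(v^b); for j ≥ 1, y e j b discretises the integral of
  -- v₁^b (log 1/s(v_j))^e/e! over 0 < v₁ < ⋯ < v_j < 1 against ∏ dv_i/(1+v_i²).
  y : ℕ → ℕ → ℕ → ℚ
  y e zero b = Sum G (λ i → (pow (v i) b - pow (v (suc i)) b) * L e i)
  y e (suc j) b = Sum G (λ i → pow (v i) b * (w i * Tl e j i))

  0≤Tl : ∀ e j {i} → i ℕ.< G → 0ℚ ≤ Tl e j i
  0≤Tl e zero l = 0≤L e (ℕP.<⇒≤ l)
  0≤Tl e (suc j) {i} l = Sum-≥0 (suc i) λ i' l' → ≥0-* (0≤w i') (0≤Tl e j (ℕP.<-≤-trans l' l))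

  -- A further integration does not raise the bound: since w ≤ δ, `Tl e (suc j)` is at most the mass
  -- at level j, and the grid has total length 1.
  Sum-Tl≤ : ∀ e j → Sum G (λ i → δ * Tl e j i) ≤ pow two e
  Sum-Tl≤ e zero = ≤-trans (≤-reflexive (Sum-ext G λ i → cong (δ *_) (sym (*-identityʳ (L e i)))))
      (≤-trans (Sum-P≤ e 0) (≤-reflexive (cong (pow two) (ℕP.+-identityʳ e))))
  Sum-Tl≤ e (suc j) = ≤-trans (Sum-mono G {λ i → δ * Tl e (suc j) i} {λ _ → δ * pow two e} λ i l → *-monoˡ δ 0≤δ
      (le i l))
    (≤-reflexive (trans (Sum-const G (δ * pow two e)) (trans
        (solve 3 (λ g d p → g :* (d :* p) := d :* g :* p) refl (ι G) δ (pow two e))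
        (trans (cong (_* pow two e) δG) (*-identityˡ (pow two e))))))
    where
    f : ℕ → ℚ
    f i = w i * Tl e j i
    le : ∀ i → i ℕ.< G → Tl e (suc j) i ≤ pow two e
    le i l = ≤-trans (0≤-⇒≤ {Sum (suc i) f} {Sum G f} (0≤tailSum f (λ i' l' → ≥0-* (0≤w i') (0≤Tl e j l')) l))
      (≤-trans (Sum-mono G λ i' l' → *-monoʳ (Tl e j i') (0≤Tl e j l') (w≤δ i')) (Sum-Tl≤ e j))

  0≤y : ∀ e j b → 0ℚ ≤ y e (suc j) b
  0≤y e j b = Sum-≥0 G λ i l → ≥0-* (pow-≥0 b (0≤v (ℕP.<⇒≤ l))) (≥0-* (0≤w i) (0≤Tl e j l))

  y-increments : ∀ e j b → Sum G (λ i → (pow (v i) (suc b) - pow (v (suc i)) (suc b)) * Tl e j i) ≡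
      y e j (suc b)
  y-increments e zero b = refl
  y-increments e (suc j) b = trans (Sum-by-parts' G (λ i → pow (v i) (suc b)) f)
    (trans (cong (λ t → y e (suc j) (suc b) - t * pow (v G) b * Sum G f) v-G)
      (solve 3 (λ a b c → a :- con 0ℚ :* b :* c := a) refl (y e (suc j) (suc b)) (pow (v G) b) (Sum G f)))
    where
    f : ℕ → ℚ
    f i = w i * Tl e j i

  -- From d(v^(b+1)) = (b+1) v^b (1+v²) dΘ. In the constant, the first term is the Taylor error for
  -- increments of v of size at most 2δ, and the second comes from `dv-dΘ`.
  y-rec : ∀ e j b → ∣ y e j (suc b) - ι (suc b) * (y e (suc j) b + y e (suc j) (suc (suc b))) ∣ ≤
      (taylorC b * four + ι (suc b) * six) * pow two e * δ
  y-rec e j b = subst₂ (λ p q → ∣ p - q ∣ ≤ (taylorC b * four + ι (suc b) * six) * pow two e * δ)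
      (y-increments e j b) eq
    (riemann {f} {g} {Tl e j} (≥0-+ (≥0-* (0≤taylorC b) (nonNegative⁻¹ four))
        (≥0-* (0≤ι (suc b)) (nonNegative⁻¹ six))) fg (λ i l → 0≤Tl e j l) (Sum-Tl≤ e j))
    where
    f g : ℕ → ℚ
    f i = pow (v i) (suc b) - pow (v (suc i)) (suc b)
    g i = ι (suc b) * (w i * (1ℚ + v i * v i) * pow (v i) b)
    eq : Sum G (λ i → g i * Tl e j i) ≡ ι (suc b) * (y e (suc j) b + y e (suc j) (suc (suc b)))
    eq = trans (Sum-ext G λ i → solve 5 (λ N w v p t → N :* (w :* (con 1ℚ :+ v :* v) :* p) :* t := N :*
        (p :* (w :* t) :+ v :* (v :* p) :* (w :* t))) refl (ι (suc b)) (w i) (v i) (pow (v i) b) (Tl e j i))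
      (trans (Sum-*ˡ G (ι (suc b)) (λ i → pow (v i) b * (w i * Tl e j i) + pow (v i) (suc (suc b)) *
          (w i * Tl e j i)))
        (cong (ι (suc b) *_) (Sum-+ G (λ i → pow (v i) b * (w i * Tl e j i))
            (λ i → pow (v i) (suc (suc b)) * (w i * Tl e j i)))))
    fg : ∀ i → i ℕ.< G → ∣ f i - g i ∣ ≤ (taylorC b * four + ι (suc b) * six) * (δ * δ)
    fg i l = begin
      ∣ f i - g i ∣
        ≡⟨ cong ∣_∣ (solve 5 (λ f N d q p → f :- N :* (q :* p) := (f :- N :* (d :* p)) :+ N :* ((d :- q) :* p))
            refl (f i) (ι (suc b)) d q p) ⟩
      ∣ (f i - ι (suc b) * (d * p)) + ι (suc b) * ((d - q) * p) ∣
        ≤⟨ ∣+∣≤ {f i - ι (suc b) * (d * p)} {ι (suc b) * ((d - q) * p)}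
             (≤-trans (pow-taylor b {v i} {v (suc i)} hv (v≤1 i) (0≤v l) (v≤1 (suc i)))
                 (*-monoˡ (taylorC b) (0≤taylorC b) ([v-v]² i)))
             (∣*∣≤ {ι (suc b)} {(d - q) * p} (∣0≤∣ (0≤ι (suc b)))
                 (∣*∣≤ {d - q} {p} (dv-dΘ i l) (≤-trans (∣0≤∣ (pow-≥0 b hv)) (pow-≤1 b hv (v≤1 i))))) ⟩
      taylorC b * (four * (δ * δ)) + ι (suc b) * (six * (δ * δ) * 1ℚ)
        ≡⟨ solve 5 (λ t a N b d → t :* (a :* d) :+ N :* (b :* d :* con 1ℚ) := (t :* a :+ N :* b) :* d) refl
            (taylorC b) four (ι (suc b)) six (δ * δ) ⟩
      (taylorC b * four + ι (suc b) * six) * (δ * δ) ∎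
      where
      open ≤-Reasoning
      d = v i - v (suc i)
      q = w i * (1ℚ + v i * v i)
      p = pow (v i) b
      hv = 0≤v (ℕP.<⇒≤ l)

  -- Exact on every mesh: `Sum-triangle` transfers the k nested tail sums of Θ one at a time onto
  -- `Tl`, and j in `fubini` counts those already moved.
  x≡y : ∀ e k → x e k 0 ≡ y e (suc k) 0
  x≡y e k = trans (Sum-ext G λ i → solve 3 (λ w l t → w :* con 1ℚ :* (l :* t) := w :* l :* t) refl (w i) (L e i)
      (Θ k i))
    (trans (fubini 0 k) (trans (cong (λ j → Sum G (λ i → w i * Tl e j i * 1ℚ)) (ℕP.+-identityʳ k))
        (Sum-ext G λ i → solve 2 (λ w t → w :* t :* con 1ℚ := con 1ℚ :* (w :* t)) refl (w i) (Tl e k i))))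
    where
    fubini : ∀ j k → Sum G (λ i → w i * Tl e j i * Θ k i) ≡ Sum G (λ i → w i * Tl e (k ℕ.+ j) i * 1ℚ)
    fubini j zero = refl
    fubini j (suc k) = trans (Sum-triangle G (λ i → w i * Tl e j i) (λ i → w i * Θ k i))
      (trans (Sum-ext G λ i → solve 3 (λ w t s → w :* t :* s := w :* s :* t) refl (w i) (Θ k i)
          (Tl e (suc j) i))
        (trans (fubini (suc j) k) (cong (λ j → Sum G (λ i → w i * Tl e j i * 1ℚ)) (ℕP.+-suc k j))))

  y-00 : ∀ e → y e 0 0 ≡ 0ℚ
  y-00 e = Sum-0 G λ i _ → trans (cong (_* L e i) (+-inverseʳ 1ℚ)) (*-zeroˡ (L e i))

  y-0 : ∀ b → y 0 0 (suc b) ≡ 1ℚ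
  y-0 b = trans (Sum-ext G λ i → *-identityʳ (pow (v i) (suc b) - pow (v (suc i)) (suc b)))
      (trans (Sum-telescope G (λ i → pow (v i) (suc b)))
    (trans (cong₂ (λ a c → pow a (suc b) - c * pow (v G) b) v-0 v-G)
        (trans (cong (_- 0ℚ * pow (v G) b) (pow-1 (suc b)))
        (solve 1 (λ t → con 1ℚ :- con 0ℚ :* t := con 1ℚ) refl (pow (v G) b)))))

  -- Integration by parts of v^b - v^(b+2). Both boundary terms vanish, since v = 1 at s = 0 and L =
  -- 0 at s = 1, and the factor 1 - v² = 4κ²s cancels the 1/s in the increment of the logarithm.
  log-increments : ∀ e b → y (suc e) 0 (suc (suc b)) - y (suc e) 0 b ≡
      Sum G (λ i → four * (δ * (κ (suc i) * κ (suc i)) * pow (v (suc i)) b) * L e i)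
  log-increments e b = begin
    y (suc e) 0 (suc (suc b)) - y (suc e) 0 b
      ≡⟨ sym (Sum-- G (λ i → (pow (v i) (suc (suc b)) - pow (v (suc i)) (suc (suc b))) * Le i)
          (λ i → (pow (v i) b - pow (v (suc i)) b) * Le i)) ⟩
    Sum G (λ i → (pow (v i) (suc (suc b)) - pow (v (suc i)) (suc (suc b))) * Le i -
        (pow (v i) b - pow (v (suc i)) b) * Le i)
      ≡⟨ Sum-ext G (λ i → solve 5 (λ a b c d l → (a :- b) :* l :- (c :- d) :* l := (d :- b :- (c :- a)) :* l)
          refl (pow (v i) (suc (suc b))) (pow (v (suc i)) (suc (suc b))) (pow (v i) b) (pow (v (suc i)) b)
          (Le i)) ⟩
    Sum G (λ i → (H (suc i) - H i) * Le i)
      ≡⟨ Sum-by-parts G H Le ⟩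
    H G * Le G - H 0 * Le 0 + Sum G (λ i → H (suc i) * (Le i - Le (suc i)))
      ≡⟨ cong₂ _+_ (cong₂ (λ p q → H G * p - q * Le 0) (tailSum-G (λ j → w₀ j * L e j)) H0)
          (Sum-ext G λ i → trans (cong (H (suc i) *_) (tailSum-step (λ j → w₀ j * L e j) i)) (term i)) ⟩
    H G * 0ℚ - 0ℚ * Le 0 + Sum G f
      ≡⟨ solve 3 (λ a b c → a :* con 0ℚ :- con 0ℚ :* b :+ c := c) refl (H G) (Le 0) (Sum G f) ⟩
    Sum G f ∎
    where
    open ≡-Reasoning
    Le = L (suc e)
    H f : ℕ → ℚ
    H i = pow (v i) b - pow (v i) (suc (suc b))
    f i = four * (δ * (κ (suc i) * κ (suc i)) * pow (v (suc i)) b) * L e i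
    H0 : H 0 ≡ 0ℚ
    H0 = trans (cong (λ t → pow t b - pow t (suc (suc b))) v-0)
        (trans (cong₂ _-_ (pow-1 b) (pow-1 (suc (suc b)))) (+-inverseʳ 1ℚ))
    term : ∀ i → H (suc i) * (w₀ i * L e i) ≡ f i
    term i = trans (solve 4 (λ p v w l → (p :- v :* (v :* p)) :* (w :* l) := (con 1ℚ :- v :* v) :* w :* p :* l)
        refl (pow (v (suc i)) b) (v (suc i)) (w₀ i) (L e i))
      (trans (cong (λ t → t * w₀ i * pow (v (suc i)) b * L e i) (1-v² (suc i)))
      (trans (solve 6 (λ c k s w p l → c :* k :* s :* w :* p :* l := c :* (s :* w :* k :* p) :* l) refl four
          (κ (suc i) * κ (suc i)) (s (suc i)) (w₀ i) (pow (v (suc i)) b) (L e i))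
        (cong (λ t → four * (t * (κ (suc i) * κ (suc i)) * pow (v (suc i)) b) * L e i) (s*w₀ i))))

  -- Here `y e 0 b` plays the role of b A_e(b), so this is the recurrence in the power of L with the
  -- denominator b + 1 cleared. It rests on 4κ²δ being twice the increment of v up to O(δ²).
  log-rec : ∀ e b → ∣ two * y e 0 (suc b) - ι (suc b) * (y (suc e) 0 (suc (suc b)) - y (suc e) 0 b) ∣ ≤
      (taylorC b * eight + ι (suc b) * four) * pow two e * δ
  log-rec e b = subst₂ (λ p q → ∣ p - q ∣ ≤ (taylorC b * eight + ι (suc b) * four) * pow two e * δ)
      (trans (Sum-ext G λ i → *-assoc two (pow (v i) (suc b) - pow (v (suc i)) (suc b)) (L e i))
          (Sum-*ˡ G two (λ i → (pow (v i) (suc b) - pow (v (suc i)) (suc b)) * L e i)))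
      (trans (Sum-ext G λ i → *-assoc (ι (suc b)) (h i) (L e i))
          (trans (Sum-*ˡ G (ι (suc b)) (λ i → h i * L e i)) (cong (ι (suc b) *_) (sym (log-increments e b)))))
      (riemann {f} {g} {L e} (≥0-+ (≥0-* (0≤taylorC b) (nonNegative⁻¹ eight))
          (≥0-* (0≤ι (suc b)) (nonNegative⁻¹ four))) fg (λ i l → 0≤L e (ℕP.<⇒≤ l)) (Sum-Tl≤ e 0))
    where
    f g h : ℕ → ℚ
    f i = two * (pow (v i) (suc b) - pow (v (suc i)) (suc b))
    h i = four * (δ * (κ (suc i) * κ (suc i)) * pow (v (suc i)) b)
    g i = ι (suc b) * h i
    fg : ∀ i → i ℕ.< G → ∣ f i - g i ∣ ≤ (taylorC b * eight + ι (suc b) * four) * (δ * δ)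
    fg i l = begin
      ∣ f i - g i ∣
        -- The Taylor expansion is taken at `v (suc i)`, because `log-increments` produces powers at
        -- that node; hence the reversed signs.
        ≡⟨ cong ∣_∣ (trans (solve 7 (λ X Y N d k' v v' → con two :* (X :- Y) :- N :*
            (con four :* (d :* (k' :* k') :* v'))
             := :- (con two :* (Y :- X :- N :* ((:- v) :* v'))) :+ N :*
                 (con two :* (v :- con two :* (d :* (k' :* k'))) :* v')) refl (pow (v i) (suc b))
                 (pow (v (suc i)) (suc b)) (ι (suc b)) δ k' d p)
             (cong₂ (λ t u → - (two * (Y - X - ι (suc b) * (t * p))) + ι (suc b) * (two * u * p))
                 (solve 2 (λ a b → :- (a :- b) := b :- a) refl (v i) (v (suc i))) deq)) ⟩
      ∣ - (two * (Y - X - ι (suc b) * ((v (suc i) - v i) * p))) + ι (suc b) *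
          (two * (two * (δ * δ) * (k * k' * k')) * p) ∣
        ≤⟨ ∣+∣≤ { - (two * D)} {ι (suc b) * (two * (two * (δ * δ) * (k * k' * k')) * p)}
             (≤-trans (≤-reflexive (∣-p∣≡∣p∣ (two * D)))
                 (∣*∣≤ {two} {D} (∣0≤∣ 0≤two) (≤-trans (pow-taylor b {v (suc i)} {v i} hv' (v≤1 (suc i))
                 (0≤v (ℕP.<⇒≤ l)) (v≤1 i))
                (*-monoˡ (taylorC b) (0≤taylorC b) (≤-trans
                    (≤-reflexive (solve 2 (λ a b → (b :- a) :* (b :- a) := (a :- b) :* (a :- b)) refl (v i)
                    (v (suc i)))) ([v-v]² i))))))
             (≤-trans (∣0≤∣ (≥0-* (0≤ι (suc b)) (≥0-* (≥0-* 0≤two 0≤t) (pow-≥0 b hv'))))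
               (*-monoˡ (ι (suc b)) (0≤ι (suc b)) (≤-trans (*≤ˡ (≥0-* 0≤two 0≤t) (pow-≤1 b hv' (v≤1 (suc i))))
                   (*-monoˡ two 0≤two (*≤ˡ (≥0-* 0≤two 0≤δδ)
                   (≤-trans (*≤ˡ (0≤κκ i (suc i)) (κ≤1 (suc i))) (κκ≤1 i (suc i)))))))) ⟩
      two * (taylorC b * (four * (δ * δ))) + ι (suc b) * (two * (two * (δ * δ)))
        ≡⟨ solve 3 (λ t N d → con two :* (t :* (con four :* d)) :+ N :* (con two :* (con two :* d)) :=
            (t :* con eight :+ N :* con four) :* d) refl (taylorC b) (ι (suc b)) (δ * δ) ⟩
      (taylorC b * eight + ι (suc b) * four) * (δ * δ) ∎
      where
      open ≤-Reasoning
      k = κ i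
      k' = κ (suc i)
      d = v i - v (suc i)
      X = pow (v i) (suc b)
      Y = pow (v (suc i)) (suc b)
      p = pow (v (suc i)) b
      D = Y - X - ι (suc b) * ((v (suc i) - v i) * p)
      hv' = 0≤v l
      0≤t : 0ℚ ≤ two * (δ * δ) * (k * k' * k')
      0≤t = ≥0-* (≥0-* 0≤two 0≤δδ) (≥0-* (0≤κκ i (suc i)) (0≤κ (suc i)))
      deq : d - two * (δ * (k' * k')) ≡ two * (δ * δ) * (k * k' * k')
      deq = trans (cong (_- two * (δ * (k' * k'))) (v-step i))
          (trans (solve 3 (λ d k k' → con two :* (d :* (k :* k')) :- con two :* (d :* (k' :* k')) := con two :*
          d :* k' :* (k :- k')) refl δ k k')
        (trans (cong (two * δ * k' *_) (κ-step i)) (solve 3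
            (λ d k k' → con two :* d :* k' :* (d :* (k :* k')) := con two :* (d :* d) :* (k :* k' :* k')) refl δ
            k k')))

  -- g e a discretises ∫ s^a (log 1/s)^e / e! ds/(1+s)².

  g : ℕ → ℕ → ℚ
  g e a = Sum G (λ i → δ * (κ (suc i) * κ (suc i)) * pow (s (suc i)) a * P e 0 i)

  g-z : ∀ e a → g e a + two * g e (suc a) + g e (suc (suc a)) ≡ z e 0 a
  g-z e a = trans (cong (λ t → g e a + t + g e (suc (suc a)))
      (sym (Sum-*ˡ G two (λ i → δ * (κ (suc i) * κ (suc i)) * pow (s (suc i)) (suc a) * P e 0 i))))
    (trans (cong (_+ g e (suc (suc a))) (sym (Sum-+ G _ _))) (trans (sym (Sum-+ G _ _)) (Sum-ext G λ i →
      trans (solve 5 (λ d k p P s → d :* (k :* k) :* p :* P :+ con two :* (d :* (k :* k) :* (s :* p) :* P) :+ d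
          :* (k :* k) :* (s :* (s :* p)) :* P
               := d :* (k :* (con 1ℚ :+ s) :* (k :* (con 1ℚ :+ s))) :* p :* P) refl δ (κ (suc i))
                   (pow (s (suc i)) a) (P e 0 i) (s (suc i)))
        (cong (λ t → t * pow (s (suc i)) a * P e 0 i) (trans (cong (λ t → δ * (t * t)) (κ-inv (suc i)))
            (*-identityʳ δ))))))

  0≤g : ∀ e a → 0ℚ ≤ g e a
  0≤g e a = Sum-≥0 G λ i l → ≥0-* (≥0-* (≥0-* 0≤δ (0≤κκ (suc i) (suc i))) (0≤s^ a i)) (0≤P e 0 (ℕP.<⇒≤ l))

  g≤z : ∀ e a → g e a ≤ z e 0 a
  g≤z e a = Sum-mono G λ i l → *-monoʳ (P e 0 i) (0≤P e 0 (ℕP.<⇒≤ l))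
      (*-monoʳ (pow (s (suc i)) a) (0≤s^ a i) (*≤ˡ 0≤δ (κκ≤1 (suc i) (suc i))))

  -- Finite form of 1/(1+s)² = Σ (-1)^k (k+1) s^k, obtained by inserting `g-z`, with the exact
  -- remainder after N terms.
  alternating-z : ∀ e N → Sum N (λ k → sgn k * (ι (suc k) * z e 0 k)) ≡
      g e 0 - sgn N * (ι (suc N) * g e N + ι N * g e (suc N))
  alternating-z e zero = solve 2 (λ a b → con 0ℚ := a :- con 1ℚ :* ((con 1ℚ :+ con 0ℚ) :* a :+ con 0ℚ :* b))
      refl (g e 0) (g e 1)
  alternating-z e (suc N) = trans (cong₂ _+_ (alternating-z e N)
      (cong (λ t → sgn N * (ι (suc N) * t)) (sym (g-z e N))))
    (solve 6 (λ g₀ σ m a b c → g₀ :- σ :* ((con 1ℚ :+ m) :* a :+ m :* b) :+ σ :*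
        ((con 1ℚ :+ m) :* (a :+ con two :* b :+ c))
      := g₀ :- (:- σ) :* ((con 1ℚ :+ (con 1ℚ :+ m)) :* b :+ (con 1ℚ :+ m) :* c)) refl (g e 0) (sgn N) (ι N)
          (g e N) (g e (suc N)) (g e (suc (suc N))))

  y-g : ∀ e → ∣ y e 0 1 - two * g e 0 ∣ ≤ two * pow two e * δ
  y-g e = subst (λ q → ∣ y e 0 1 - q ∣ ≤ two * pow two e * δ)
      (trans (Sum-ext G λ i → solve 3 (λ k l d → con two :* (d :* k) :* l := con two :*
          (d :* k :* con 1ℚ :* (l :* con 1ℚ))) refl (κ (suc i) * κ (suc i)) (L e i) δ)
        (Sum-*ˡ G two (λ i → δ * (κ (suc i) * κ (suc i)) * 1ℚ * P e 0 i)))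
      (riemann {λ i → pow (v i) 1 - pow (v (suc i)) 1} {λ i → two * (δ * (κ (suc i) * κ (suc i)))} {L e} 0≤two
          fg (λ i l → 0≤L e (ℕP.<⇒≤ l)) (Sum-Tl≤ e 0))
    where
    fg : ∀ i → i ℕ.< G → ∣ (pow (v i) 1 - pow (v (suc i)) 1) - two * (δ * (κ (suc i) * κ (suc i))) ∣ ≤
        two * (δ * δ)
    fg i l = begin
      ∣ (v i * 1ℚ - v (suc i) * 1ℚ) - two * (δ * (k' * k')) ∣
        ≡⟨ cong ∣_∣ (trans (cong (_- two * (δ * (k' * k')))
            (trans (cong₂ _-_ (*-identityʳ (v i)) (*-identityʳ (v (suc i)))) (v-step i)))
             (trans (solve 3 (λ d k k' → con two :* (d :* (k :* k')) :- con two :* (d :* (k' :* k')) := con two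
                 :* d :* k' :* (k :- k')) refl δ k k')
               (trans (cong (two * δ * k' *_) (κ-step i))
                   (solve 3 (λ d k k' → con two :* d :* k' :* (d :* (k :* k')) := con two :* (d :* d) :*
                   (k :* k' :* k')) refl δ k k')))) ⟩
      ∣ two * (δ * δ) * (k * k' * k') ∣
        ≤⟨ ∣0≤∣ (≥0-* (≥0-* 0≤two 0≤δδ) (≥0-* (0≤κκ i (suc i)) (0≤κ (suc i)))) ⟩
      two * (δ * δ) * (k * k' * k')
        ≤⟨ *≤ˡ (≥0-* 0≤two 0≤δδ) (≤-trans (*≤ˡ (0≤κκ i (suc i)) (κ≤1 (suc i))) (κκ≤1 i (suc i))) ⟩
      two * (δ * δ) ∎
      where
      open ≤-Reasoning
      k = κ i
      k' = κ (suc i)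

-- Sums over the lists of Defs

upFrom : ℕ → ℕ → List ℕ
upFrom x zero = []
upFrom x (suc c) = x ∷ upFrom (suc x) c

-- The meta in the type of range-go is solved by the local function of range.
mutual
  range-upFrom : ∀ a b → range a b ≡ upFrom a (suc b ∸ a)
  range-upFrom a b with suc b ∸ a
  ... | zero = refl
  ... | suc c with suc a
  ...   | x = cong (a ∷_) (range-go a b x c)

  range-go : ∀ a b x c → _ ≡ upFrom x c
  range-go a b x zero = refl
  range-go a b x (suc c) = cong (x ∷_) (range-go a b (suc x) c)

sum-upFrom : ∀ f x c → sumℚ (map f (upFrom x c)) ≡ Sum c (λ i → f (x ℕ.+ i))
sum-upFrom f x zero = refl
sum-upFrom f x (suc c) = trans (cong₂ _+_ (cong f (sym (ℕP.+-identityʳ x)))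
    (trans (sum-upFrom f (suc x) c) (Sum-ext c λ i → cong f (sym (ℕP.+-suc x i)))))
  (sym (Sum-head c (λ i → f (x ℕ.+ i))))

Σ-Sum : ∀ a b f → Σ[ a ⋯ b ] f ≡ Sum (suc b ∸ a) (λ i → f (a ℕ.+ i))
Σ-Sum a b f = trans (cong (λ l → sumℚ (map f l)) (range-upFrom a b)) (sum-upFrom f a (suc b ∸ a))

sumℚ-++ : ∀ xs ys → sumℚ (xs ++ ys) ≡ sumℚ xs + sumℚ ys
sumℚ-++ [] ys = sym (+-identityˡ (sumℚ ys))
sumℚ-++ (x ∷ xs) ys = trans (cong (x +_) (sumℚ-++ xs ys)) (sym (+-assoc x (sumℚ xs) (sumℚ ys)))

sum-concatMap : {A B : Set} (f : B → ℚ) (g : A → List B) (l : List A) → sumℚ (map f (concatMap g l)) ≡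
    sumℚ (map (λ a → sumℚ (map f (g a))) l)
sum-concatMap f g [] = refl
sum-concatMap f g (a ∷ l) = trans (cong sumℚ (map-++ f (g a) (concatMap g l)))
    (trans (sumℚ-++ (map f (g a)) _) (cong (sumℚ (map f (g a)) +_) (sum-concatMap f g l)))

sum-map-∘ : {A B : Set} (f : B → ℚ) (g : A → B) (l : List A) → sumℚ (map f (map g l)) ≡ sumℚ (map (f ∘ g) l)
sum-map-∘ f g l = cong sumℚ (sym (map-∘ l))

Sum-extend : ∀ m d f → (∀ i → i ℕ.< d → f (m ℕ.+ i) ≡ 0ℚ) → Sum (m ℕ.+ d) f ≡ Sum m f
Sum-extend m zero f h = cong (λ t → Sum t f) (ℕP.+-identityʳ m)
Sum-extend m (suc d) f h = trans (cong (λ t → Sum t f) (ℕP.+-suc m d))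
  (trans (cong₂ _+_ (Sum-extend m d f (λ i l → h i (ℕP.m<n⇒m<1+n l))) (h d ℕP.≤-refl)) (+-identityʳ (Sum m f)))

-- Sums over compositions

sumI : ℕ → ℕ → (List ℕ → ℚ) → ℚ
sumI r k F = sumℚ (map F (I k r))

sumI-suc : ∀ r k F → sumI (suc r) k F ≡ Sum k (λ j → sumI r (k ∸ suc j) (λ ks → F (suc j ∷ ks)))
sumI-suc r k F = trans (sum-concatMap F (λ a → map (a ∷_) (I (k ∸ a) r)) (range 1 k))
  (trans (cong sumℚ (map-cong (λ a → sum-map-∘ F (a ∷_) (I (k ∸ a) r)) (range 1 k)))
    (Σ-Sum 1 k (λ a → sumI r (k ∸ a) (λ ks → F (a ∷ ks)))))

sumI-ext : ∀ r k {F F'} → (∀ ks → F ks ≡ F' ks) → sumI r k F ≡ sumI r k F'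
sumI-ext r k h = cong sumℚ (map-cong h (I k r))

sumℚ-*ˡ : {A : Set} (c : ℚ) (F : A → ℚ) (l : List A) → sumℚ (map (λ a → c * F a) l) ≡ c * sumℚ (map F l)
sumℚ-*ˡ c F [] = sym (*-zeroʳ c)
sumℚ-*ˡ c F (a ∷ l) = trans (cong (c * F a +_) (sumℚ-*ˡ c F l)) (sym (*-distribˡ-+ c (F a) (sumℚ (map F l))))

sumℚ-Sum : {A : Set} (m : ℕ) (F : A → ℕ → ℚ) (l : List A) → sumℚ (map (λ a → Sum m (F a)) l) ≡
    Sum m (λ i → sumℚ (map (λ a → F a i) l))
sumℚ-Sum m F [] = sym (Sum-0 m λ _ _ → refl)
sumℚ-Sum m F (a ∷ l) = trans (cong (Sum m (F a) +_) (sumℚ-Sum m F l))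
    (sym (Sum-+ m (F a) (λ i → sumℚ (map (λ a → F a i) l))))

sumI-0 : ∀ r k F → k ℕ.< r → sumI r k F ≡ 0ℚ
sumI-0 (suc r) k F (s≤s h) = trans (sumI-suc r k F) (Sum-0 k λ j l → sumI-0 r (k ∸ suc j) _
    (ℕP.<-≤-trans (∸suc-< k j l) h))

sumI-length : ∀ r k F → sumI r k (λ ks → pow two (length ks) * F ks) ≡ pow two r * sumI r k F
sumI-length zero zero F = solve 1 (λ f → con 1ℚ :* f :+ con 0ℚ := con 1ℚ :* (f :+ con 0ℚ)) refl (F [])
sumI-length zero (suc k) F = refl
sumI-length (suc r) k F = trans (sumI-suc r k _) (trans (Sum-ext k λ j →
    trans (sumI-ext r (k ∸ suc j) λ ks → solve 2 (λ p f → con two :* p :* f := p :* (con two :* f)) refl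
        (pow two (length ks)) (F (suc j ∷ ks)))
      (trans (sumI-length r (k ∸ suc j) (λ ks → two * F (suc j ∷ ks)))
        (trans (cong (pow two r *_) (sumℚ-*ˡ two (λ ks → F (suc j ∷ ks)) (I (k ∸ suc j) r)))
          (solve 2 (λ p f → p :* (con two :* f) := con two :* p :* f) refl (pow two r)
              (sumI r (k ∸ suc j) (λ ks → F (suc j ∷ ks)))))))
  (trans (Sum-*ˡ k (two * pow two r) (λ j → sumI r (k ∸ suc j) (λ ks → F (suc j ∷ ks))))
      (cong (two * pow two r *_) (sym (sumI-suc r k F)))))

-- The inner part of a truncated sum W, without the power of 2 and with its indices restricted to
-- exceed `prev`; the induction on the depth needs this starting point free.
V : ℕ → ℕ → ℕ → ℕ → ℕ → ℚ
V r k i prev N = sumI r k (λ ks → tbarSum ks i prev N)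

W-V : ∀ N k r → W N k r ≡ pow two r * V r k 1 0 N
W-V N k r = sumI-length r k (λ ks → tbarSum ks 1 0 N)

-- Writing the weight as e plus the depth makes e the excess over the minimal weight: a first
-- exponent j + 1 leaves excess e - j, and exponents beyond e + 1 leave too little weight for the
-- other r entries.
V-suc : ∀ r e i prev N → V (suc r) (e ℕ.+ suc r) i prev N ≡
  Sum (N ∸ prev) (λ t → Sum (suc e) (λ j → pow (inv (2 ℕ.* (suc prev ℕ.+ t) ∸ i)) (suc j) * V r ((e ∸ j) ℕ.+ r)
      (suc i) (suc prev ℕ.+ t) N))
V-suc r e i prev N = begin
  V (suc r) k i prev N   ≡⟨ sumI-suc r k _ ⟩
  Sum k f                ≡⟨ cong (λ t → Sum t f) (ℕP.+-suc e r) ⟩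
  Sum (suc e ℕ.+ r) f    ≡⟨ Sum-extend (suc e) r f beyond ⟩
  Sum (suc e) f          ≡⟨ Sum-cong (suc e) term ⟩
  Sum (suc e) (λ j → Sum (N ∸ prev) (λ t → h t j)) ≡⟨ Sum-swap (suc e) (N ∸ prev) (λ j t → h t j) ⟩
  Sum (N ∸ prev) (λ t → Sum (suc e) (h t)) ∎
  where
  open ≡-Reasoning
  k = e ℕ.+ suc r
  f : ℕ → ℚ
  f j = sumI r (k ∸ suc j) (λ ks → tbarSum (suc j ∷ ks) i prev N)
  h : ℕ → ℕ → ℚ
  h t j = pow (inv (2 ℕ.* (suc prev ℕ.+ t) ∸ i)) (suc j) * V r ((e ∸ j) ℕ.+ r) (suc i) (suc prev ℕ.+ t) N
  beyond : ∀ j → j ℕ.< r → f (suc e ℕ.+ j) ≡ 0ℚ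
  beyond j l = sumI-0 r _ _ (subst (ℕ._< r) (sym (trans (cong (_∸ suc (suc (e ℕ.+ j))) (ℕP.+-suc e r))
    (trans (cong (e ℕ.+ r ∸_) (sym (ℕP.+-suc e j))) (ℕP.[m+n]∸[m+o]≡n∸o e r (suc j))))) (∸suc-< r j l))
  term : ∀ j → j ℕ.< suc e → f j ≡ Sum (N ∸ prev) (λ t → h t j)
  term j (s≤s l) = trans (cong (λ t → sumI r t (λ ks → tbarSum (suc j ∷ ks) i prev N)) keq)
    (trans (sumI-ext r ((e ∸ j) ℕ.+ r) λ ks → Σ-Sum (suc prev) N
        (λ n → pow (inv (2 ℕ.* n ∸ i)) (suc j) * tbarSum ks (suc i) n N))
      (trans (sumℚ-Sum (N ∸ prev) (λ ks t → pow (inv (2 ℕ.* (suc prev ℕ.+ t) ∸ i)) (suc j) * tbarSum ks (suc i)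
          (suc prev ℕ.+ t) N) (I ((e ∸ j) ℕ.+ r) r))
        (Sum-ext (N ∸ prev) λ t → sumℚ-*ˡ (pow (inv (2 ℕ.* (suc prev ℕ.+ t) ∸ i)) (suc j))
            (λ ks → tbarSum ks (suc i) (suc prev ℕ.+ t) N) (I ((e ∸ j) ℕ.+ r) r))))
    where
    keq : k ∸ suc j ≡ (e ∸ j) ℕ.+ r
    keq = trans (cong (_∸ suc j) (ℕP.+-suc e r)) (ℕP.+-∸-comm r l)

-- The s-side: W as an iterated moment

zS xS xsS yS : ℕ → ℕ → ℕ → ℕ → ℚ
zS e k a n = Grid.z n e k a
xS e k a n = Grid.x n e k a
xsS e k a n = Grid.xs n e k a
yS e j b n = GridV.y n e j b

inv*ι : ∀ d t → inv (suc d) * (ι (suc d) * t) ≡ t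
inv*ι d t = trans (sym (*-assoc (inv (suc d)) (ι (suc d)) t)) (trans (cong (_* t) (inv-ι d)) (*-identityˡ t))

z-step : ∀ e k a → zS e k a ≈ (λ n → inv (suc a) * (Grid.zp n e k a + Grid.xs n e k (suc a)))
z-step e k a = ≈-ext {λ n → inv (suc a) * (ι (suc a) * zS e k a n)} {r} {zS e k a} {r}
    (λ n → inv*ι a (zS e k a n)) (λ _ → refl)
    (≈-scale {λ n → ι (suc a) * zS e k a n} {λ n → Grid.zp n e k a + Grid.xs n e k (suc a)} (inv (suc a))
        (apx-δ (taylorC a * pow two (e ℕ.+ k) + pow two (e ℕ.+ k)) λ n → Grid.z-rec n e k a))
  where
  r : ℕ → ℚ
  r n = inv (suc a) * (Grid.zp n e k a + Grid.xs n e k (suc a))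

-- Iteration of `z-step` until e is exhausted. The sum over j matches the sum over the first
-- exponent in `V-suc`, which is how W becomes a moment.
z-expand : ∀ e k a → zS e k a ≈ (λ n → Sum (suc e) (λ j → pow (inv (suc a)) (suc j) * xsS (e ∸ j) k (suc a) n))
z-expand zero k a = ≈-trans {zS zero k a} {λ n → inv (suc a) * (0ℚ + xsS 0 k (suc a) n)} (z-step zero k a)
  (≈-≡ λ n → solve 2 (λ i x → i :* (con 0ℚ :+ x) := con 0ℚ :+ i :* con 1ℚ :* x) refl (inv (suc a))
      (xsS 0 k (suc a) n))
z-expand (suc e) k a = ≈-trans {zS (suc e) k a} {λ n → i * (zS e k a n + X n)} (z-step (suc e) k a)
  (≈-ext {λ n → i * (zS e k a n + X n)} {λ n → i * (S n + X n)} (λ _ → refl) eq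
    (≈-scale {λ n → zS e k a n + X n} {λ n → S n + X n} i
        (≈-+ {zS e k a} {S} {X} {X} (z-expand e k a) (≈-refl {X}))))
  where
  i = inv (suc a)
  X S : ℕ → ℚ
  X = xsS (suc e) k (suc a)
  S n = Sum (suc e) (λ j → pow i (suc j) * xsS (e ∸ j) k (suc a) n)
  eq : ∀ n → i * (S n + X n) ≡ Sum (suc (suc e)) (λ j → pow i (suc j) * xsS (suc e ∸ j) k (suc a) n)
  eq n = trans (solve 3 (λ i s x → i :* (s :+ x) := i :* con 1ℚ :* x :+ i :* s) refl i (S n) (X n))
    (trans (cong (i * 1ℚ * X n +_) (trans (sym (Sum-*ˡ (suc e) i
        (λ j → pow i (suc j) * xsS (e ∸ j) k (suc a) n)))
        (Sum-ext (suc e) λ j → sym (*-assoc i (pow i (suc j)) (xsS (e ∸ j) k (suc a) n)))))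
      (sym (Sum-head (suc e) (λ j → pow i (suc j) * xsS (suc e ∸ j) k (suc a) n))))

-- Partial sums of 1/(1+s²) = Σ (-1)^t s^(2t) with exact remainder; t will be the offset of the next
-- summation index beyond `prev`.
x-telescope : ∀ n e k a D → Sum D (λ t → sgn t * zS e k (a ℕ.+ 2 ℕ.* t) n) ≡
    xS e k a n - sgn D * xS e k (a ℕ.+ 2 ℕ.* D) n
x-telescope n e k a zero = trans (sym (+-inverseʳ (xS e k a n)))
    (cong (λ t → xS e k a n - t) (trans (cong (λ b → xS e k b n) (sym (ℕP.+-identityʳ a)))
    (sym (*-identityˡ (xS e k (a ℕ.+ 0) n)))))
x-telescope n e k a (suc D) = trans (cong₂ _+_ (x-telescope n e k a D)
    (cong (sgn D *_) (sym (Grid.x-z n e k b))))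
  (trans (solve 4 (λ x σ p q → x :- σ :* p :+ σ :* (p :+ q) := x :- (:- σ) :* q) refl (xS e k a n) (sgn D)
      (xS e k b n) (xS e k (suc (suc b)) n))
    (cong (λ t → xS e k a n - - sgn D * xS e k t n) (idx a D)))
  where
  b = a ℕ.+ 2 ℕ.* D
  idx : ∀ a D → suc (suc (a ℕ.+ 2 ℕ.* D)) ≡ a ℕ.+ 2 ℕ.* suc D
  idx = NS.solve 2 (λ a D → NS.con 2 NS.:+ (a NS.:+ NS.con 2 NS.:* D) NS.:= a NS.:+ NS.con 2 NS.:*
      (NS.con 1 NS.:+ D)) refl

zp-≤ : ∀ n e k a → Grid.zp n e k a ≤ pow two (e ℕ.+ k)
zp-≤ n zero k a = pow-≥0 k 0≤two
zp-≤ n (suc e) k a = ≤-trans (Grid.z≤z₀ n e k a) (≤-trans (Grid.z₀≤ n e k)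
    (pow-mono-exp {two} 1≤two (ℕP.n≤1+n (e ℕ.+ k))))

xs-≤ : ∀ n e k a → Grid.xs n e k a ≤ pow two (e ℕ.+ k)
xs-≤ n zero zero a = ≤-refl
xs-≤ n (suc e) zero a = pow-≥0 (suc e ℕ.+ 0) 0≤two
xs-≤ n zero (suc k) a = ≤-trans (Grid.x≤₂ n zero k a) (pow-mono-exp {two} 1≤two (ℕP.n≤1+n k))
xs-≤ n (suc e) (suc k) a = ≤-trans (Grid.x≤₂ n (suc e) k a)
    (pow-mono-exp {two} 1≤two (s≤s (ℕP.+-monoʳ-≤ e (ℕP.n≤1+n k))))

0≤zp : ∀ n e k a → 0ℚ ≤ Grid.zp n e k a
0≤zp n zero k a = ≤-refl
0≤zp n (suc e) k a = Grid.0≤z n e k a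

z-small : ∀ e k a → Apx (zS e k a) (inv (suc a) * pow two (suc (e ℕ.+ k)))
z-small e k a = apx-≈ {r} {zS e k a} (≈-sym {zS e k a} {r} (z-step e k a)) (apx-exact λ n →
    ≤-trans (∣0≤∣ (≥0-* (0≤inv (suc a)) (≥0-+ (0≤zp n e k a) (Grid.0≤xs n e k (suc a)))))
      (*-monoˡ (inv (suc a)) (0≤inv (suc a)) (≤-trans (+-mono-≤ (zp-≤ n e k a) (xs-≤ n e k (suc a)))
          (≤-reflexive (p+p≡two* (pow two (e ℕ.+ k)))))))
  where
  r : ℕ → ℚ
  r n = inv (suc a) * (Grid.zp n e k a + Grid.xs n e k (suc a))

x-small : ∀ e k a → Apx (xS e k a) (inv (suc a) * pow two (suc (e ℕ.+ k)))
x-small e k a = apx-dom {xS e k a} {zS e k a} (λ n → ≤-trans (∣0≤∣ (Grid.0≤x n e k a))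
    (≤-trans (Grid.x≤z n e k a) (p≤∣p∣ (zS e k a n)))) (z-small e k a)

-- Mirrors the error recursion in `V-moment`: the first term bounds the remainder of the telescoping
-- sum, the others are inherited from depth r, one for each first exponent.
errC : ℕ → ℕ → ℚ
errC zero e = 0ℚ
errC (suc r) e = pow two (suc (e ℕ.+ r)) + Sum (suc e) (λ j → errC r (e ∸ j))

0≤errC : ∀ r e → 0ℚ ≤ errC r e
0≤errC zero e = ≤-refl
0≤errC (suc r) e = ≥0-+ (pow-≥0 (suc (e ℕ.+ r)) 0≤two) (Sum-≥0 (suc e) λ j _ → 0≤errC r (e ∸ j))

-- i counts the indices already chosen and p is `prev` - i, so the next denominator, 2n - (i+1) at n
-- = prev + 1 + t, equals i + 2p + 2t + 1 and no subtraction is cut off. By induction the inner sum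
-- is a moment `xs`; summing over the first exponent gives z (`z-expand`), and the alternating sum
-- over t gives x (`x-telescope`).
V-moment : ∀ r e i p D → let N = i ℕ.+ p ℕ.+ D in
  Apx (λ n → V r (e ℕ.+ r) (suc i) (i ℕ.+ p) N - sgn r * (sgn (i ℕ.+ p) * xsS e r (i ℕ.+ 2 ℕ.* p) n))
      (errC r e * smallη r N)
V-moment zero e i p D = apx-≤ (≤-reflexive (sym (*-zeroˡ (smallη 0 (i ℕ.+ p ℕ.+ D)))))
    (apx-exact λ n → ≤-reflexive (cong ∣_∣ (base e n)))
  where
  base : ∀ e n → V 0 (e ℕ.+ 0) (suc i) (i ℕ.+ p) (i ℕ.+ p ℕ.+ D) - 1ℚ *
      (sgn (i ℕ.+ p) * xsS e 0 (i ℕ.+ 2 ℕ.* p) n) ≡ 0ℚ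
  base zero n = solve 1 (λ s → s :+ con 0ℚ :- con 1ℚ :* (s :* con 1ℚ) := con 0ℚ) refl (sgn (i ℕ.+ p))
  base (suc e) n = solve 1 (λ s → con 0ℚ :- con 1ℚ :* (s :* con 0ℚ) := con 0ℚ) refl (sgn (i ℕ.+ p))
V-moment (suc r) e i p D = apx-≤ total (apx-ext assemble
    (apx-+ {λ n → Sum D (λ t → main t n)} {λ n → sgn r * (sgn prev * (sgn D * xS e r (a ℕ.+ 2 ℕ.* D) n))}
    (apx-Sum D {main} mainB) tailB))
  where
  N = i ℕ.+ p ℕ.+ D
  prev = i ℕ.+ p
  a = i ℕ.+ 2 ℕ.* p
  q : ℕ → ℚ
  q t = inv (suc (a ℕ.+ 2 ℕ.* t))
  Vt : ℕ → ℕ → ℚ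
  Vt t j = V r ((e ∸ j) ℕ.+ r) (suc (suc i)) (suc i ℕ.+ (p ℕ.+ t)) N
  main : ℕ → ℕ → ℚ
  main t n = Sum (suc e) (λ j → pow (q t) (suc j) * Vt t j) - sgn r *
      (sgn (suc i ℕ.+ (p ℕ.+ t)) * zS e r (a ℕ.+ 2 ℕ.* t) n)
  E : ℚ
  E = Sum (suc e) (λ j → errC r (e ∸ j)) * smallη r N
  0≤E : 0ℚ ≤ E
  0≤E = ≥0-* (Sum-≥0 (suc e) λ j _ → 0≤errC r (e ∸ j)) (0≤smallη r N)
  c : ℕ → ℚ
  c t = sgn r * sgn (suc i ℕ.+ (p ℕ.+ t))
  idx : ∀ i p t → suc i ℕ.+ 2 ℕ.* (p ℕ.+ t) ≡ suc (i ℕ.+ 2 ℕ.* p ℕ.+ 2 ℕ.* t)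
  idx = NS.solve 3 (λ i p t → NS.con 1 NS.:+ i NS.:+ NS.con 2 NS.:* (p NS.:+ t) NS.:= NS.con 1 NS.:+
      (i NS.:+ NS.con 2 NS.:* p NS.:+ NS.con 2 NS.:* t)) refl
  Neq : ∀ t d → suc t ℕ.+ d ≡ D → suc i ℕ.+ (p ℕ.+ t) ℕ.+ d ≡ N
  Neq t d h = trans (NS.solve 4 (λ i p t d → NS.con 1 NS.:+ i NS.:+ (p NS.:+ t) NS.:+ d NS.:= i NS.:+ p NS.:+
      (NS.con 1 NS.:+ t NS.:+ d)) refl i p t d) (cong (i ℕ.+ p ℕ.+_) h)
  ih : ∀ t → t ℕ.< D → ∀ j → Apx (λ n → Vt t j - c t * xsS (e ∸ j) r (suc (a ℕ.+ 2 ℕ.* t)) n)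
      (errC r (e ∸ j) * smallη r N)
  ih t l j = apx-ext {f} (λ n → cong₂ (λ N' b → V r ((e ∸ j) ℕ.+ r) (suc (suc i)) (suc i ℕ.+ (p ℕ.+ t)) N' - b)
      (Neq t (D ∸ suc t) (ℕP.m+[n∸m]≡n l))
        (trans (sym (*-assoc (sgn r) (sgn (suc i ℕ.+ (p ℕ.+ t))) (xsS (e ∸ j) r (suc i ℕ.+ 2 ℕ.* (p ℕ.+ t)) n)))
            (cong (λ b → c t * xsS (e ∸ j) r b n) (idx i p t))))
      (subst (λ N' → Apx f (errC r (e ∸ j) * smallη r N')) (Neq t (D ∸ suc t) (ℕP.m+[n∸m]≡n l))
          (V-moment r (e ∸ j) (suc i) (p ℕ.+ t) (D ∸ suc t)))
    where
    f : ℕ → ℚ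
    f n = V r ((e ∸ j) ℕ.+ r) (suc (suc i)) (suc i ℕ.+ (p ℕ.+ t)) (suc i ℕ.+ (p ℕ.+ t) ℕ.+ (D ∸ suc t)) - sgn r
        * (sgn (suc i ℕ.+ (p ℕ.+ t)) * xsS (e ∸ j) r (suc i ℕ.+ 2 ℕ.* (p ℕ.+ t)) n)
  -- One factor of `q t` is kept: summed over t it gives a harmonic sum, hence one power of η per
  -- level.
  pow≤ : ∀ t j → ∣ pow (q t) (suc j) ∣ ≤ inv (suc t)
  pow≤ t j = ≤-trans (∣0≤∣ (pow-≥0 (suc j) (0≤inv (suc (a ℕ.+ 2 ℕ.* t)))))
      (≤-trans (*≤ˡ (0≤inv (suc (a ℕ.+ 2 ℕ.* t))) (pow-≤1 j (0≤inv (suc (a ℕ.+ 2 ℕ.* t)))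
      (inv≤1 (suc (a ℕ.+ 2 ℕ.* t)))))
    (inv-anti (ℕP.≤-trans (ℕP.m≤m+n t (t ℕ.+ 0)) (ℕP.m≤n+m (2 ℕ.* t) a))))
  mainB : ∀ t → t ℕ.< D → Apx (main t) (inv (suc t) * E)
  mainB t l = apx-≤ bound₁ (apx-≈ {f} {main t} f≈ (apx-Sum (suc e)
      {λ j n → pow (q t) (suc j) * (Vt t j - c t * X j n)}
      {λ j → ∣ pow (q t) (suc j) ∣ * (errC r (e ∸ j) * smallη r N)} λ j _ → apx-scale (pow (q t) (suc j))
      (ih t l j)))
    where
    X : ℕ → ℕ → ℚ
    X j n = xsS (e ∸ j) r (suc (a ℕ.+ 2 ℕ.* t)) n
    f S T' : ℕ → ℚ
    f n = Sum (suc e) (λ j → pow (q t) (suc j) * (Vt t j - c t * X j n))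
    S n = Sum (suc e) (λ j → pow (q t) (suc j) * X j n)
    T' n = Sum (suc e) (λ j → pow (q t) (suc j) * Vt t j)
    feq : ∀ n → - c t * S n + T' n ≡ f n
    feq n = sym (trans (Sum-ext (suc e) λ j → solve 4 (λ p v c x → p :* (v :- c :* x) := :- c :* (p :* x) :+ p
        :* v) refl (pow (q t) (suc j)) (Vt t j) (c t) (X j n))
      (trans (Sum-+ (suc e) (λ j → - c t * (pow (q t) (suc j) * X j n)) (λ j → pow (q t) (suc j) * Vt t j))
          (cong (_+ T' n) (Sum-*ˡ (suc e) (- c t) (λ j → pow (q t) (suc j) * X j n)))))
    zz = zS e r (a ℕ.+ 2 ℕ.* t)
    f≈ : f ≈ main t
    f≈ = ≈-ext {λ n → - c t * S n + T' n} {λ n → - c t * zz n + T' n} feq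
      (λ n → solve 4 (λ a b z t → (:- (a :* b)) :* z :+ t := t :- a :* (b :* z)) refl (sgn r)
          (sgn (suc i ℕ.+ (p ℕ.+ t))) (zz n) (T' n))
      (≈-+ {λ n → - c t * S n} {λ n → - c t * zz n} {T'} {T'}
          (≈-scale {S} {zz} (- c t) (≈-sym {zz} {S} (z-expand e r (a ℕ.+ 2 ℕ.* t)))) (≈-refl {T'}))
    bound₁ : Sum (suc e) (λ j → ∣ pow (q t) (suc j) ∣ * (errC r (e ∸ j) * smallη r N)) ≤ inv (suc t) * E
    bound₁ = ≤-trans (Sum-mono (suc e) λ j _ → *-monoʳ (errC r (e ∸ j) * smallη r N)
        (≥0-* (0≤errC r (e ∸ j)) (0≤smallη r N)) (pow≤ t j))
      (≤-reflexive (trans (Sum-*ˡ (suc e) (inv (suc t)) (λ j → errC r (e ∸ j) * smallη r N))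
          (cong (inv (suc t) *_) (Sum-*ʳ (suc e) (smallη r N) (λ j → errC r (e ∸ j))))))
  tailε : ℚ
  tailε = inv (suc N) * pow two (suc (e ℕ.+ r))
  tailB : Apx (λ n → sgn r * (sgn prev * (sgn D * xS e r (a ℕ.+ 2 ℕ.* D) n))) tailε
  tailB = apx-dom {_} {xS e r (a ℕ.+ 2 ℕ.* D)} (λ n → ≤-reflexive (unit n))
      (apx-≤ (*-monoʳ (pow two (suc (e ℕ.+ r))) (pow-≥0 (suc (e ℕ.+ r)) 0≤two) (inv-anti N≤))
      (x-small e r (a ℕ.+ 2 ℕ.* D)))
    where
    -- The remainder of the telescoping sum is a moment of s to a power at least N, hence O(1/N) by
    -- `x-small`.
    N≤ : N ℕ.≤ a ℕ.+ 2 ℕ.* D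
    N≤ = ℕP.+-mono-≤ (ℕP.+-monoʳ-≤ i (ℕP.m≤m+n p (p ℕ.+ 0))) (ℕP.m≤m+n D (D ℕ.+ 0))
    unit : ∀ n → ∣ sgn r * (sgn prev * (sgn D * xS e r (a ℕ.+ 2 ℕ.* D) n)) ∣ ≡ ∣ xS e r (a ℕ.+ 2 ℕ.* D) n ∣
    unit n = trans (drop r _) (trans (drop prev _) (drop D (xS e r (a ℕ.+ 2 ℕ.* D) n)))
      where
      drop : ∀ k t → ∣ sgn k * t ∣ ≡ ∣ t ∣
      drop k t = trans (∣p*q∣≡∣p∣*∣q∣ (sgn k) t) (trans (cong (_* ∣ t ∣) (∣sgn∣ k)) (*-identityˡ ∣ t ∣))
  total : Sum D (λ t → inv (suc t) * E) + tailε ≤ errC (suc r) e * smallη (suc r) N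
  total = begin
    Sum D (λ t → inv (suc t) * E) + tailε
      ≡⟨ cong (_+ tailε) (Sum-*ʳ D E (inv ∘ suc)) ⟩
    Sum D (inv ∘ suc) * E + tailε
      ≤⟨ +-mono-≤ (*-monoʳ E 0≤E (≤-trans (Sum-mono-len (inv ∘ suc) (λ t → 0≤inv (suc t))
          (ℕP.≤-trans (ℕP.m≤n+m D (i ℕ.+ p)) (ℕP.n≤1+n N))) (≤+ˡ {Sum (suc N) (inv ∘ suc)} {1ℚ} 0≤1)))
           (≤-trans (≤-reflexive (sym (*-identityˡ tailε)))
               (*-monoʳ tailε (≥0-* (0≤inv (suc N)) (pow-≥0 (suc (e ℕ.+ r)) 0≤two)) (pow-≥1 (suc r) (1≤η N)))) ⟩
    η N * E + pow (η N) (suc r) * tailε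
      ≡⟨ solve 5 (λ h S P i K → h :* (S :* (P :* i)) :+ h :* P :* (i :* K) := (K :+ S) :* (h :* P :* i)) refl
          (η N) (Sum (suc e) (λ j → errC r (e ∸ j))) (pow (η N) r) (inv (suc N)) (pow two (suc (e ℕ.+ r))) ⟩
    errC (suc r) e * smallη (suc r) N ∎ where open ≤-Reasoning
  assemble : ∀ n → Sum D (λ t → main t n) + sgn r * (sgn prev * (sgn D * xS e r (a ℕ.+ 2 ℕ.* D) n))
    ≡ V (suc r) (e ℕ.+ suc r) (suc i) prev N - sgn (suc r) * (sgn prev * xsS e (suc r) a n)
  assemble n = trans (cong (_+ R) (trans (Sum-- D A B) (cong₂ _-_ VA BB))) (trans
      (solve 5 (λ v σ π x y → v :- (:- (σ :* π)) :* (x :- y) :+ σ :* (π :* y) := v :- (:- σ) :* (π :* x)) refl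
          (V (suc r) (e ℕ.+ suc r) (suc i) prev N) (sgn r) (sgn prev) (xS e r a n)
          (sgn D * xS e r (a ℕ.+ 2 ℕ.* D) n))
      (cong (λ t → V (suc r) (e ℕ.+ suc r) (suc i) prev N - sgn (suc r) * (sgn prev * t)) (xs-suc e)))
    where
    R = sgn r * (sgn prev * (sgn D * xS e r (a ℕ.+ 2 ℕ.* D) n))
    A B : ℕ → ℚ
    A t = Sum (suc e) (λ j → pow (q t) (suc j) * Vt t j)
    B t = sgn r * (sgn (suc i ℕ.+ (p ℕ.+ t)) * zS e r (a ℕ.+ 2 ℕ.* t) n)
    xs-suc : ∀ e → xS e r a n ≡ xsS e (suc r) a n
    xs-suc zero = refl
    xs-suc (suc e) = refl
    ∸-idx : ∀ t → 2 ℕ.* (suc prev ℕ.+ t) ∸ suc i ≡ suc (a ℕ.+ 2 ℕ.* t)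
    ∸-idx t = trans (cong (_∸ suc i) (NS.solve 3 (λ i p t → NS.con 2 NS.:* (NS.con 1 NS.:+ (i NS.:+ p) NS.:+ t)
        NS.:= NS.con 1 NS.:+ i NS.:+ (NS.con 1 NS.:+ (i NS.:+ NS.con 2 NS.:* p NS.:+ NS.con 2 NS.:* t))) refl i
        p t)) (ℕP.m+n∸m≡n (suc i) (suc (a ℕ.+ 2 ℕ.* t)))
    F : ℕ → ℚ
    F t = Sum (suc e) (λ j → pow (inv (2 ℕ.* (suc prev ℕ.+ t) ∸ suc i)) (suc j) * V r ((e ∸ j) ℕ.+ r)
        (suc (suc i)) (suc prev ℕ.+ t) N)
    VA : Sum D A ≡ V (suc r) (e ℕ.+ suc r) (suc i) prev N
    VA = sym (trans (V-suc r e (suc i) prev N) (trans (cong (λ D' → Sum D' F) (ℕP.m+n∸m≡n prev D))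
        (Sum-ext D λ t → Sum-ext (suc e) λ j →
      cong₂ (λ x y → pow (inv x) (suc j) * V r ((e ∸ j) ℕ.+ r) (suc (suc i)) y N) (∸-idx t)
          (cong suc (ℕP.+-assoc i p t)))))
    BB : Sum D B ≡ - (sgn r * sgn prev) * (xS e r a n - sgn D * xS e r (a ℕ.+ 2 ℕ.* D) n)
    BB = trans (Sum-ext D λ t → trans (cong (λ u → sgn r * (- u * zS e r (a ℕ.+ 2 ℕ.* t) n))
        (trans (cong sgn (sym (ℕP.+-assoc i p t))) (sgn-+ prev t)))
        (solve 4 (λ σ π τ z → σ :* (:- (π :* τ) :* z) := (:- (σ :* π)) :* (τ :* z)) refl (sgn r) (sgn prev)
            (sgn t) (zS e r (a ℕ.+ 2 ℕ.* t) n)))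
      (trans (Sum-*ˡ D (- (sgn r * sgn prev)) (λ t → sgn t * zS e r (a ℕ.+ 2 ℕ.* t) n))
          (cong (- (sgn r * sgn prev) *_) (x-telescope n e r a D)))

-- The truncated T-values by their largest index

-- Doubling by structural recursion, so that parities compute and even and odd arguments can be
-- matched.
dbl : ℕ → ℕ
dbl zero = zero
dbl (suc n) = suc (suc (dbl n))

dbl≡2* : ∀ n → dbl n ≡ 2 ℕ.* n
dbl≡2* zero = refl
dbl≡2* (suc n) = trans (cong (suc ∘ suc) (dbl≡2* n)) (cong suc (sym (ℕP.+-suc n (n ℕ.+ 0))))

-- E j n is T_n({1}_{2j}) / 4^j; Od j n is the same sum over 2j+1 indices.
mutual
  E Od : ℕ → ℕ → ℚ
  E zero n = 1ℚ
  E (suc j) n = Sum n (λ i → Od j i * inv (dbl i))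
  Od j n = Sum n (λ i → E j (suc i) * inv (suc (dbl i)))

χ : ℕ → ℕ → ℚ
χ i m = if (m % 2) ≡ᵇ (i % 2) then inv m else 0ℚ

if-* : ∀ (c : Bool) (x t : ℚ) → (if c then x * t else 0ℚ) ≡ (if c then x else 0ℚ) * t
if-* true x t = refl
if-* false x t = sym (*-zeroˡ t)

tsum-Sum : ∀ r i prev d → tsum (suc r) i prev (suc (prev ℕ.+ d)) ≡
    Sum d (λ t → χ i (suc prev ℕ.+ t) * tsum r (suc i) (suc prev ℕ.+ t) (suc (prev ℕ.+ d)))
tsum-Sum r i prev d = trans (Σ-Sum (suc prev) (prev ℕ.+ d)
    (λ m → if (m % 2) ≡ᵇ (i % 2) then inv m * tsum r (suc i) m (suc (prev ℕ.+ d)) else 0ℚ))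
  (trans (cong (λ c → Sum c f) (ℕP.m+n∸m≡n prev d)) (Sum-ext d λ t → if-* (((suc prev ℕ.+ t) % 2) ≡ᵇ (i % 2))
      (inv (suc prev ℕ.+ t)) (tsum r (suc i) (suc prev ℕ.+ t) (suc (prev ℕ.+ d)))))
  where
  f : ℕ → ℚ
  f t = if ((suc prev ℕ.+ t) % 2) ≡ᵇ (i % 2) then inv (suc prev ℕ.+ t) * tsum r (suc i) (suc prev ℕ.+ t)
      (suc (prev ℕ.+ d)) else 0ℚ

tsum-empty : ∀ r i prev → tsum (suc r) i prev (suc prev) ≡ 0ℚ
tsum-empty r i prev = trans (cong (λ b → tsum (suc r) i prev (suc b)) (sym (ℕP.+-identityʳ prev)))
    (tsum-Sum r i prev 0)

-- `tsum` recurses on the smallest index, while Abel summation in n needs differences in n and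
-- therefore the largest one. Raising the bound by one admits the value B, which only the last of
-- the r + 1 indices can take; its parity is that of i + r.
tsum-top : ∀ r i prev d → tsum (suc r) i prev (suc (suc (prev ℕ.+ d))) ≡
  tsum (suc r) i prev (suc (prev ℕ.+ d)) + χ (i ℕ.+ r) (suc (prev ℕ.+ d)) * tsum r i prev (suc (prev ℕ.+ d))
tsum-top r i prev d = begin
  tsum (suc r) i prev (suc (suc (prev ℕ.+ d)))
    ≡⟨ cong (λ b → tsum (suc r) i prev (suc b)) (sym (ℕP.+-suc prev d)) ⟩
  tsum (suc r) i prev (suc (prev ℕ.+ suc d))
    ≡⟨ tsum-Sum r i prev (suc d) ⟩
  Sum (suc d) (λ t → χ i (suc prev ℕ.+ t) * tsum r (suc i) (suc prev ℕ.+ t) (suc (prev ℕ.+ suc d)))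
    ≡⟨ cong (λ b → Sum (suc d) (λ t → χ i (suc prev ℕ.+ t) * tsum r (suc i) (suc prev ℕ.+ t) (suc b)))
        (ℕP.+-suc prev d) ⟩
  Sum (suc d) (λ t → χ i (suc prev ℕ.+ t) * tsum r (suc i) (suc prev ℕ.+ t) (suc (suc (prev ℕ.+ d))))
    ≡⟨ split r ⟩
  Sum d (λ t → χ i (suc prev ℕ.+ t) * tsum r (suc i) (suc prev ℕ.+ t) (suc (prev ℕ.+ d))) + χ (i ℕ.+ r) B * tsum
      r i prev B
    ≡⟨ cong (_+ χ (i ℕ.+ r) B * tsum r i prev B) (sym (tsum-Sum r i prev d)) ⟩
  tsum (suc r) i prev B + χ (i ℕ.+ r) B * tsum r i prev B ∎
  where
  open ≡-Reasoning
  B = suc (prev ℕ.+ d)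
  split : ∀ r → Sum (suc d) (λ t → χ i (suc prev ℕ.+ t) * tsum r (suc i) (suc prev ℕ.+ t) (suc B))
    ≡ Sum d (λ t → χ i (suc prev ℕ.+ t) * tsum r (suc i) (suc prev ℕ.+ t) B) + χ (i ℕ.+ r) B * tsum r i prev B
  split zero = cong (λ k → Sum d (λ t → χ i (suc prev ℕ.+ t) * 1ℚ) + χ k B * 1ℚ) (sym (ℕP.+-identityʳ i))
  split (suc r) = begin
    Sum d (λ t → χ i (suc prev ℕ.+ t) * tsum (suc r) (suc i) (suc prev ℕ.+ t) (suc B)) + χ i B * tsum (suc r)
        (suc i) B (suc B)
      ≡⟨ cong₂ _+_ (Sum-cong d body) (trans (cong (χ i B *_) (tsum-empty r (suc i) B)) (*-zeroʳ (χ i B))) ⟩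
    Sum d (λ t → F t + χ (i ℕ.+ suc r) B * H t) + 0ℚ
      ≡⟨ +-identityʳ (Sum d (λ t → F t + χ (i ℕ.+ suc r) B * H t)) ⟩
    Sum d (λ t → F t + χ (i ℕ.+ suc r) B * H t)
      ≡⟨ trans (Sum-+ d F (λ t → χ (i ℕ.+ suc r) B * H t))
          (cong (Sum d F +_) (Sum-*ˡ d (χ (i ℕ.+ suc r) B) H)) ⟩
    Sum d F + χ (i ℕ.+ suc r) B * Sum d H
      ≡⟨ cong (λ t → Sum d F + χ (i ℕ.+ suc r) B * t) (sym (tsum-Sum r i prev d)) ⟩
    Sum d F + χ (i ℕ.+ suc r) B * tsum (suc r) i prev B ∎
    where
    F H : ℕ → ℚ
    F t = χ i (suc prev ℕ.+ t) * tsum (suc r) (suc i) (suc prev ℕ.+ t) B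
    H t = χ i (suc prev ℕ.+ t) * tsum r (suc i) (suc prev ℕ.+ t) B
    body : ∀ t → t ℕ.< d → χ i (suc prev ℕ.+ t) * tsum (suc r) (suc i) (suc prev ℕ.+ t) (suc B) ≡
        F t + χ (i ℕ.+ suc r) B * H t
    body t l = trans (cong (χ i (suc prev ℕ.+ t) *_) step)
      (solve 4 (λ a b c d → a :* (b :+ c :* d) := a :* b :+ c :* (a :* d)) refl (χ i (suc prev ℕ.+ t))
          (tsum (suc r) (suc i) (suc prev ℕ.+ t) B) (χ (i ℕ.+ suc r) B) (tsum r (suc i) (suc prev ℕ.+ t) B))
      where
      Beq : suc (suc prev ℕ.+ t ℕ.+ (d ∸ suc t)) ≡ B
      Beq = cong suc (trans (cong suc (ℕP.+-assoc prev t (d ∸ suc t)))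
          (trans (sym (ℕP.+-suc prev (t ℕ.+ (d ∸ suc t)))) (cong (prev ℕ.+_) (ℕP.m+[n∸m]≡n l))))
      step : tsum (suc r) (suc i) (suc prev ℕ.+ t) (suc B) ≡
          tsum (suc r) (suc i) (suc prev ℕ.+ t) B + χ (i ℕ.+ suc r) B * tsum r (suc i) (suc prev ℕ.+ t) B
      step = trans (subst (λ b → tsum (suc r) (suc i) (suc prev ℕ.+ t) (suc b) ≡ tsum (suc r) (suc i)
          (suc prev ℕ.+ t) b + χ (suc i ℕ.+ r) b * tsum r (suc i) (suc prev ℕ.+ t) b) Beq
          (tsum-top r (suc i) (suc prev ℕ.+ t) (d ∸ suc t)))
        (cong (λ k → tsum (suc r) (suc i) (suc prev ℕ.+ t) B + χ k B * tsum r (suc i) (suc prev ℕ.+ t) B)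
            (sym (ℕP.+-suc i r)))

ev%2 : ∀ n → dbl n % 2 ≡ 0
ev%2 zero = refl
ev%2 (suc n) = ev%2 n

od%2 : ∀ n → suc (dbl n) % 2 ≡ 1
od%2 zero = refl
od%2 (suc n) = od%2 n

χ-ee : ∀ i m → χ (dbl i) (dbl m) ≡ inv (dbl m)
χ-ee i m rewrite ev%2 i | ev%2 m = refl

χ-oo : ∀ i m → χ (suc (dbl i)) (suc (dbl m)) ≡ inv (suc (dbl m))
χ-oo i m rewrite od%2 i | od%2 m = refl

χ-eo : ∀ i m → χ (dbl i) (suc (dbl m)) ≡ 0ℚ
χ-eo i m rewrite ev%2 i | od%2 m = refl

χ-oe : ∀ i m → χ (suc (dbl i)) (dbl m) ≡ 0ℚ
χ-oe i m rewrite od%2 i | ev%2 m = refl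

tsum-skip : ∀ r m → χ (suc r) (suc m) ≡ 0ℚ → tsum (suc r) 1 0 (suc (suc m)) ≡ tsum (suc r) 1 0 (suc m)
tsum-skip r m h = trans (tsum-top r 1 0 m) (trans (cong
    (λ t → tsum (suc r) 1 0 (suc m) + t * tsum r 1 0 (suc m)) h)
  (solve 2 (λ a b → a :+ con 0ℚ :* b := a) refl (tsum (suc r) 1 0 (suc m)) (tsum r 1 0 (suc m))))

tsum-0 : ∀ r → tsum (suc r) 1 0 0 ≡ 0ℚ
tsum-0 r = refl

mutual
  tsum-E : ∀ j n → tsum (dbl j) 1 0 (dbl n) ≡ E j n
  tsum-E zero n = refl
  tsum-E (suc j) zero = tsum-0 (suc (dbl j))
  -- Below 2 only m = 1 is available, and it is odd, so it cannot be the last of an even number of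
  -- indices. The next clause would split off the value 0 here, which is outside the range.
  tsum-E (suc j) (suc zero) = trans (tsum-top (suc (dbl j)) 1 0 0)
    (trans (cong₂ (λ a b → a + b * tsum (suc (dbl j)) 1 0 1) (tsum-empty (suc (dbl j)) 1 0) (χ-eo (suc j) 0))
      (solve 2 (λ a b → con 0ℚ :+ con 0ℚ :* a := con 0ℚ :+ b :* con 0ℚ) refl (tsum (suc (dbl j)) 1 0 1)
          (Od j 0)))
  tsum-E (suc j) (suc (suc n)) = trans (tsum-skip (suc (dbl j)) (dbl (suc n)) (χ-eo (suc j) (suc n)))
    (trans (tsum-top (suc (dbl j)) 1 0 (suc (dbl n)))
      (cong₂ _+_ (tsum-E (suc j) (suc n)) (trans (cong₂ _*_ (χ-ee (suc j) (suc n)) (tsum-O j (suc n)))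
          (*-comm (inv (dbl (suc n))) (Od j (suc n))))))

  tsum-O : ∀ j n → tsum (suc (dbl j)) 1 0 (dbl n) ≡ Od j n
  tsum-O j zero = tsum-0 (dbl j)
  tsum-O j (suc n) = trans (tsum-top (dbl j) 1 0 (dbl n))
    (cong₂ _+_ (lower n) (trans (cong₂ _*_ (χ-oo j n) (upper j)) (*-comm (inv (suc (dbl n))) (E j (suc n)))))
    where
    lower : ∀ n → tsum (suc (dbl j)) 1 0 (suc (dbl n)) ≡ Od j n
    lower zero = tsum-empty (dbl j) 1 0
    lower (suc n) = trans (tsum-skip (dbl j) (suc (dbl n)) (χ-oe j (suc n))) (tsum-O j (suc n))
    upper : ∀ j → tsum (dbl j) 1 0 (suc (dbl n)) ≡ E j (suc n)
    upper zero = refl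
    upper (suc j) = trans (sym (tsum-skip (suc (dbl j)) (dbl n) (χ-eo (suc j) n))) (tsum-E (suc j) (suc n))

pow4 : ∀ j → pow two (dbl j) ≡ pow four j
pow4 zero = refl
pow4 (suc j) = trans (cong (λ t → two * (two * t)) (pow4 j))
    (solve 1 (λ t → con two :* (con two :* t) := con four :* t) refl (pow four j))

T-E : ∀ n j → T n (dbl j) ≡ pow four j * E j n
T-E n j = cong₂ _*_ (pow4 j) (trans (cong (tsum (dbl j) 1 0) (sym (dbl≡2* n))) (tsum-E j n))

-- Logarithmic bounds

Hn : ℕ → ℚ
Hn m = 1ℚ + Sum m (inv ∘ suc)

1≤Hn : ∀ m → 1ℚ ≤ Hn m
1≤Hn m = ≤+ʳ {1ℚ} {Sum m (inv ∘ suc)} (Sum-≥0 m λ i _ → 0≤inv (suc i))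

0≤Hn : ∀ m → 0ℚ ≤ Hn m
0≤Hn m = ≤-trans 0≤1 (1≤Hn m)

Hn-mono : ∀ {m n} → m ℕ.≤ n → Hn m ≤ Hn n
Hn-mono le = +-monoʳ-≤ 1ℚ (Sum-mono-len (inv ∘ suc) (λ i → 0≤inv (suc i)) le)

n≤dbl : ∀ n → n ℕ.≤ dbl n
n≤dbl zero = z≤n
n≤dbl (suc n) = s≤s (ℕP.m≤n⇒m≤1+n (n≤dbl n))

inv-dbl : ∀ i → inv (dbl i) ≤ inv (suc i)
inv-dbl zero = 0≤inv 1
inv-dbl (suc i) = inv-anti (s≤s (n≤dbl i))

mutual
  0≤E : ∀ j n → 0ℚ ≤ E j n
  0≤E zero n = 0≤1
  0≤E (suc j) n = Sum-≥0 n λ i _ → ≥0-* (0≤Od j i) (0≤inv (dbl i))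

  0≤Od : ∀ j n → 0ℚ ≤ Od j n
  0≤Od j n = Sum-≥0 n λ i _ → ≥0-* (0≤E j (suc i)) (0≤inv (suc (dbl i)))

-- Each summation against weights at most 1/(i+1) costs one factor `Hn n`; this is how powers of log
-- N arise on the side of the T-values.
Sum-log : ∀ n k (f c : ℕ → ℚ) → (∀ i → i ℕ.< n → 0ℚ ≤ f i) → (∀ i → i ℕ.< n → f i ≤ pow (Hn n) k) →
    (∀ i → 0ℚ ≤ c i) → (∀ i → c i ≤ inv (suc i)) → Sum n (λ i → f i * c i) ≤ pow (Hn n) (suc k)
Sum-log n k f c 0≤f f≤ 0≤c c≤ = ≤-trans (Sum-mono n λ i l → *-mono (0≤f i l) (0≤c i) (f≤ i l) (c≤ i))
  (≤-trans (≤-reflexive (Sum-*ˡ n (pow (Hn n) k) (inv ∘ suc)))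
    (≤-trans (*-monoˡ (pow (Hn n) k) (pow-≥0 k (0≤Hn n)) (≤+ˡ {Sum n (inv ∘ suc)} {1ℚ} 0≤1))
        (≤-reflexive (*-comm (pow (Hn n) k) (Hn n)))))

mutual
  E≤ : ∀ j n → E j n ≤ pow (Hn n) (dbl j)
  E≤ zero n = ≤-refl
  E≤ (suc j) n = Sum-log n (suc (dbl j)) (Od j) (inv ∘ dbl) (λ i _ → 0≤Od j i)
    (λ i l → ≤-trans (O≤ j i) (pow-mono (suc (dbl j)) (0≤Hn i) (Hn-mono (ℕP.<⇒≤ l)))) (λ i → 0≤inv (dbl i))
        inv-dbl

  O≤ : ∀ j n → Od j n ≤ pow (Hn n) (suc (dbl j))
  O≤ j n = Sum-log n (dbl j) (λ i → E j (suc i)) (λ i → inv (suc (dbl i))) (λ i _ → 0≤E j (suc i))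
    (λ i l → ≤-trans (E≤ j (suc i)) (pow-mono (dbl j) (0≤Hn (suc i)) (Hn-mono l))) (λ i → 0≤inv (suc (dbl i)))
        (λ i → inv-anti (n≤dbl i))

E-log : ∀ j → LogBounded (λ N → E j (suc N))
E-log j = 1ℚ , dbl j , 0≤1 , λ N → ≤-trans (∣0≤∣ (0≤E j (suc N)))
    (≤-trans (E≤ j (suc N)) (≤-reflexive (sym (*-identityˡ (pow (η N) (dbl j))))))

O-log : ∀ j → LogBounded (λ N → Od j N)
O-log j = 1ℚ , suc (dbl j) , 0≤1 , λ N → ≤-trans (∣0≤∣ (0≤Od j N)) (≤-trans (O≤ j N)
  (≤-trans (pow-mono (suc (dbl j)) (0≤Hn N) (Hn-mono (ℕP.n≤1+n N)))
      (≤-reflexive (sym (*-identityˡ (pow (η N) (suc (dbl j))))))))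

-- Moments of powers of the logarithm

y-log-step : ∀ e b → yS (suc e) 0 (suc (suc b)) ≈ (λ n → yS (suc e) 0 b n + inv (suc b) *
    (two * yS e 0 (suc b) n))
y-log-step e b = ≈-ext {λ n → yS (suc e) 0 b n + inv (suc b) * (ι (suc b) * D n)} {r}
    {yS (suc e) 0 (suc (suc b))} {r}
    (λ n → trans (cong (yS (suc e) 0 b n +_) (inv*ι b (D n)))
        (solve 2 (λ a b → a :+ (b :- a) := b) refl (yS (suc e) 0 b n) (yS (suc e) 0 (suc (suc b)) n)))
    (λ _ → refl)
    (≈-+ {yS (suc e) 0 b} {yS (suc e) 0 b} {λ n → inv (suc b) * (ι (suc b) * D n)}
        {λ n → inv (suc b) * (two * yS e 0 (suc b) n)} (≈-refl {yS (suc e) 0 b})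
      (≈-scale {λ n → ι (suc b) * D n} {λ n → two * yS e 0 (suc b) n} (inv (suc b))
        (≈-sym {λ n → two * yS e 0 (suc b) n} {λ n → ι (suc b) * D n}
            (apx-δ ((taylorC b * eight + ι (suc b) * four) * pow two e) λ n → GridV.log-rec n e b))))
  where
  D r : ℕ → ℚ
  D n = yS (suc e) 0 (suc (suc b)) n - yS (suc e) 0 b n
  r n = yS (suc e) 0 b n + inv (suc b) * (two * yS e 0 (suc b) n)

-- The limit of cS q is ∫ (log 1/s)^{2q}/(2q)! dv over 0 < v < 1, which is 2 ζ̄(2q) for q ≥ 1.
cS : ℕ → ℕ → ℚ
cS q = yS (dbl q) 0 1

-- ΣA is the combination of c and T-values for the moment at b = 2m + 1, with T_{m+1}({1}_{2j}) =
-- 4^j E. The recurrence lowers b and the power of L together, so even b with odd powers must be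
-- treated at the same time; there T_m({1}_{2j+1}) = 2 · 4^j Od takes over.
ΣA ΣB : ℕ → ℕ → ℕ → ℚ
ΣA q m n = Sum (suc q) (λ j → pow four j * E j (suc m) * cS (q ∸ j) n)
ΣB q m n = Sum (suc q) (λ j → two * pow four j * Od j m * cS (q ∸ j) n)

-- The only index is 0, and `inv (dbl 0)` is the default value 0.
E-1 : ∀ j → E (suc j) 1 ≡ 0ℚ
E-1 j = solve 1 (λ a → con 0ℚ :+ a :* con 0ℚ := con 0ℚ) refl (Od j 0)

mutual
  -- The T-values satisfy the coupled recurrence of the moments: passing from b = 2m + 1 to 2m + 3
  -- adds 2/(2m+2) times the even moment times 2, with 4^j absorbing the constants, just as
  -- `E (suc j)` grows by Od/(2m+2). The initial values are c at b = 1 and 0 at b = 0.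
  y-odd : ∀ q m → yS (dbl q) 0 (suc (dbl m)) ≈ ΣA q m
  y-odd zero m = ≈-≡ λ n → trans (GridV.y-0 n (dbl m)) (trans (sym (GridV.y-0 n 0))
      (solve 1 (λ c → c := con 0ℚ :+ con 1ℚ :* con 1ℚ :* c) refl (cS 0 n)))
  y-odd (suc q) zero = ≈-≡ λ n → sym (trans (Sum-head (suc q) (λ j → pow four j * E j 1 * cS (suc q ∸ j) n))
    (trans (cong (1ℚ * 1ℚ * cS (suc q) n +_) (Sum-0 (suc q) λ j _ → trans
        (cong (λ t → pow four (suc j) * t * cS (q ∸ j) n) (E-1 j))
        (solve 2 (λ p c → p :* con 0ℚ :* c := con 0ℚ) refl (pow four (suc j)) (cS (q ∸ j) n))))
      (solve 1 (λ c → con 1ℚ :* con 1ℚ :* c :+ con 0ℚ := c) refl (cS (suc q) n))))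
  y-odd (suc q) (suc m) = ≈-trans {yS (dbl (suc q)) 0 (suc (dbl (suc m)))}
      {λ n → yS (dbl (suc q)) 0 (suc (dbl m)) n + inv b * (two * yS (suc (dbl q)) 0 b n)}
      (y-log-step (suc (dbl q)) (suc (dbl m)))
    (≈-ext {λ n → yS (dbl (suc q)) 0 (suc (dbl m)) n + inv b * (two * yS (suc (dbl q)) 0 b n)}
        {λ n → ΣA (suc q) m n + inv b * (two * ΣB q (suc m) n)} (λ _ → refl) eq
      (≈-+ {yS (dbl (suc q)) 0 (suc (dbl m))} {ΣA (suc q) m} {λ n → inv b * (two * yS (suc (dbl q)) 0 b n)}
          {λ n → inv b * (two * ΣB q (suc m) n)} (y-odd (suc q) m)
        (≈-scale {λ n → two * yS (suc (dbl q)) 0 b n} {λ n → two * ΣB q (suc m) n} (inv b)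
            (≈-scale {yS (suc (dbl q)) 0 b} {ΣB q (suc m)} two (y-even q (suc m))))))
    where
    b = dbl (suc m)
    eq : ∀ n → ΣA (suc q) m n + inv b * (two * ΣB q (suc m) n) ≡ ΣA (suc q) (suc m) n
    eq n = begin
      ΣA (suc q) m n + inv b * (two * ΣB q (suc m) n)
        ≡⟨ cong₂ _+_ (Sum-head (suc q) (λ j → pow four j * E j (suc m) * cS (suc q ∸ j) n))
            (trans (cong (inv b *_) (sym (Sum-*ˡ (suc q) two G')))
            (sym (Sum-*ˡ (suc q) (inv b) (λ j → two * G' j)))) ⟩
      1ℚ * 1ℚ * cS (suc q) n + Sum (suc q) F + Sum (suc q) (λ j → inv b * (two * G' j))
        ≡⟨ trans (+-assoc (1ℚ * 1ℚ * cS (suc q) n) (Sum (suc q) F) (Sum (suc q) (λ j → inv b * (two * G' j))))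
            (cong (1ℚ * 1ℚ * cS (suc q) n +_) (trans (sym (Sum-+ (suc q) F (λ j → inv b * (two * G' j))))
            (Sum-ext (suc q) λ j →
             solve 5 (λ f e o i c → con four :* f :* e :* c :+ i :* (con two :* (con two :* f :* o :* c)) := con
                 four :* f :* (e :+ o :* i) :* c) refl (pow four j) (E (suc j) (suc m)) (Od j (suc m)) (inv b)
                 (cS (q ∸ j) n)))) ⟩
      1ℚ * 1ℚ * cS (suc q) n + Sum (suc q) (λ j → pow four (suc j) * E (suc j) (suc (suc m)) * cS (q ∸ j) n)
        ≡⟨ sym (Sum-head (suc q) (λ j → pow four j * E j (suc (suc m)) * cS (suc q ∸ j) n)) ⟩
      ΣA (suc q) (suc m) n ∎
      where
      open ≡-Reasoning
      F G' : ℕ → ℚ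
      F j = pow four (suc j) * E (suc j) (suc m) * cS (q ∸ j) n
      G' j = two * pow four j * Od j (suc m) * cS (q ∸ j) n

  y-even : ∀ q m → yS (suc (dbl q)) 0 (dbl m) ≈ ΣB q m
  y-even q zero = ≈-≡ λ n → trans (GridV.y-00 n (suc (dbl q)))
      (sym (Sum-0 (suc q) λ j _ → solve 2 (λ p c → p :* con 0ℚ :* c := con 0ℚ) refl (two * pow four j)
      (cS (q ∸ j) n)))
  y-even q (suc m) = ≈-trans {yS (suc (dbl q)) 0 (dbl (suc m))}
      {λ n → yS (suc (dbl q)) 0 (dbl m) n + inv b * (two * yS (dbl q) 0 b n)} (y-log-step (dbl q) (dbl m))
    (≈-ext {λ n → yS (suc (dbl q)) 0 (dbl m) n + inv b * (two * yS (dbl q) 0 b n)}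
        {λ n → ΣB q m n + inv b * (two * ΣA q m n)} (λ _ → refl) eq
      (≈-+ {yS (suc (dbl q)) 0 (dbl m)} {ΣB q m} {λ n → inv b * (two * yS (dbl q) 0 b n)}
          {λ n → inv b * (two * ΣA q m n)} (y-even q m)
        (≈-scale {λ n → two * yS (dbl q) 0 b n} {λ n → two * ΣA q m n} (inv b)
            (≈-scale {yS (dbl q) 0 b} {ΣA q m} two (y-odd q m)))))
    where
    b = suc (dbl m)
    eq : ∀ n → ΣB q m n + inv b * (two * ΣA q m n) ≡ ΣB q (suc m) n
    eq n = trans (cong (ΣB q m n +_) (trans (cong (inv b *_)
        (sym (Sum-*ˡ (suc q) two (λ j → pow four j * E j (suc m) * cS (q ∸ j) n))))
        (sym (Sum-*ˡ (suc q) (inv b) (λ j → two * (pow four j * E j (suc m) * cS (q ∸ j) n))))))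
      (trans (sym (Sum-+ (suc q) (λ j → two * pow four j * Od j m * cS (q ∸ j) n)
          (λ j → inv b * (two * (pow four j * E j (suc m) * cS (q ∸ j) n)))))
        (Sum-ext (suc q) λ j → solve 5 (λ f o e i c → con two :* f :* o :* c :+ i :* (con two :* (f :* e :* c))
            := con two :* f :* (o :+ e :* i) :* c) refl (pow four j) (Od j m) (E j (suc m)) (inv b)
            (cS (q ∸ j) n)))

c-bounded : ∀ e → Apx (yS e 0 1) (two * pow two (e ℕ.+ 0))
c-bounded e = apx-ext (λ n → solve 2 (λ a b → b :+ (a :- b) := a) refl (yS e 0 1 n) (two * GridV.g n e 0))
  (apx-+₀ (apx-exact λ n → ≤-trans (∣0≤∣ (≥0-* 0≤two (GridV.0≤g n e 0)))
      (*-monoˡ two 0≤two (≤-trans (GridV.g≤z n e 0) (Grid.z₀≤ n e 0))))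
    (apx-δ (two * pow two e) (λ n → GridV.y-g n e)))

bd-const : ∀ {N₀ f ε} → 0ℚ ≤ ε → Apx f ε → Bd N₀ one (λ _ → f)
bd-const {ε = ε} hε a = bd ε hε 0 λ N _ → apx-≤ (≤-reflexive
    (sym (trans (cong (ε *_) (*-identityʳ 1ℚ)) (*-identityʳ ε)))) a

0≤one : ∀ N → 0ℚ ≤ one N
0≤one _ = 0≤1

bd-Sum₁ : ∀ {N₀} K {F : ℕ → ℕ → ℕ → ℚ} → (∀ i → Bd N₀ one (F i)) → Bd N₀ one (λ N n → Sum K (λ i → F i N n))
bd-Sum₁ zero h = bd 0ℚ ≤-refl 0 λ N _ → apx-exact λ n → ≤-reflexive (sym (*-zeroˡ (1ℚ * 1ℚ)))
bd-Sum₁ (suc K) {F} h = bd-+ 0≤one {λ N n → Sum K (λ i → F i N n)} (bd-Sum₁ K h) (h K)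

y-odd-log : ∀ {N₀} q → Bd N₀ one (λ N → yS (dbl q) 0 (suc (dbl N)))
y-odd-log q = bd-≈ {F = ΣA q} (λ N _ → ≈-sym {yS (dbl q) 0 (suc (dbl N))} {ΣA q N} (y-odd q N))
  (bd-Sum₁ (suc q) {λ j N n → pow four j * E j (suc N) * cS (q ∸ j) n} λ j →
    bd-scale {F = λ _ → cS (q ∸ j)} {c = λ N → pow four j * E j (suc N)} 0≤one
        (lb-* {λ _ → pow four j} (lb-const (pow four j)) (E-log j))
        (bd-const (≥0-* 0≤two (pow-≥0 (dbl (q ∸ j) ℕ.+ 0) 0≤two)) (c-bounded (dbl (q ∸ j)))))

-- Alternating sums of moments in v

y-step : ∀ e j b → (λ n → inv (suc b) * yS e j (suc b) n) ≈
    (λ n → yS e (suc j) b n + yS e (suc j) (suc (suc b)) n)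
y-step e j b = ≈-ext {l} {λ n → inv (suc b) * (ι (suc b) * r n)} {l} {r} (λ _ → refl) (λ n → inv*ι b (r n))
    (≈-scale {yS e j (suc b)} {λ n → ι (suc b) * r n} (inv (suc b))
        (apx-δ ((taylorC b * four + ι (suc b) * six) * pow two e) λ n → GridV.y-rec n e j b))
  where
  l r : ℕ → ℚ
  l n = inv (suc b) * yS e j (suc b) n
  r n = yS e (suc j) b n + yS e (suc j) (suc (suc b)) n

apx-≤-≈ : ∀ {f g h ε} → (∀ n → 0ℚ ≤ f n) → (∀ n → f n ≤ g n) → g ≈ h → Apx h ε → Apx f ε
apx-≤-≈ {f} {g} {h} 0≤f f≤g g≈h a = apx-dom {f} {g} (λ n → ≤-trans (∣0≤∣ (0≤f n))
    (≤-trans (f≤g n) (p≤∣p∣ (g n)))) (apx-≈ {h} {g} (≈-sym {g} {h} g≈h) a)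

-- Both moments on the right of `y-step` are nonnegative, so each is bounded by their sum; `y-upper`
-- treats the other one.
y-lower : ∀ e j b ε → Apx (λ n → inv (suc b) * yS e j (suc b) n) ε → Apx (yS e (suc j) b) ε
y-lower e j b ε = apx-≤-≈ {yS e (suc j) b} {λ n → yS e (suc j) b n + yS e (suc j) (suc (suc b)) n}
    {λ n → inv (suc b) * yS e j (suc b) n} (λ n → GridV.0≤y n e j b)
    (λ n → ≤+ʳ {yS e (suc j) b n} (GridV.0≤y n e j (suc (suc b))))
  (≈-sym {λ n → inv (suc b) * yS e j (suc b) n} {λ n → yS e (suc j) b n + yS e (suc j) (suc (suc b)) n}
      (y-step e j b))

y-upper : ∀ e j b ε → Apx (λ n → inv (suc b) * yS e j (suc b) n) ε → Apx (yS e (suc j) (suc (suc b))) ε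
y-upper e j b ε = apx-≤-≈ {yS e (suc j) (suc (suc b))} {λ n → yS e (suc j) b n + yS e (suc j) (suc (suc b)) n}
    {λ n → inv (suc b) * yS e j (suc b) n} (λ n → GridV.0≤y n e j (suc (suc b)))
    (λ n → ≤+ˡ {yS e (suc j) (suc (suc b)) n} (GridV.0≤y n e j b))
  (≈-sym {λ n → inv (suc b) * yS e j (suc b) n} {λ n → yS e (suc j) b n + yS e (suc j) (suc (suc b)) n}
      (y-step e j b))

drop-inv : ∀ d {f ε} → Apx f ε → Apx (λ n → inv d * f n) ε
drop-inv d {f} = apx-dom {λ n → inv d * f n} {f} λ n → ≤-trans (≤-reflexive (∣p*q∣≡∣p∣*∣q∣ (inv d) (f n)))
  (*≤ʳ (0≤∣p∣ (f n)) (≤-trans (∣0≤∣ (0≤inv d)) (inv≤1 d)))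

-- The 1/N comes once, from the 1/(2N+1) in the first use of `y-step`. Two further levels take the
-- exponent from 2N to 2N - 1 and back without loss, which requires N ≥ 1.
y-odd-small : ∀ q i → Bd 1 invs (λ N → yS (dbl q) (suc (dbl i)) (dbl N))
y-odd-small q zero = small (bd-inv (y-odd-log {1} q))
  where
  small : Bd 1 invs (λ N n → inv (suc N) * yS (dbl q) 0 (suc (dbl N)) n) →
      Bd 1 invs (λ N → yS (dbl q) 1 (dbl N))
  small (bd C hC k b) = bd C hC k λ N le → y-lower (dbl q) 0 (dbl N) _
      (apx-dom {λ n → inv (suc (dbl N)) * yS (dbl q) 0 (suc (dbl N)) n}
      {λ n → inv (suc N) * yS (dbl q) 0 (suc (dbl N)) n}
    (λ n → subst₂ _≤_ (sym (∣p*q∣≡∣p∣*∣q∣ (inv (suc (dbl N))) (yS (dbl q) 0 (suc (dbl N)) n)))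
        (sym (∣p*q∣≡∣p∣*∣q∣ (inv (suc N)) (yS (dbl q) 0 (suc (dbl N)) n)))
      (*-monoʳ ∣ yS (dbl q) 0 (suc (dbl N)) n ∣ (0≤∣p∣ (yS (dbl q) 0 (suc (dbl N)) n))
          (subst₂ _≤_ (sym (0≤p⇒∣p∣≡p (0≤inv (suc (dbl N))))) (sym (0≤p⇒∣p∣≡p (0≤inv (suc N))))
          (inv-anti (n≤dbl N)))))
    (b N le))
y-odd-small q (suc i) = bd (coef ih) (coef≥0 ih) (exponent ih) go
  where
  ih = y-odd-small q i
  go : ∀ N → 1 ℕ.≤ N → Apx (yS (dbl q) (suc (dbl (suc i))) (dbl N))
      (coef ih * (pow (η N) (exponent ih) * invs N))
  go (suc N) le = y-upper (dbl q) (dbl (suc i)) (dbl N) _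
      (drop-inv (suc (dbl N)) {yS (dbl q) (dbl (suc i)) (suc (dbl N))}
    (y-lower (dbl q) (suc (dbl i)) (suc (dbl N)) _ (drop-inv (suc (suc (dbl N)))
        {yS (dbl q) (suc (dbl i)) (dbl (suc N))} (holds ih (suc N) le))))

y-even-small : ∀ q i → Bd 1 invs (λ N → yS (dbl q) (dbl (suc i)) (suc (dbl N)))
y-even-small q i = bd (coef ih) (coef≥0 ih) (exponent ih) go
  where
  ih = y-odd-small q i
  go : ∀ N → 1 ℕ.≤ N → Apx (yS (dbl q) (dbl (suc i)) (suc (dbl N)))
      (coef ih * (pow (η N) (exponent ih) * invs N))
  go (suc N) le = y-upper (dbl q) (suc (dbl i)) (suc (dbl N)) _
      (drop-inv (suc (suc (dbl N))) {yS (dbl q) (suc (dbl i)) (dbl (suc N))} (holds ih (suc N) le))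

AN BN : ℕ → ℕ → ℕ → ℕ → ℕ → ℚ
AN e j k N n = Sum N (λ m → sgn (suc m) * E j (suc m) * (inv (suc (dbl m)) * yS e k (suc (dbl m)) n))
BN e j k N n = Sum N (λ m → sgn (suc m) * Od j (suc m) * (inv (dbl (suc m)) * yS e k (dbl (suc m)) n))

-- The two versions of Abel summation differ in which difference of u they form. Each is used where
-- the lower boundary term is under control: `E (suc j) 1` = 0 in `A-suc`, and `Od j 0` = 0 in
-- `B-A`, which uses `abel₂`.
abel₁ : ∀ N (u Y : ℕ → ℚ) → Sum N (λ m → sgn (suc m) * u (suc m) * (Y m + Y (suc m))) ≡
  - (u 1 * Y 0) - Sum N (λ m → sgn (suc m) * (u (suc (suc m)) - u (suc m)) * Y (suc m)) + sgn N * u (suc N) * Y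
      N
abel₁ zero u Y = solve 2 (λ u y → con 0ℚ := :- (u :* y) :- con 0ℚ :+ con 1ℚ :* u :* y) refl (u 1) (Y 0)
abel₁ (suc N) u Y = trans (cong (_+ sgn (suc N) * u (suc N) * (Y N + Y (suc N))) (abel₁ N u Y))
  (solve 7 (λ c S σ a b y y' → c :- S :+ σ :* a :* y :+ (:- σ) :* a :* (y :+ y') := c :-
      (S :+ (:- σ) :* (b :- a) :* y') :+ (:- σ) :* b :* y') refl
    (- (u 1 * Y 0)) (Sum N (λ m → sgn (suc m) * (u (suc (suc m)) - u (suc m)) * Y (suc m))) (sgn N) (u (suc N))
        (u (suc (suc N))) (Y N) (Y (suc N)))

abel₂ : ∀ N (u Y : ℕ → ℚ) → Sum N (λ m → sgn (suc m) * u (suc m) * (Y m + Y (suc m))) ≡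
  Sum N (λ m → sgn (suc m) * (u (suc m) - u m) * Y m) + sgn N * u N * Y N - u 0 * Y 0
abel₂ zero u Y = solve 2 (λ u y → con 0ℚ := con 0ℚ :+ con 1ℚ :* u :* y :- u :* y) refl (u 0) (Y 0)
abel₂ (suc N) u Y = trans (cong (_+ sgn (suc N) * u (suc N) * (Y N + Y (suc N))) (abel₂ N u Y))
  (solve 7 (λ c S σ a b y y' → S :+ σ :* a :* y :- c :+ (:- σ) :* b :* (y :+ y') := S :+ (:- σ) :* (b :- a) :* y
      :+ (:- σ) :* b :* y' :- c) refl
    (u 0 * Y 0) (Sum N (λ m → sgn (suc m) * (u (suc m) - u m) * Y m)) (sgn N) (u N) (u (suc N)) (Y N)
        (Y (suc N)))

A-sum : ∀ e j k N → AN e j k N ≈ (λ n → Sum N (λ m → sgn (suc m) * E j (suc m) *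
    (yS e (suc k) (dbl m) n + yS e (suc k) (dbl (suc m)) n)))
A-sum e j k N = ≈-Sum N {λ m n → sgn (suc m) * E j (suc m) * (inv (suc (dbl m)) * yS e k (suc (dbl m)) n)}
    {λ m n → sgn (suc m) * E j (suc m) * (yS e (suc k) (dbl m) n + yS e (suc k) (dbl (suc m)) n)}
  λ m _ → ≈-scale {λ n → inv (suc (dbl m)) * yS e k (suc (dbl m)) n}
      {λ n → yS e (suc k) (dbl m) n + yS e (suc k) (dbl (suc m)) n} (sgn (suc m) * E j (suc m))
      (y-step e k (dbl m))

B-sum : ∀ e j k N → BN e j k N ≈ (λ n → Sum N (λ m → sgn (suc m) * Od j (suc m) *
    (yS e (suc k) (suc (dbl m)) n + yS e (suc k) (suc (dbl (suc m))) n)))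
B-sum e j k N = ≈-Sum N {λ m n → sgn (suc m) * Od j (suc m) * (inv (dbl (suc m)) * yS e k (dbl (suc m)) n)}
    {λ m n → sgn (suc m) * Od j (suc m) * (yS e (suc k) (suc (dbl m)) n + yS e (suc k) (suc (dbl (suc m))) n)}
  λ m _ → ≈-scale {λ n → inv (dbl (suc m)) * yS e k (dbl (suc m)) n}
      {λ n → yS e (suc k) (suc (dbl m)) n + yS e (suc k) (suc (dbl (suc m))) n} (sgn (suc m) * Od j (suc m))
      (y-step e k (suc (dbl m)))

A-zero : ∀ e k N → AN e 0 k N ≈ (λ n → - yS e (suc k) 0 n + sgn N * yS e (suc k) (dbl N) n)
A-zero e k N = ≈-ext {AN e 0 k N} {S} (λ _ → refl) (λ n → trans
    (abel₁ N (λ _ → 1ℚ) (λ m → yS e (suc k) (dbl m) n))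
    (trans (cong (λ t → - (1ℚ * yS e (suc k) 0 n) - t + sgn N * 1ℚ * yS e (suc k) (dbl N) n)
        (Sum-0 N λ m _ → solve 2 (λ σ y → σ :* (con 1ℚ :- con 1ℚ) :* y := con 0ℚ) refl (sgn (suc m))
        (yS e (suc k) (dbl (suc m)) n)))
      (solve 3 (λ a σ b → :- (con 1ℚ :* a) :- con 0ℚ :+ σ :* con 1ℚ :* b := :- a :+ σ :* b) refl
          (yS e (suc k) 0 n) (sgn N) (yS e (suc k) (dbl N) n))))
    (A-sum e 0 k N)
  where
  S : ℕ → ℚ
  S n = Sum N (λ m → sgn (suc m) * 1ℚ * (yS e (suc k) (dbl m) n + yS e (suc k) (dbl (suc m)) n))

A-suc : ∀ e j k N → AN e (suc j) k N ≈ (λ n → - BN e j (suc k) N n + sgn N * E (suc j) (suc N) * yS e (suc k)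
    (dbl N) n)
A-suc e j k N = ≈-ext {AN e (suc j) k N} {λ n → Sum N (λ m → sgn (suc m) * E (suc j) (suc m) *
    (yS e (suc k) (dbl m) n + yS e (suc k) (dbl (suc m)) n))} (λ _ → refl)
    (λ n → trans (abel₁ N (E (suc j)) (λ m → yS e (suc k) (dbl m) n)) (eq n)) (A-sum e (suc j) k N)
  where
  eq : ∀ n → - (E (suc j) 1 * yS e (suc k) 0 n) - Sum N
      (λ m → sgn (suc m) * (E (suc j) (suc (suc m)) - E (suc j) (suc m)) * yS e (suc k) (dbl (suc m)) n) + sgn N
      * E (suc j) (suc N) * yS e (suc k) (dbl N) n
    ≡ - BN e j (suc k) N n + sgn N * E (suc j) (suc N) * yS e (suc k) (dbl N) n
  eq n = cong (_+ sgn N * E (suc j) (suc N) * yS e (suc k) (dbl N) n)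
    (trans (cong₂ (λ a b → - (a * yS e (suc k) 0 n) - b) (E-1 j)
        (Sum-ext N λ m → solve 5 (λ σ a o i y → σ :* (a :+ o :* i :- a) :* y := σ :* o :* (i :* y)) refl
        (sgn (suc m)) (E (suc j) (suc m)) (Od j (suc m)) (inv (dbl (suc m))) (yS e (suc k) (dbl (suc m)) n)))
      (solve 2 (λ y b → :- (con 0ℚ :* y) :- b := :- b) refl (yS e (suc k) 0 n) (BN e j (suc k) N n)))

B-A : ∀ e j k N → BN e j k N ≈ (λ n → AN e j (suc k) N n + sgn N * Od j N * yS e (suc k) (suc (dbl N)) n)
B-A e j k N = ≈-ext {BN e j k N} {λ n → Sum N (λ m → sgn (suc m) * Od j (suc m) *
    (yS e (suc k) (suc (dbl m)) n + yS e (suc k) (suc (dbl (suc m))) n))} (λ _ → refl)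
    (λ n → trans (abel₂ N (Od j) (λ m → yS e (suc k) (suc (dbl m)) n)) (eq n)) (B-sum e j k N)
  where
  eq : ∀ n → Sum N (λ m → sgn (suc m) * (Od j (suc m) - Od j m) * yS e (suc k) (suc (dbl m)) n) + sgn N * Od j N
      * yS e (suc k) (suc (dbl N)) n - 0ℚ * yS e (suc k) 1 n
    ≡ AN e j (suc k) N n + sgn N * Od j N * yS e (suc k) (suc (dbl N)) n
  eq n = trans (cong (λ t → t + sgn N * Od j N * yS e (suc k) (suc (dbl N)) n - 0ℚ * yS e (suc k) 1 n)
      (Sum-ext N λ m → solve 5 (λ σ a o i y → σ :* (a :+ o :* i :- a) :* y := σ :* o :* (i :* y)) refl
          (sgn (suc m)) (Od j m) (E j (suc m)) (inv (suc (dbl m))) (yS e (suc k) (suc (dbl m)) n)))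
    (solve 3 (λ a b y → a :+ b :- con 0ℚ :* y := a :+ b) refl (AN e j (suc k) N n)
        (sgn N * Od j N * yS e (suc k) (suc (dbl N)) n) (yS e (suc k) 1 n))

lb-sgn : LogBounded sgn
lb-sgn = 1ℚ , 0 , 0≤1 , λ N → ≤-trans (∣sgn∣≤1 N) (≤-reflexive (sym (*-identityʳ 1ℚ)))

-- One round from A to B and back lowers j by 1, raises the depth by 2 and changes the sign, so i
-- stays free in the induction on j; at j = 0 the sum telescopes to the moment at b = 0. The
-- boundary terms at N are powers of log N times moments that are O((log N)^k/N).
A-moment : ∀ q j i → Bd 1 invs (λ N n → AN (dbl q) j (dbl i) N n - sgn (suc j) * yS (dbl q)
    (suc (dbl (i ℕ.+ j))) 0 n)
A-moment q zero i = bd-≈ {F = λ N n → sgn N * yS e (suc (dbl i)) (dbl N) n}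
    {G = λ N n → AN e 0 (dbl i) N n - sgn 1 * yS e (suc (dbl (i ℕ.+ 0))) 0 n}
    (λ N _ → ≈-ext {λ n → - yS e (suc (dbl i)) 0 n + sgn N * yS e (suc (dbl i)) (dbl N) n + yS e (suc (dbl i)) 0
        n} {λ n → AN e 0 (dbl i) N n + yS e (suc (dbl i)) 0 n}
      (λ n → solve 2 (λ a b → :- a :+ b :+ a := b) refl (yS e (suc (dbl i)) 0 n)
          (sgn N * yS e (suc (dbl i)) (dbl N) n))
      (λ n → trans (solve 2 (λ a b → a :+ b := a :- (:- con 1ℚ) :* b) refl (AN e 0 (dbl i) N n)
          (yS e (suc (dbl i)) 0 n)) (cong (λ t → AN e 0 (dbl i) N n - sgn 1 * yS e (suc (dbl t)) 0 n)
          (sym (ℕP.+-identityʳ i))))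
      (≈-+ {λ n → - yS e (suc (dbl i)) 0 n + sgn N * yS e (suc (dbl i)) (dbl N) n} {AN e 0 (dbl i) N}
          {yS e (suc (dbl i)) 0} {yS e (suc (dbl i)) 0}
        (≈-sym {AN e 0 (dbl i) N} {λ n → - yS e (suc (dbl i)) 0 n + sgn N * yS e (suc (dbl i)) (dbl N) n}
            (A-zero e (dbl i) N)) (≈-refl {yS e (suc (dbl i)) 0})))
    (bd-scale {F = λ N → yS e (suc (dbl i)) (dbl N)} 0≤invs lb-sgn (y-odd-small q i))
  where
  e = dbl q
A-moment q (suc j) i = bd-≈ {F = R} {G = λ N n → AN e (suc j) (dbl i) N n - sgn (suc (suc j)) * yS e
    (suc (dbl (i ℕ.+ suc j))) 0 n} step
    (bd-+ 0≤invs {λ N n → - ih N n + - b₂ N n} {b₁} (bd-+ 0≤invs {λ N n → - ih N n} {λ N n → - b₂ N n}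
        (bd-neg {F = ih} (A-moment q j (suc i)))
      (bd-neg {F = b₂} (bd-scale {F = λ N → yS e (dbl (suc i)) (suc (dbl N))} {c = λ N → sgn N * Od j N} 0≤invs
          (lb-* {sgn} {λ N → Od j N} lb-sgn (O-log j)) (y-even-small q i))))
      (bd-scale {F = λ N → yS e (suc (dbl i)) (dbl N)} {c = λ N → sgn N * E (suc j) (suc N)} 0≤invs
          (lb-* {sgn} {λ N → E (suc j) (suc N)} lb-sgn (E-log (suc j))) (y-odd-small q i)))
  where
  e = dbl q
  X : ℕ → ℚ
  X = yS e (suc (dbl (suc i ℕ.+ j))) 0
  ih b₁ b₂ R : ℕ → ℕ → ℚ
  ih N n = AN e j (dbl (suc i)) N n - sgn (suc j) * X n
  b₁ N n = sgn N * E (suc j) (suc N) * yS e (suc (dbl i)) (dbl N) n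
  b₂ N n = sgn N * Od j N * yS e (dbl (suc i)) (suc (dbl N)) n
  R N n = - ih N n + - b₂ N n + b₁ N n
  step : ∀ N → 1 ℕ.≤ N → R N ≈ (λ n → AN e (suc j) (dbl i) N n - sgn (suc (suc j)) * yS e
      (suc (dbl (i ℕ.+ suc j))) 0 n)
  step N _ = ≈-sym {λ n → AN e (suc j) (dbl i) N n - sgn (suc (suc j)) * yS e (suc (dbl (i ℕ.+ suc j))) 0 n}
      {R N}
    (≈-ext {λ n → AN e (suc j) (dbl i) N n + sgn (suc j) * X n}
        {λ n → - (A' n + b₂ N n) + b₁ N n + sgn (suc j) * X n}
      (λ n → trans (solve 3 (λ a s x → a :+ s :* x := a :- (:- s) :* x) refl (AN e (suc j) (dbl i) N n)
          (sgn (suc j)) (X n)) (cong (λ t → AN e (suc j) (dbl i) N n - sgn (suc (suc j)) * yS e (suc (dbl t)) 0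
          n) (sym (ℕP.+-suc i j))))
      (λ n → solve 4 (λ a b c x → :- (a :+ b) :+ c :+ x := :- (a :- x) :+ :- b :+ c) refl (A' n) (b₂ N n)
          (b₁ N n) (sgn (suc j) * X n))
      (≈-+ {AN e (suc j) (dbl i) N} {λ n → - (A' n + b₂ N n) + b₁ N n} {λ n → sgn (suc j) * X n}
          {λ n → sgn (suc j) * X n} AB (≈-refl {λ n → sgn (suc j) * X n})))
    where
    A' : ℕ → ℚ
    A' = AN e j (dbl (suc i)) N
    B' : ℕ → ℚ
    B' = BN e j (suc (dbl i)) N
    AB : AN e (suc j) (dbl i) N ≈ (λ n → - (A' n + b₂ N n) + b₁ N n)
    AB = ≈-trans {AN e (suc j) (dbl i) N} {λ n → - B' n + b₁ N n} {λ n → - (A' n + b₂ N n) + b₁ N n}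
        (A-suc e j (dbl i) N)
      (≈-ext {λ n → - 1ℚ * B' n + b₁ N n} {λ n → - 1ℚ * (A' n + b₂ N n) + b₁ N n}
        (λ n → cong (_+ b₁ N n) (solve 1 (λ a → (:- con 1ℚ) :* a := :- a) refl (B' n)))
            (λ n → cong (_+ b₁ N n) (solve 1 (λ a → (:- con 1ℚ) :* a := :- a) refl (A' n + b₂ N n)))
        (≈-+ {λ n → - 1ℚ * B' n} {λ n → - 1ℚ * (A' n + b₂ N n)} {b₁ N} {b₁ N}
            (≈-scale {B'} {λ n → A' n + b₂ N n} (- 1ℚ) (B-A e j (suc (dbl i)) N)) (≈-refl {b₁ N})))

-- The constants c

z-pow : ∀ e a → zS e 0 a ≈ (λ _ → pow (inv (suc a)) (suc e))
z-pow zero a = ≈-trans {zS 0 0 a} {λ n → inv (suc a) * (0ℚ + 1ℚ)} (z-step 0 0 a)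
    (≈-refl {λ _ → inv (suc a) * 1ℚ})
z-pow (suc e) a = ≈-trans {zS (suc e) 0 a} {λ n → inv (suc a) * (zS e 0 a n + 0ℚ)} (z-step (suc e) 0 a)
  (≈-ext {λ n → inv (suc a) * zS e 0 a n} {λ _ → inv (suc a) * pow (inv (suc a)) (suc e)}
      (λ n → cong (inv (suc a) *_) (sym (+-identityʳ (zS e 0 a n)))) (λ _ → refl)
    (≈-scale {zS e 0 a} {λ _ → pow (inv (suc a)) (suc e)} (inv (suc a)) (z-pow e a)))

ιz-pow : ∀ e a → (λ n → ι (suc a) * zS e 0 a n) ≈ (λ _ → pow (inv (suc a)) e)
ιz-pow e a = ≈-ext {λ n → ι (suc a) * zS e 0 a n} {λ _ → ι (suc a) * pow (inv (suc a)) (suc e)} (λ _ → refl)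
  (λ _ → trans (solve 3 (λ m i p → m :* (i :* p) := i :* (m :* p)) refl (ι (suc a)) (inv (suc a))
      (pow (inv (suc a)) e)) (inv*ι a (pow (inv (suc a)) e)))
  (≈-scale {zS e 0 a} {λ _ → pow (inv (suc a)) (suc e)} (ι (suc a)) (z-pow e a))

zbar-Sum : ∀ N e → zbar N e ≡ Sum N (λ k → sgn k * pow (inv (suc k)) e)
zbar-Sum N e = Σ-Sum 1 N (λ n → sgn (n ∸ 1) * pow (inv n) e)

alternating-zbar : ∀ e N → (λ n → Sum N (λ k → sgn k * (ι (suc k) * zS e 0 k n))) ≈ (λ _ → zbar N e)
alternating-zbar e N = ≈-ext {S} {λ _ → Sum N (λ k → sgn k * pow (inv (suc k)) e)} {S} (λ _ → refl)
    (λ _ → sym (zbar-Sum N e))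
    (≈-Sum N {λ k n → sgn k * (ι (suc k) * zS e 0 k n)} {λ k _ → sgn k * pow (inv (suc k)) e} λ k _ → ≈-scale
        {λ n → ι (suc k) * zS e 0 k n} {λ _ → pow (inv (suc k)) e} (sgn k) (ιz-pow e k))
  where
  S : ℕ → ℚ
  S n = Sum N (λ k → sgn k * (ι (suc k) * zS e 0 k n))

ιg-small : ∀ e a m → m ℕ.≤ suc a → Apx (λ n → ι m * GridV.g n (suc e) a) (inv (suc a))
ιg-small e a m le = apx-≤-≈ {λ n → ι m * GridV.g n (suc e) a} {λ n → ι (suc a) * zS (suc e) 0 a n}
    {λ _ → pow (inv (suc a)) (suc e)}
  (λ n → ≥0-* (0≤ι m) (GridV.0≤g n (suc e) a)) (λ n → *-mono (0≤ι m) (GridV.0≤g n (suc e) a) (ι-mono le)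
      (GridV.g≤z n (suc e) a)) (ιz-pow (suc e) a)
  (apx-exact λ _ → ≤-trans (∣0≤∣ (pow-≥0 (suc e) (0≤inv (suc a))))
      (*≤ˡ (0≤inv (suc a)) (pow-≤1 e (0≤inv (suc a)) (inv≤1 (suc a)))))

-- Here 2 ds/(1+s)² is expanded by `alternating-z`. The remainder has two terms of size at most
-- 1/(N+1) in the limit, doubled by the factor 2; their decay comes from the positive power of L.
c-zbar : ∀ e N → Apx (λ n → yS (suc e) 0 1 n - two * zbar N (suc e)) (four * inv (suc N))
c-zbar e N = apx-≤ bound' (apx-ext eq (apx-+ {λ n → (two * sgn N) * R n} {λ n → D₁ n + two * D₂ n}
    (apx-scale {R} (two * sgn N) (apx-+ {λ n → ι (suc N) * gS N n} {λ n → ι N * gS (suc N) n}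
    (ιg-small e N (suc N) ℕP.≤-refl)
      (apx-≤ (inv-anti (ℕP.n≤1+n N)) (ιg-small e (suc N) N (ℕP.m≤n⇒m≤1+n (ℕP.n≤1+n N))))))
    (apx-+₀ {D₁} {λ n → two * D₂ n} {0ℚ} (apx-δ (two * pow two (suc e)) λ n → GridV.y-g n (suc e))
        (apx-≤ (≤-reflexive (*-zeroʳ ∣ two ∣)) (apx-scale {D₂} two (alternating-zbar (suc e) N))))))
  where
  gS : ℕ → ℕ → ℚ
  gS a n = GridV.g n (suc e) a
  R D₁ D₂ S : ℕ → ℚ
  R n = ι (suc N) * gS N n + ι N * gS (suc N) n
  S n = Sum N (λ k → sgn k * (ι (suc k) * zS (suc e) 0 k n))
  D₁ n = yS (suc e) 0 1 n - two * gS 0 n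
  D₂ n = S n - zbar N (suc e)
  eq : ∀ n → (two * sgn N) * R n + (D₁ n + two * D₂ n) ≡ yS (suc e) 0 1 n - two * zbar N (suc e)
  eq n = trans (cong (λ t → (two * sgn N) * R n + (D₁ n + two * (t - zbar N (suc e))))
      (GridV.alternating-z n (suc e) N))
    (solve 5 (λ σ r y g z → (con two :* σ) :* r :+ ((y :- con two :* g) :+ con two :* (g :- σ :* r :- z)) := y
        :- con two :* z) refl (sgn N) (R n) (yS (suc e) 0 1 n) (gS 0 n) (zbar N (suc e)))
  bound' : ∣ two * sgn N ∣ * (inv (suc N) + inv (suc N)) + 0ℚ ≤ four * inv (suc N)
  bound' = ≤-reflexive (trans (cong (λ t → t * (inv (suc N) + inv (suc N)) + 0ℚ)
      (trans (∣p*q∣≡∣p∣*∣q∣ two (sgn N)) (cong (two *_) (∣sgn∣ N))))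
    (solve 1 (λ i → con two :* con 1ℚ :* (i :+ i) :+ con 0ℚ := con four :* i) refl (inv (suc N))))

-- The value at 0 is set apart: the total increment of v is 1, whereas the truncated `zbar N 0`
-- alternates between 0 and 1.
cN : ℕ → ℕ → ℚ
cN N zero = 1ℚ
cN N (suc d) = two * zbar N (2 ℕ.* suc d)

c-limit : ∀ {N₀} d → Bd N₀ invs (λ N n → cS d n - cN N d)
c-limit zero = bd-ext (λ N _ n → sym (trans (cong (_- 1ℚ) (GridV.y-0 n 0)) (+-inverseʳ 1ℚ))) bd-0
c-limit (suc d) = bd four (nonNegative⁻¹ four) 0 λ N _ → apx-≤
    (≤-reflexive (cong (four *_) (sym (*-identityˡ (inv (suc N))))))
  (apx-ext (λ n → cong (λ t → cS (suc d) n - two * zbar N t) (dbl≡2* (suc d))) (c-zbar (suc (dbl d)) N))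

zbar-log : ∀ s → LogBounded (λ N → zbar N (suc s))
zbar-log s = 1ℚ , 1 , 0≤1 , λ N → ≤-trans (≤-reflexive (cong ∣_∣ (zbar-Sum N (suc s))))
  (≤-trans (Sum-∣∣ N {λ k → sgn k * pow (inv (suc k)) (suc s)} {inv ∘ suc} λ k _ → ≤-trans
      (∣*∣≤ {sgn k} {pow (inv (suc k)) (suc s)} (∣sgn∣≤1 k)
      (≤-trans (∣0≤∣ (pow-≥0 (suc s) (0≤inv (suc k)))) (*≤ˡ (0≤inv (suc k))
      (pow-≤1 s (0≤inv (suc k)) (inv≤1 (suc k)))))) (≤-reflexive (*-identityˡ (inv (suc k)))))
    (≤-trans (Sum-mono-len (inv ∘ suc) (λ k → 0≤inv (suc k)) (ℕP.n≤1+n N))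
        (≤-trans (≤+ˡ {Sum (suc N) (inv ∘ suc)} {1ℚ} 0≤1)
        (≤-reflexive (solve 1 (λ h → h := con 1ℚ :* (h :* con 1ℚ)) refl (η N))))))

-- Convolution

conv : (ℕ → ℚ) → (ℕ → ℚ) → ℕ → ℚ
conv f g n = Sum (suc n) (λ j → f j * g (n ∸ j))

conv-suc : ∀ f g n → conv f g (suc n) ≡ f 0 * g (suc n) + conv (f ∘ suc) g n
conv-suc f g n = Sum-head (suc n) (λ j → f j * g (suc n ∸ j))

conv-linear : ∀ c f f' g n → conv (λ j → c * f j + f' j) g n ≡ c * conv f g n + conv f' g n
conv-linear c f f' g n = trans (Sum-ext (suc n) λ j → solve 4
    (λ c a b g → (c :* a :+ b) :* g := c :* (a :* g) :+ b :* g) refl c (f j) (f' j) (g (n ∸ j)))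
  (trans (Sum-+ (suc n) (λ j → c * (f j * g (n ∸ j))) (λ j → f' j * g (n ∸ j)))
      (cong (_+ conv f' g n) (Sum-*ˡ (suc n) c (λ j → f j * g (n ∸ j)))))

conv-ext : ∀ {f f'} g n → (∀ j → f j ≡ f' j) → conv f g n ≡ conv f' g n
conv-ext g n h = Sum-ext (suc n) λ j → cong (_* g (n ∸ j)) (h j)

conv-assoc : ∀ f g h n → conv (conv f g) h n ≡ conv f (conv g h) n
conv-assoc f g h zero = solve 3 (λ f g h → con 0ℚ :+ (con 0ℚ :+ f :* g) :* h := con 0ℚ :+ f :*
    (con 0ℚ :+ g :* h)) refl (f 0) (g 0) (h 0)
conv-assoc f g h (suc n) = begin
  conv (conv f g) h (suc n)
    ≡⟨ conv-suc (conv f g) h n ⟩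
  conv f g 0 * h (suc n) + conv (conv f g ∘ suc) h n
    ≡⟨ cong (conv f g 0 * h (suc n) +_) (trans (conv-ext h n (conv-suc f g))
        (conv-linear (f 0) (g ∘ suc) (conv (f ∘ suc) g) h n)) ⟩
  conv f g 0 * h (suc n) + (f 0 * conv (g ∘ suc) h n + conv (conv (f ∘ suc) g) h n)
    ≡⟨ cong (λ t → conv f g 0 * h (suc n) + (f 0 * conv (g ∘ suc) h n + t)) (conv-assoc (f ∘ suc) g h n) ⟩
  conv f g 0 * h (suc n) + (f 0 * conv (g ∘ suc) h n + conv (f ∘ suc) (conv g h) n)
    ≡⟨ solve 5 (λ f g h c r → (con 0ℚ :+ f :* g) :* h :+ (f :* c :+ r) := f :* (g :* h :+ c) :+ r) refl (f 0)
        (g 0) (h (suc n)) (conv (g ∘ suc) h n) (conv (f ∘ suc) (conv g h) n) ⟩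
  f 0 * (g 0 * h (suc n) + conv (g ∘ suc) h n) + conv (f ∘ suc) (conv g h) n
    ≡⟨ cong (λ t → f 0 * t + conv (f ∘ suc) (conv g h) n) (sym (conv-suc g h n)) ⟩
  f 0 * conv g h (suc n) + conv (f ∘ suc) (conv g h) n
    ≡⟨ sym (conv-suc f (conv g h) n) ⟩
  conv f (conv g h) (suc n) ∎ where open ≡-Reasoning

conv-unit : ∀ f {e} → e 0 ≡ 1ℚ → (∀ d → e (suc d) ≡ 0ℚ) → ∀ n → conv f e n ≡ f n
conv-unit f {e} h₀ h zero = trans (cong (λ t → 0ℚ + f 0 * t) h₀)
    (solve 1 (λ f → con 0ℚ :+ f :* con 1ℚ := f) refl (f 0))
conv-unit f {e} h₀ h (suc n) = trans (conv-suc f e n) (trans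
    (cong₂ (λ a b → f 0 * a + b) (h n) (conv-unit (f ∘ suc) {e} h₀ h n))
    (solve 2 (λ a b → a :* con 0ℚ :+ b := b) refl (f 0) (f (suc n))))

-- Z is the convolution inverse of c

-- Chains with k steps and total length d.
K : ℕ → ℕ → ℕ → ℚ
K N zero zero = 1ℚ
K N zero (suc d) = 0ℚ
K N (suc k) d = Sum d (λ i → zbar N (2 ℕ.* suc i) * K N k (d ∸ suc i))

-- Z(j,p) as a function of d = p - j. As a power series this is the geometric expansion of the
-- inverse of 1 + 2 Σ ζ̄(2i) x^i, with K the coefficients of the k-th power of Σ ζ̄(2i) x^i; the
-- term k = 0 accounts for Z(p,p) = 1.
u : ℕ → ℕ → ℚ
u N d = Sum (suc d) (λ k → pow (- two) k * K N k d)

≡ᵇ-refl : ∀ s → (s ≡ᵇ s) ≡ true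
≡ᵇ-refl zero = refl
≡ᵇ-refl (suc s) = ≡ᵇ-refl s

≡ᵇ-+suc : ∀ s d → (s ≡ᵇ s ℕ.+ suc d) ≡ false
≡ᵇ-+suc zero d = refl
≡ᵇ-+suc (suc s) d = ≡ᵇ-+suc s d

chains-K : ∀ N k s d → sumℚ (map (chainProd N s) (chains s (s ℕ.+ d) k)) ≡ K N k d
chains-K N zero s zero rewrite ℕP.+-identityʳ s | ≡ᵇ-refl s = +-identityʳ 1ℚ
chains-K N zero s (suc d) rewrite ≡ᵇ-+suc s d = refl
chains-K N (suc k) s d = begin
  sumℚ (map (chainProd N s) (chains s (s ℕ.+ d) (suc k)))
    ≡⟨ sum-concatMap (chainProd N s) (λ i → map (i ∷_) (chains i (s ℕ.+ d) k)) (range (suc s) (s ℕ.+ d)) ⟩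
  Σ[ suc s ⋯ s ℕ.+ d ] (λ i → sumℚ (map (chainProd N s) (map (i ∷_) (chains i (s ℕ.+ d) k))))
    ≡⟨ Σ-Sum (suc s) (s ℕ.+ d) (λ i → sumℚ (map (chainProd N s) (map (i ∷_) (chains i (s ℕ.+ d) k)))) ⟩
  Sum (s ℕ.+ d ∸ s) F
    ≡⟨ cong (λ c → Sum c F) (ℕP.m+n∸m≡n s d) ⟩
  Sum d F
    ≡⟨ Sum-cong d term ⟩
  K N (suc k) d ∎
  where
  open ≡-Reasoning
  F : ℕ → ℚ
  F t = sumℚ (map (chainProd N s) (map ((suc s ℕ.+ t) ∷_) (chains (suc s ℕ.+ t) (s ℕ.+ d) k)))
  term : ∀ t → t ℕ.< d → F t ≡ zbar N (2 ℕ.* suc t) * K N k (d ∸ suc t)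
  term t l = trans (sum-map-∘ (chainProd N s) ((suc s ℕ.+ t) ∷_) (chains (suc s ℕ.+ t) (s ℕ.+ d) k))
    (trans (sumℚ-*ˡ (zbar N (2 ℕ.* (suc s ℕ.+ t) ∸ 2 ℕ.* s)) (chainProd N (suc s ℕ.+ t))
        (chains (suc s ℕ.+ t) (s ℕ.+ d) k))
      (cong₂ (λ a b → zbar N a * b) idx (trans (cong (λ e → sumℚ
          (map (chainProd N (suc s ℕ.+ t)) (chains (suc s ℕ.+ t) e k))) eeq)
          (chains-K N k (suc s ℕ.+ t) (d ∸ suc t)))))
    where
    idx : 2 ℕ.* (suc s ℕ.+ t) ∸ 2 ℕ.* s ≡ 2 ℕ.* suc t
    idx = trans (cong (_∸ 2 ℕ.* s) (NS.solve 2 (λ s t → NS.con 2 NS.:* (NS.con 1 NS.:+ s NS.:+ t) NS.:= NS.con 2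
        NS.:* s NS.:+ NS.con 2 NS.:* (NS.con 1 NS.:+ t)) refl s t)) (ℕP.m+n∸m≡n (2 ℕ.* s) (2 ℕ.* suc t))
    eeq : s ℕ.+ d ≡ suc s ℕ.+ t ℕ.+ (d ∸ suc t)
    eeq = trans (cong (s ℕ.+_) (sym (ℕP.m+[n∸m]≡n l))) (trans (ℕP.+-suc s (t ℕ.+ (d ∸ suc t)))
        (cong suc (sym (ℕP.+-assoc s t (d ∸ suc t)))))

Z-u : ∀ N s d → Z N s (s ℕ.+ d) ≡ u N d
Z-u N s zero rewrite ℕP.+-identityʳ s | ≡ᵇ-refl s = refl
Z-u N s (suc d) rewrite ≡ᵇ-+suc s d = begin
  Σ[ 1 ⋯ s ℕ.+ suc d ∸ s ] (λ k → pow (- two) k * sumℚ (map (chainProd N s) (chains s (s ℕ.+ suc d) k)))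
    ≡⟨ Σ-Sum 1 (s ℕ.+ suc d ∸ s) (λ k → pow (- two) k * sumℚ (map (chainProd N s) (chains s (s ℕ.+ suc d) k))) ⟩
  Sum (s ℕ.+ suc d ∸ s) (λ k → pow (- two) (suc k) * sumℚ
      (map (chainProd N s) (chains s (s ℕ.+ suc d) (suc k))))
    ≡⟨ cong (λ c → Sum c (λ k → pow (- two) (suc k) * sumℚ
        (map (chainProd N s) (chains s (s ℕ.+ suc d) (suc k))))) (ℕP.m+n∸m≡n s (suc d)) ⟩
  Sum (suc d) (λ k → pow (- two) (suc k) * sumℚ (map (chainProd N s) (chains s (s ℕ.+ suc d) (suc k))))
    ≡⟨ Sum-ext (suc d) (λ k → cong (pow (- two) (suc k) *_) (chains-K N (suc k) s (suc d))) ⟩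
  Sum (suc d) (λ k → pow (- two) (suc k) * K N (suc k) (suc d))
    ≡⟨ solve 1 (λ t → t := con 1ℚ :* con 0ℚ :+ t) refl (Sum (suc d)
        (λ k → pow (- two) (suc k) * K N (suc k) (suc d))) ⟩
  1ℚ * 0ℚ + Sum (suc d) (λ k → pow (- two) (suc k) * K N (suc k) (suc d))
    ≡⟨ sym (Sum-head (suc d) (λ k → pow (- two) k * K N k (suc d))) ⟩
  u N (suc d) ∎ where open ≡-Reasoning

K-0 : ∀ N k d → d ℕ.< k → K N k d ≡ 0ℚ
K-0 N (suc k) d (s≤s le) = Sum-0 d λ i l → trans (cong (zbar N (2 ℕ.* suc i) *_)
    (K-0 N k (d ∸ suc i) (ℕP.<-≤-trans (∸suc-< d i l) le))) (*-zeroʳ (zbar N (2 ℕ.* suc i)))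

-- Splits off the first step of each chain. The range of k can be the same for all remaining
-- lengths, because chains with more steps than length contribute 0 (`K-0`).
u-rec : ∀ N d → u N (suc d) ≡ - two * Sum (suc d) (λ i → zbar N (2 ℕ.* suc i) * u N (d ∸ i))
u-rec N d = begin
  u N (suc d)
    ≡⟨ Sum-head (suc d) (λ k → pow (- two) k * K N k (suc d)) ⟩
  1ℚ * 0ℚ + Sum (suc d) (λ k → - two * pow (- two) k * Sum (suc d) (λ i → zb i * K N k (d ∸ i)))
    ≡⟨ cong (1ℚ * 0ℚ +_) (Sum-ext (suc d) λ k → trans (*-assoc (- two) (pow (- two) k)
        (Sum (suc d) (λ i → zb i * K N k (d ∸ i)))) (cong (- two *_)
        (sym (Sum-*ˡ (suc d) (pow (- two) k) (λ i → zb i * K N k (d ∸ i)))))) ⟩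
  1ℚ * 0ℚ + Sum (suc d) (λ k → - two * Sum (suc d) (λ i → pow (- two) k * (zb i * K N k (d ∸ i))))
    ≡⟨ trans (+-identityˡ (Sum (suc d) (λ k → - two * Sum (suc d)
        (λ i → pow (- two) k * (zb i * K N k (d ∸ i))))))
        (Sum-*ˡ (suc d) (- two) (λ k → Sum (suc d) (λ i → pow (- two) k * (zb i * K N k (d ∸ i))))) ⟩
  - two * Sum (suc d) (λ k → Sum (suc d) (λ i → pow (- two) k * (zb i * K N k (d ∸ i))))
    ≡⟨ cong (- two *_) (trans (Sum-swap (suc d) (suc d) (λ k i → pow (- two) k * (zb i * K N k (d ∸ i))))
        (Sum-cong (suc d) term)) ⟩
  - two * Sum (suc d) (λ i → zb i * u N (d ∸ i)) ∎
  where
  open ≡-Reasoning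
  zb : ℕ → ℚ
  zb i = zbar N (2 ℕ.* suc i)
  term : ∀ i → i ℕ.< suc d → Sum (suc d) (λ k → pow (- two) k * (zb i * K N k (d ∸ i))) ≡ zb i * u N (d ∸ i)
  term i (s≤s le) = trans (Sum-ext (suc d) λ k → solve 3 (λ p z k → p :* (z :* k) := z :* (p :* k)) refl
      (pow (- two) k) (zb i) (K N k (d ∸ i)))
    (trans (Sum-*ˡ (suc d) (zb i) f) (cong (zb i *_) (trans (cong (λ c → Sum (suc c) f) (sym (ℕP.m∸n+n≡m le)))
      (Sum-extend (suc (d ∸ i)) i f λ k _ → trans (cong (pow (- two) (suc (d ∸ i) ℕ.+ k) *_)
          (K-0 N (suc (d ∸ i) ℕ.+ k) (d ∸ i) (s≤s (ℕP.m≤m+n (d ∸ i) k))))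
          (*-zeroʳ (pow (- two) (suc (d ∸ i) ℕ.+ k)))))))
    where
    f : ℕ → ℚ
    f k = pow (- two) k * K N k (d ∸ i)

conv-cu-0 : ∀ N → conv (cN N) (u N) 0 ≡ 1ℚ
conv-cu-0 N = refl

-- Exact at every truncation, since c and Z use the same truncated ζ̄.
conv-cu : ∀ N d → conv (cN N) (u N) (suc d) ≡ 0ℚ
conv-cu N d = trans (conv-suc (cN N) (u N) d) (trans (cong₂ (λ a b → 1ℚ * a + b) (u-rec N d)
    (trans (Sum-ext (suc d) λ j → *-assoc two (zbar N (2 ℕ.* suc j)) (u N (d ∸ j)))
        (Sum-*ˡ (suc d) two (λ j → zbar N (2 ℕ.* suc j) * u N (d ∸ j)))))
  (solve 1 (λ s → con 1ℚ :* ((:- con two) :* s) :+ con two :* s := con 0ℚ) refl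
      (Sum (suc d) (λ i → zbar N (2 ℕ.* suc i) * u N (d ∸ i)))))

K-log : ∀ k d → LogBounded (λ N → K N k d)
K-log zero zero = lb-const 1ℚ
K-log zero (suc d) = lb-const 0ℚ
K-log (suc k) d = lb-Sum d {λ i N → zbar N (2 ℕ.* suc i) * K N k (d ∸ suc i)} λ i → lb-*
    {λ N → zbar N (2 ℕ.* suc i)} {λ N → K N k (d ∸ suc i)} (zbar-log (i ℕ.+ (suc i ℕ.+ 0)))
    (K-log k (d ∸ suc i))

u-log : ∀ d → LogBounded (λ N → u N d)
u-log d = lb-Sum (suc d) {λ k N → pow (- two) k * K N k d} λ k → lb-* {λ _ → pow (- two) k} {λ N → K N k d}
    (lb-const (pow (- two) k)) (K-log k d)

-- Comparison of the two sides

LHS-E : ∀ N m j → LHS N (suc m) (suc j) ≡ two * Sum N (λ t → pow four m * E m (suc t) *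
    (pow four j * E j (suc t)) * inv (suc (dbl t)) * sgn (suc t))
LHS-E N m j = cong (two *_) (trans (Σ-Sum 1 N (λ n → T n (2 ℕ.* suc m ∸ 2) * T n (2 ℕ.* suc j ∸ 2) * inv
    (2 ℕ.* n ∸ 1) * sgn n))
  (Sum-ext N λ t → cong (_* sgn (suc t)) (cong₂ _*_ (cong₂ _*_ (T-suc m t) (T-suc j t))
      (cong (λ k → inv (k ∸ 1)) (sym (dbl≡2* (suc t)))))))
  where
  T-suc : ∀ m t → T (suc t) (2 ℕ.* suc m ∸ 2) ≡ pow four m * E m (suc t)
  T-suc m t = trans (cong (λ k → T (suc t) (k ∸ 2)) (sym (dbl≡2* (suc m)))) (T-E (suc t) m)

-- LHS will multiply the error between `cS` and `cN`; growth like a power of log N is harmless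
-- against the 1/N there.
LHS-log : ∀ m j → LogBounded (λ N → LHS N (suc m) (suc j))
LHS-log m j = C , suc (dbl m ℕ.+ dbl j) , 0≤C , λ N → ≤-trans
    (≤-reflexive (trans (cong ∣_∣ (LHS-E N m j)) (∣p*q∣≡∣p∣*∣q∣ two (Sum N (F N)))))
    (≤-trans (*-monoˡ two 0≤two (Sum-∣∣ N {F N} {λ t → D N * inv (suc t)} (termB N)))
      (≤-trans (*-monoˡ two 0≤two (≤-trans (≤-reflexive (Sum-*ˡ N (D N) (inv ∘ suc)))
          (*-monoˡ (D N) (0≤D N) (≤-trans (Sum-mono-len (inv ∘ suc) (λ k → 0≤inv (suc k)) (ℕP.n≤1+n N))
          (≤+ˡ {Sum (suc N) (inv ∘ suc)} {1ℚ} 0≤1)))))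
        (≤-reflexive (trans (solve 5 (λ a b P Q h → con two :* (a :* P :* (b :* Q) :* h) := con two :* (a :* b)
            :* (h :* (P :* Q))) refl (pow four m) (pow four j) (pow (η N) (dbl m)) (pow (η N) (dbl j)) (η N))
          (cong (λ t → C * (η N * t)) (sym (pow-+ (η N) (dbl m) (dbl j))))))))
  where
  C : ℚ
  C = two * (pow four m * pow four j)
  0≤4^ : ∀ k → 0ℚ ≤ pow four k
  0≤4^ k = pow-≥0 k (nonNegative⁻¹ four)
  0≤C : 0ℚ ≤ C
  0≤C = ≥0-* 0≤two (≥0-* (0≤4^ m) (0≤4^ j))
  D : ℕ → ℚ
  D N = pow four m * pow (η N) (dbl m) * (pow four j * pow (η N) (dbl j))
  0≤D : ∀ N → 0ℚ ≤ D N
  0≤D N = ≥0-* (≥0-* (0≤4^ m) (pow-≥0 (dbl m) (0≤η N))) (≥0-* (0≤4^ j) (pow-≥0 (dbl j) (0≤η N)))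
  F : ℕ → ℕ → ℚ
  F N t = pow four m * E m (suc t) * (pow four j * E j (suc t)) * inv (suc (dbl t)) * sgn (suc t)
  E≤η : ∀ N t → t ℕ.< N → ∀ m → E m (suc t) ≤ pow (η N) (dbl m)
  E≤η N t l m = ≤-trans (E≤ m (suc t)) (pow-mono (dbl m) (0≤Hn (suc t)) (Hn-mono (ℕP.m≤n⇒m≤1+n l)))
  termB : ∀ N t → t ℕ.< N → ∣ F N t ∣ ≤ D N * inv (suc t)
  termB N t l = ≤-trans (∣*∣≤ {pow four m * E m (suc t) * (pow four j * E j (suc t)) * inv (suc (dbl t))}
      {sgn (suc t)} abs (∣sgn∣≤1 (suc t))) (≤-reflexive (*-identityʳ (D N * inv (suc t))))
    where
    nn : ∀ k → 0ℚ ≤ pow four k * E k (suc t)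
    nn k = ≥0-* (0≤4^ k) (0≤E k (suc t))
    le : ∀ k → pow four k * E k (suc t) ≤ pow four k * pow (η N) (dbl k)
    le k = *-monoˡ (pow four k) (0≤4^ k) (E≤η N t l k)
    abs : ∣ pow four m * E m (suc t) * (pow four j * E j (suc t)) * inv (suc (dbl t)) ∣ ≤ D N * inv (suc t)
    abs = ≤-trans (∣0≤∣ (≥0-* (≥0-* (nn m) (nn j)) (0≤inv (suc (dbl t)))))
      (*-mono (≥0-* (nn m) (nn j)) (0≤inv (suc (dbl t))) (*-mono (nn m) (nn j) (le m) (le j))
          (inv-anti (n≤dbl t)))

A-LHS : ∀ m q N → (λ n → two * pow four m * AN (dbl q) m 0 N n) ≈
    (λ n → Sum (suc q) (λ j → LHS N (suc m) (suc j) * cS (q ∸ j) n))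
A-LHS m q N = ≈-ext {λ n → two * pow four m * AN (dbl q) m 0 N n} {λ n → two * pow four m * S n} (λ _ → refl) eq
    (≈-scale {AN (dbl q) m 0 N} {S} (two * pow four m) (≈-Sum N
        {λ t n → a t * (i t * yS (dbl q) 0 (suc (dbl t)) n)} {λ t n → a t * (i t * ΣA q t n)} λ t _ →
      ≈-scale {λ n → i t * yS (dbl q) 0 (suc (dbl t)) n} {λ n → i t * ΣA q t n} (a t)
          (≈-scale {yS (dbl q) 0 (suc (dbl t))} {ΣA q t} (i t) (y-odd q t))))
  where
  a i : ℕ → ℚ
  a t = sgn (suc t) * E m (suc t)
  i t = inv (suc (dbl t))
  S : ℕ → ℚ
  S n = Sum N (λ t → a t * (i t * ΣA q t n))
  eq : ∀ n → two * pow four m * S n ≡ Sum (suc q) (λ j → LHS N (suc m) (suc j) * cS (q ∸ j) n)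
  eq n = begin
    two * pow four m * S n
      ≡⟨ cong (two * pow four m *_) (Sum-ext N λ t → trans
          (cong (a t *_) (sym (Sum-*ˡ (suc q) (i t) (λ j → g t j))))
          (sym (Sum-*ˡ (suc q) (a t) (λ j → i t * g t j)))) ⟩
    two * pow four m * Sum N (λ t → Sum (suc q) (λ j → a t * (i t * g t j)))
      ≡⟨ cong (two * pow four m *_) (Sum-swap N (suc q) (λ t j → a t * (i t * g t j))) ⟩
    two * pow four m * Sum (suc q) (λ j → Sum N (λ t → a t * (i t * g t j)))
      ≡⟨ sym (Sum-*ˡ (suc q) (two * pow four m) (λ j → Sum N (λ t → a t * (i t * g t j)))) ⟩
    Sum (suc q) (λ j → two * pow four m * Sum N (λ t → a t * (i t * g t j)))
      ≡⟨ Sum-ext (suc q) (λ j → col j) ⟩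
    Sum (suc q) (λ j → LHS N (suc m) (suc j) * cS (q ∸ j) n) ∎
    where
    open ≡-Reasoning
    g : ℕ → ℕ → ℚ
    g t j = pow four j * E j (suc t) * cS (q ∸ j) n
    col : ∀ j → two * pow four m * Sum N (λ t → a t * (i t * g t j)) ≡ LHS N (suc m) (suc j) * cS (q ∸ j) n
    col j = begin
      two * pow four m * Sum N (λ t → a t * (i t * g t j))
        ≡⟨ trans (*-assoc two (pow four m) (Sum N (λ t → a t * (i t * g t j))))
            (cong (two *_) (trans (sym (Sum-*ˡ N (pow four m) (λ t → a t * (i t * g t j)))) (Sum-ext N λ t →
             solve 7 (λ f s e i p e' c → f :* (s :* e :* (i :* (p :* e' :* c))) := f :* e :* (p :* e') :* i :* s
                 :* c) refl (pow four m) (sgn (suc t)) (E m (suc t)) (i t) (pow four j) (E j (suc t))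
                 (cS (q ∸ j) n)))) ⟩
      two * Sum N (λ t → F t * cS (q ∸ j) n)
        ≡⟨ trans (cong (two *_) (Sum-*ʳ N (cS (q ∸ j) n) F)) (sym (*-assoc two (Sum N F) (cS (q ∸ j) n))) ⟩
      two * Sum N F * cS (q ∸ j) n
        ≡⟨ cong (_* cS (q ∸ j) n) (sym (LHS-E N m j)) ⟩
      LHS N (suc m) (suc j) * cS (q ∸ j) n ∎
      where
      F : ℕ → ℚ
      F t = pow four m * E m (suc t) * (pow four j * E j (suc t)) * i t * sgn (suc t)

sgn-dbl : ∀ m → sgn (dbl m) ≡ 1ℚ
sgn-dbl zero = refl
sgn-dbl (suc m) = trans (cong (λ t → - - t) (sgn-dbl m)) refl

-- The W of the right-hand side with its sign; m and q stand for m - 1 and j - 1 of the statement.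
WS : ℕ → ℕ → ℕ → ℚ
WS m N q = sgn m * W N (dbl q ℕ.+ suc (dbl m)) (suc (dbl m))

-- `V-moment` with nothing chosen yet, i = p = 0. The depth is odd, so its sign -1 turns `sgn m`
-- into `sgn (suc m)`.
W-moment : ∀ m q → Bd 1 invs (λ N n → WS m N q - two * pow four m *
    (sgn (suc m) * yS (dbl q) (suc (dbl m)) 0 n))
W-moment m q = bd-ext eq (bd-scale {F = D} {c = λ _ → sgn m * (two * pow four m)} 0≤invs
    (lb-const (sgn m * (two * pow four m)))
    (bd (errC r e) (0≤errC r e) r λ N _ → V-moment r e 0 0 N))
  where
  r = suc (dbl m)
  e = dbl q
  D : ℕ → ℕ → ℚ
  D N n = V r (e ℕ.+ r) 1 0 N - sgn r * (1ℚ * xsS e r 0 n)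
  xs-y : ∀ e n → xsS e r 0 n ≡ yS e r 0 n
  xs-y zero n = GridV.x≡y n zero (dbl m)
  xs-y (suc e) n = GridV.x≡y n (suc e) (dbl m)
  eq : ∀ N → 1 ℕ.≤ N → ∀ n → sgn m * (two * pow four m) * D N n ≡
      WS m N q - two * pow four m * (sgn (suc m) * yS (dbl q) (suc (dbl m)) 0 n)
  eq N _ n = trans (cong₂ (λ a b → sgn m * (two * pow four m) * (V r (e ℕ.+ r) 1 0 N - - a * (1ℚ * b)))
      (sgn-dbl m) (xs-y e n))
    (trans (solve 4 (λ s f v y → s :* (con two :* f) :* (v :- (:- con 1ℚ) :* (con 1ℚ :* y)) := s :*
        (con two :* f :* v) :- con two :* f :* ((:- s) :* y)) refl (sgn m) (pow four m) (V r (e ℕ.+ r) 1 0 N)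
        (yS e r 0 n))
      (cong (λ t → sgn m * t - two * pow four m * (sgn (suc m) * yS e r 0 n))
          (trans (cong (λ p → two * p * V r (e ℕ.+ r) 1 0 N) (sym (pow4 m))) (sym (W-V N (e ℕ.+ r) r)))))

-- A chain of comparisons: LHS convolved with `cN`, then with `cS` (`d₄`), the alternating sum AN
-- (`d₃`), the moment (`d₁`), and W (`d₂`). The mesh occurs in the intermediate terms only and
-- cancels from the total.
conv-small : ∀ m q → Bd 1 invs (λ N _ → conv (λ j → LHS N (suc m) (suc j)) (cN N) q - WS m N q)
conv-small m q = bd-ext {F = λ N n → (d₁ N n + - d₂ N n) + (d₃ N n + - d₄ N n)} eq
    (bd-+ 0≤invs {λ N n → d₁ N n + - d₂ N n} {λ N n → d₃ N n + - d₄ N n}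
      (bd-+ 0≤invs {d₁} {λ N n → - d₂ N n} (bd-scale {F = λ N n → AN e m 0 N n - sgn (suc m) * X n}
          {c = λ _ → t} 0≤invs (lb-const t) (A-moment q m 0)) (bd-neg {F = d₂} (W-moment m q)))
      (bd-+ 0≤invs {d₃} {λ N n → - d₄ N n}
        (bd 0ℚ ≤-refl 0 λ N _ → apx-≤ (≤-reflexive (sym (*-zeroˡ (1ℚ * inv (suc N)))))
            (≈-sym {λ n → t * AN e m 0 N n} {λ n → Sum (suc q) (λ j → LHS N (suc m) (suc j) * cS (q ∸ j) n)}
            (A-LHS m q N)))
        (bd-neg {F = d₄} (bd-Sum (suc q) {λ j N n → LHS N (suc m) (suc j) * (cS (q ∸ j) n - cN N (q ∸ j))} λ j _
            →
          bd-scale {F = λ N n → cS (q ∸ j) n - cN N (q ∸ j)} {c = λ N → LHS N (suc m) (suc j)} 0≤invs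
              (LHS-log m j) (c-limit (q ∸ j))))))
  where
  e = dbl q
  t = two * pow four m
  X : ℕ → ℚ
  X = yS e (suc (dbl m)) 0
  d₁ d₂ d₃ d₄ : ℕ → ℕ → ℚ
  d₁ N n = t * (AN e m 0 N n - sgn (suc m) * X n)
  d₂ N n = WS m N q - t * (sgn (suc m) * X n)
  d₃ N n = Sum (suc q) (λ j → LHS N (suc m) (suc j) * cS (q ∸ j) n) - t * AN e m 0 N n
  d₄ N n = Sum (suc q) (λ j → LHS N (suc m) (suc j) * (cS (q ∸ j) n - cN N (q ∸ j)))
  eq : ∀ N → 1 ℕ.≤ N → ∀ n → (d₁ N n + - d₂ N n) + (d₃ N n + - d₄ N n) ≡
      conv (λ j → LHS N (suc m) (suc j)) (cN N) q - WS m N q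
  eq N _ n = trans (cong (λ s → (d₁ N n + - d₂ N n) + (d₃ N n + - s))
      (trans (Sum-ext (suc q) λ j → solve 3 (λ l a b → l :* (a :- b) := l :* a :- l :* b) refl
      (LHS N (suc m) (suc j)) (cS (q ∸ j) n) (cN N (q ∸ j)))
      (Sum-- (suc q) (λ j → LHS N (suc m) (suc j) * cS (q ∸ j) n)
          (λ j → LHS N (suc m) (suc j) * cN N (q ∸ j)))))
    (solve 6 (λ t a x w S c → t :* (a :- x) :+ :- (w :- t :* x) :+ (S :- t :* a :+ :- (S :- c)) := c :- w) refl
        t (AN e m 0 N n) (sgn (suc m) * X n) (WS m N q)
      (Sum (suc q) (λ j → LHS N (suc m) (suc j) * cS (q ∸ j) n)) (conv (λ j → LHS N (suc m) (suc j)) (cN N) q))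

RHS-conv : ∀ N m q → RHS N (suc m) (suc q) ≡ conv (WS m N) (u N) q
RHS-conv N m q = trans (cong (sgn m *_) (Σ-Sum 1 (suc q)
    (λ j → W N ((2 ℕ.* j) ℕ.+ (2 ℕ.* suc m) ∸ 3) (2 ℕ.* suc m ∸ 1) * Z N j (suc q))))
  (trans (sym (Sum-*ˡ (suc q) (sgn m) (λ j → W N ((2 ℕ.* suc j) ℕ.+ (2 ℕ.* suc m) ∸ 3) (2 ℕ.* suc m ∸ 1) * Z N
      (suc j) (suc q)))) (Sum-cong (suc q) term))
  where
  idx : ∀ j → (2 ℕ.* suc j) ℕ.+ (2 ℕ.* suc m) ∸ 3 ≡ dbl j ℕ.+ suc (dbl m)
  idx j = trans (cong₂ (λ a b → a ℕ.+ b ∸ 3) (sym (dbl≡2* (suc j))) (sym (dbl≡2* (suc m))))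
      (cong (_∸ 1) (ℕP.+-suc (dbl j) (suc (dbl m))))
  term : ∀ j → j ℕ.< suc q → sgn m * (W N ((2 ℕ.* suc j) ℕ.+ (2 ℕ.* suc m) ∸ 3) (2 ℕ.* suc m ∸ 1) * Z N (suc j)
      (suc q)) ≡ WS m N j * u N (q ∸ j)
  term j (s≤s le) = trans (cong (sgn m *_) (cong₂ _*_ (cong₂ (W N) (idx j) (cong (_∸ 1) (sym (dbl≡2* (suc m)))))
      (trans (cong (Z N (suc j)) (cong suc (sym (ℕP.m+[n∸m]≡n le)))) (Z-u N (suc j) (q ∸ j)))))
    (sym (*-assoc (sgn m) (W N (dbl j ℕ.+ suc (dbl m)) (suc (dbl m))) (u N (q ∸ j))))

-- Convolving LHS with c and then with u returns LHS, so the error in `conv-small` is merely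
-- multiplied by values of u, which are bounded by powers of log N.
LHS-RHS : ∀ N m q → LHS N (suc m) (suc q) - RHS N (suc m) (suc q) ≡
    Sum (suc q) (λ j → u N (q ∸ j) * (conv (λ i → LHS N (suc m) (suc i)) (cN N) j - WS m N j))
LHS-RHS N m q = begin
  ℓ q - RHS N (suc m) (suc q)
    ≡⟨ cong₂ _-_ (sym (trans (conv-assoc ℓ (cN N) (u N) q)
        (conv-unit ℓ {conv (cN N) (u N)} (conv-cu-0 N) (conv-cu N) q))) (RHS-conv N m q) ⟩
  conv (conv ℓ (cN N)) (u N) q - conv (WS m N) (u N) q
    ≡⟨ sym (Sum-- (suc q) (λ j → conv ℓ (cN N) j * u N (q ∸ j)) (λ j → WS m N j * u N (q ∸ j))) ⟩
  Sum (suc q) (λ j → conv ℓ (cN N) j * u N (q ∸ j) - WS m N j * u N (q ∸ j))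
    ≡⟨ Sum-ext (suc q) (λ j → solve 3 (λ a b c → a :* c :- b :* c := c :* (a :- b)) refl (conv ℓ (cN N) j)
        (WS m N j) (u N (q ∸ j))) ⟩
  Sum (suc q) (λ j → u N (q ∸ j) * (conv ℓ (cN N) j - WS m N j)) ∎
  where
  open ≡-Reasoning
  ℓ : ℕ → ℚ
  ℓ i = LHS N (suc m) (suc i)

LHS-RHS-null : ∀ m q → Null (λ N → LHS N (suc m) (suc q) - RHS N (suc m) (suc q))
LHS-RHS-null m q = bd⇒null {1} {λ N → LHS N (suc m) (suc q) - RHS N (suc m) (suc q)}
  (bd-ext (λ N _ _ → sym (LHS-RHS N m q)) (bd-Sum (suc q)
      {λ j N _ → u N (q ∸ j) * (conv (λ i → LHS N (suc m) (suc i)) (cN N) j - WS m N j)} λ j _ →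
    bd-scale {F = λ N _ → conv (λ i → LHS N (suc m) (suc i)) (cN N) j - WS m N j} {c = λ N → u N (q ∸ j)} 0≤invs
        (u-log (q ∸ j)) (conv-small m j)))

theorem3p3 : (m p : ℕ) → 1 ℕ.≤ m → 1 ℕ.≤ p →
    (ε : ℚ) → 0ℚ < ε →
    ∃[ N ] ((M : ℕ) → N ℕ.≤ M → ∣ LHS M m p - RHS M m p ∣ < ε)
theorem3p3 (suc m) (suc p) _ _ = LHS-RHS-null m p
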